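{- The equivelar toroids of type $\{3,3,4,3\}$ or $\{3,4,3,3\}$ with exactly $3$ flag-orbits are exactly those of the form $\{3,3,4,3\}/\mathbf{L}$ or $\{3,4,3,3\}/\mathbf{L}$, where $\mathbf{L}$ is either the translation group of $2s\,\mathbb{Z}^4$ for a positive integer $s$, or $2s$ times the lattice group generated by the translations by the vectors $(1,0,1,0)$, $(1,0,-1,0)$, $(0,1,0,1)$ and $(0,1,0,-1)$, for a positive integer $s$.
   Context: $\{3,3,4,3\}$ is the regular tessellation of $\mathbb{E}^4$ by regular cross-polytopes with vertex set $\{x\in\mathbb{Z}^4: x_1\equiv x_2\equiv x_3\equiv x_4\pmod 2\}$, and $\{3,4,3,3\}$ is its dual tessellation by $24$-cells. A toroid $\mathcal{U}/\mathbf{L}$ of such type is the quotient of the tessellation $\mathcal{U}$ by a rank-$4$ lattice group $\mathbf{L}$ of translational symmetries of $\mathcal{U}$; its flags are the $\mathbf{L}$-orbits of flags of $\mathcal{U}$ (chains of faces with one face of each dimension $0,\dots,4$), and its automorphism group $N_{G(\mathcal{U})}(\mathbf{L})/\mathbf{L}$ acts on them by $(\Phi\mathbf{L})(\mathbf{L}S)=(\Phi S)\mathbf{L}$; the number of orbits is the number of flag-orbits. Toroids are considered up to isomorphism (conjugacy of lattice groups by isometries). -}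

module Defs where

open import Level using (Lift)
open import Data.Nat as ℕ using (ℕ; zero; suc; _≥_)
open import Data.Integer as ℤ using (ℤ; +_; _+_; _*_; _-_; ∣_∣)
open import Data.Fin using (Fin; zero; suc; inject₁; opposite)
open import Data.Vec using (Vec; []; _∷_; map; zipWith; lookup; replicate)
open import Data.Vec.Membership.Propositional using (_∈_)
open import Data.Product using (Σ; _×_; _,_; proj₁)
open import Data.Sum using (_⊎_)
open import Relation.Binary.PropositionalEquality using (_≡_; _≢_)
open import Relation.Nullary using (¬_)

-- Points of E⁴ with integer coordinates (all faces of both tessellations
-- have their vertices in ℤ⁴).

Pt : Set
Pt = Vec ℤ 4

_+v_ : ∀ {n} → Vec ℤ n → Vec ℤ n → Vec ℤ n
_+v_ = zipWith _+_

_-v_ : ∀ {n} → Vec ℤ n → Vec ℤ n → Vec ℤ n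
_-v_ = zipWith _-_

_·v_ : ∀ {n} → ℤ → Vec ℤ n → Vec ℤ n
k ·v v = map (k *_) v

zeroV : Pt
zeroV = replicate 4 (+ 0)

dot : ∀ {n} → Vec ℤ n → Vec ℤ n → ℤ
dot [] [] = + 0
dot (x ∷ xs) (y ∷ ys) = x * y + dot xs ys

norm2 : Pt → ℤ
norm2 x = dot x x

dist2 : Pt → Pt → ℤ
dist2 x y = norm2 (x -v y)

numOdd : Pt → ℕ
numOdd x = Data.Vec.sum (map (λ z → ∣ z ∣ ℕ.% 2) x)

-- vertex set of {3,3,4,3}: x₁ ≡ x₂ ≡ x₃ ≡ x₄ (mod 2)
Vtx : Pt → Set
Vtx x = numOdd x ≡ 0 ⊎ numOdd x ≡ 4

-- centres of the cross-polytope tiles of {3,3,4,3}: exactly two odd coordinates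
Cen : Pt → Set
Cen c = numOdd c ≡ 2

-- Faces, identified with their vertex sets (predicates on ℤ⁴).

Pred : Set₁
Pred = Pt → Set

_⊆_ : Pred → Pred → Set
F ⊆ G = ∀ x → F x → G x

_≐_ : Pred → Pred → Set
F ≐ G = (F ⊆ G) × (G ⊆ F)

-- vertex set of the cross-polytope tile of {3,3,4,3} centred at c
TileU : Pt → Pred
TileU c x = Vtx x × dist2 x c ≡ + 2

-- a k-face (k ≤ 3) of the tessellation {3,3,4,3}: the vertex set of a proper
-- face of some tile, i.e. k+1 distinct vertices of that cross-polytope
-- containing no antipodal pair.
SubFace : ℕ → Pred → Set
SubFace k F =
  Σ Pt λ c → Cen c × Σ (Vec Pt (suc k)) λ vs →
    (∀ i → TileU c (lookup vs i)) ×
    (∀ i j → i ≢ j → (lookup vs i ≢ lookup vs j) ×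
                      ((lookup vs i +v lookup vs j) ≢ (+ 2) ·v c)) ×
    (∀ x → (F x → x ∈ vs) × (x ∈ vs → F x))

FaceU : Fin 5 → Pred → Set
FaceU zero F = SubFace 0 F
FaceU (suc zero) F = SubFace 1 F
FaceU (suc (suc zero)) F = SubFace 2 F
FaceU (suc (suc (suc zero))) F = SubFace 3 F
FaceU (suc (suc (suc (suc zero)))) F = Σ Pt λ c → Cen c × F ≐ TileU c

-- the dual face of a face F of {3,3,4,3}: its vertices are the centres of
-- the tiles containing F
Dual : Pred → Pred
Dual F w = Cen w × (F ⊆ TileU w)

-- faces of the dual tessellation {3,4,3,3}: a j-face is the dual of a
-- (4-j)-face of {3,3,4,3}
FaceD : Fin 5 → Pred → Set₁
FaceD j G = Σ Pred λ F → FaceU (opposite j) F × G ≐ Dual F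

data Kind : Set where
  cross : Kind   -- {3,3,4,3}
  icosi : Kind   -- {3,4,3,3}

Face : Kind → Fin 5 → Pred → Set₁
Face cross k F = Lift _ (FaceU k F)
Face icosi k F = FaceD k F

-- Isometries.  Every isometry preserving either tessellation has the form
-- x ↦ (M x + b)/2 with M an integer matrix and b an integer vector; we
-- represent it by (M , b).

record Aff : Set where
  constructor aff
  field
    M : Vec Pt 4
    b : Pt
open Aff public

_·m_ : Vec Pt 4 → Pt → Pt
M ·m x = map (λ row → dot row x) M

-- (1/2) M is orthogonal
IsIso : Aff → Set
IsIso g = ∀ x → norm2 (M g ·m x) ≡ (+ 4) * norm2 x

Maps : Aff → Pt → Pt → Set
Maps g x y = (M g ·m x) +v b g ≡ (+ 2) ·v y

img : Aff → Pred → Pred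
img g F y = Σ Pt λ x → F x × Maps g x y

-- g is a symmetry of the tessellation T: an isometry mapping the set of
-- tiles of T onto itself
Sym : Kind → Aff → Set₁
Sym T g = IsIso g ×
  (∀ C → Face T (opposite zero) C → Face T (opposite zero) (img g C)) ×
  (∀ C' → Face T (opposite zero) C' →
     Σ Pred λ C → Face T (opposite zero) C × img g C ≐ C')

-- Lattice groups, given by a basis of translation vectors.

idRows : Vec Pt 4
idRows = (+ 1 ∷ + 0 ∷ + 0 ∷ + 0 ∷ []) ∷ (+ 0 ∷ + 1 ∷ + 0 ∷ + 0 ∷ []) ∷
         (+ 0 ∷ + 0 ∷ + 1 ∷ + 0 ∷ []) ∷ (+ 0 ∷ + 0 ∷ + 0 ∷ + 1 ∷ []) ∷ []

transl : Pt → Aff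
transl t = aff (map ((+ 2) ·v_) idRows) ((+ 2) ·v t)

lincomb : ∀ {n} → Vec ℤ n → Vec Pt n → Pt
lincomb [] [] = zeroV
lincomb (k ∷ ks) (v ∷ vs) = (k ·v v) +v lincomb ks vs

InLat : Vec Pt 4 → Pt → Set
InLat B x = Σ (Vec ℤ 4) λ k → x ≡ lincomb k B

Independent : Vec Pt 4 → Set
Independent B = ∀ k → lincomb k B ≡ zeroV → k ≡ replicate 4 (+ 0)

LatticeGroup : Kind → Vec Pt 4 → Set₁
LatticeGroup T B = (∀ i → Sym T (transl (lookup B i))) × Independent B

-- g L(B) g⁻¹ = L(B')  (conjugating translation by t gives translation by (1/2) M t)
ConjBy : Aff → Vec Pt 4 → Vec Pt 4 → Set
ConjBy g B B' =
  (∀ t → InLat B t → Σ Pt λ t' → InLat B' t' × (M g ·m t ≡ (+ 2) ·v t')) ×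
  (∀ t' → InLat B' t' → Σ Pt λ t → InLat B t × (M g ·m t ≡ (+ 2) ·v t'))

-- L(B) and L(B') are conjugate in G(T)  (T/L(B) ≅ T/L(B'))
Conj : Kind → Vec Pt 4 → Vec Pt 4 → Set₁
Conj T B B' = Σ Aff λ g → Sym T g × ConjBy g B B'

Flag : Kind → Set₁
Flag T = Σ (Fin 5 → Pred) λ Φ →
  (∀ k → Face T k (Φ k)) × (∀ (k : Fin 4) → Φ (inject₁ k) ⊆ Φ (suc k))

-- Φ and Ψ lie in the same orbit under N_{G(T)}(L(B))
SameOrbit : (T : Kind) → Vec Pt 4 → Flag T → Flag T → Set₁
SameOrbit T B Φ Ψ = Σ Aff λ g → Sym T g × ConjBy g B B ×
  (∀ k → img g (proj₁ Φ k) ≐ proj₁ Ψ k)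

ThreeFlagOrbits : Kind → Vec Pt 4 → Set₁
ThreeFlagOrbits T B = Σ (Flag T) λ Φ₁ → Σ (Flag T) λ Φ₂ → Σ (Flag T) λ Φ₃ →
  ¬ SameOrbit T B Φ₁ Φ₂ × ¬ SameOrbit T B Φ₁ Φ₃ × ¬ SameOrbit T B Φ₂ Φ₃ ×
  (∀ (Ψ : Flag T) → SameOrbit T B Φ₁ Ψ ⊎ SameOrbit T B Φ₂ Ψ ⊎ SameOrbit T B Φ₃ Ψ)

cubicBasis : ℕ → Vec Pt 4
cubicBasis s = map ((+ (2 ℕ.* s)) ·v_) idRows

L2Basis : ℕ → Vec Pt 4
L2Basis s = map ((+ (2 ℕ.* s)) ·v_)
  ((+ 1 ∷ + 0 ∷ + 1 ∷ + 0 ∷ []) ∷ (+ 1 ∷ + 0 ∷ ℤ.- + 1 ∷ + 0 ∷ []) ∷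
   (+ 0 ∷ + 1 ∷ + 0 ∷ + 1 ∷ []) ∷ (+ 0 ∷ + 1 ∷ + 0 ∷ ℤ.- + 1 ∷ []) ∷ [])

{-# OPTIONS --safe #-}
module Submission where

open import Defs
open import Level using (lift; lower)
open import Data.Bool using (Bool; true; false; _xor_)
open import Data.Empty using (⊥; ⊥-elim)
open import Data.Fin using (Fin; zero; suc; inject₁; opposite)
open import Data.Fin.Patterns using (1F; 2F; 3F; 4F)
open import Data.Fin.Properties using (all?) renaming (_≟_ to _≟F_)
open import Data.Integer as ℤ using (ℤ; +_; -[1+_]; -_; _+_; _*_; _-_; ∣_∣; _≤_; _<_; +≤+)
import Data.Integer.Properties as ℤP
open import Data.Integer.Tactic.RingSolver using (solve-∀)
open import Data.Nat as ℕ using (ℕ; zero; suc; _≥_; s≤s; z≤n)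
open import Data.Nat.Divisibility using (divides)
open import Data.Nat.GCD using (gcd; gcd-GCD; gcd[m,n]∣m; gcd[m,n]∣n; module Bézout)
import Data.Nat.Properties as ℕP
open import Data.Product using (Σ; _×_; _,_; proj₁; proj₂)
open import Data.Sum using (_⊎_; inj₁; inj₂; [_,_]′)
open import Data.Unit using (⊤; tt)
open import Data.Vec using (Vec; []; _∷_; head; tail; map; lookup; replicate; tabulate)
open import Data.Vec.Membership.Propositional using (_∈_)
open import Data.Vec.Membership.Propositional.Properties using (∈-lookup)
open import Data.Vec.Properties using (lookup∘tabulate; ≡-dec)
open import Data.Vec.Relation.Binary.Pointwise.Inductive using (Pointwise; []; _∷_)
open import Data.Vec.Relation.Unary.All using (All; []; _∷_)
open import Data.Vec.Relation.Unary.Any using (here; there; index)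
open import Data.Vec.Relation.Unary.Any.Properties using (lookup-index)
open import Relation.Binary.PropositionalEquality
open import Relation.Nullary using (¬_; Dec; yes; no)
open import Relation.Nullary.Decidable using (toWitness; _→-dec_; _×-dec_; ¬?)

-- Let V be the vertex lattice of {3,3,4,3} and let D be the union of V and the set of tile centres; V and D are dual to
-- each other up to scale.  The symmetries of both tessellations are the maps x ↦ Nx + t with t ∈ V and N in the finite
-- group W of isometries preserving V and D, and they act simply transitively on the flags.  Hence the flag orbits of T/L
-- correspond to the distinct lattices N⁻¹L with N ∈ W.
--
-- If there are three of them, W permutes them, and the relations between its reflections show that one of the three
-- lattices is invariant under all signed permutations of the coordinates, or under their conjugates by the similarity
-- ρ(a,b,c,d) = (a+c, b+d, a-c, b-d), ρ² = 2.  Looking modulo 2, a lattice invariant under signed permutations is a multiple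
-- of Z⁴, D or V; multiples of D and V are W-invariant, which leaves those of Z⁴ and ρZ⁴, and these must be even to lie in V.
-- Conversely, W maps 2Z⁴ to the three lattices spanned by the orthogonal frames of vectors of norm 4 in V.

-- The group W is the Weyl group of type F₄, of order 1152, and it is never listed: an isometry is
-- recognised as a member on generators of V and D, and flag transitivity comes from comparing Gram
-- matrices. The faces of {3,4,3,3} are given as sets of tile centres; a flag of it becomes a flag
-- of {3,3,4,3} only because a face can be recovered from the tiles that contain it. The number
-- three enters through permutations: a nontrivial involution of three points is a transposition,
-- with one fixed point. Braid relations make the reflections in roots of one length all act
-- trivially or all nontrivially; a long and an orthogonal short root give commuting transpositions,
-- which share that point. The similarity ρ exchanges the root lengths, realising the symmetry of
-- the F₄ diagram; it produces the second family from the first and carries the orbit count along.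
-- Divided by its content, a lattice invariant under signed permutations contains 2Z⁴, so it amounts
-- to a nonzero permutation-invariant binary code of length 4: everything, the even-weight code or
-- the repetition code.

pattern v4 a b c d = a Vec.∷ b Vec.∷ c Vec.∷ d Vec.∷ Vec.[]

v4≡ : ∀ {a b c d a' b' c' d' : ℤ} → a ≡ a' → b ≡ b' → c ≡ c' → d ≡ d' →
      _≡_ {A = Pt} (v4 a b c d) (v4 a' b' c' d')
v4≡ refl refl refl refl = refl

-- Parity of integers

Even Odd : ℤ → Set
Even z = Σ ℤ λ k → z ≡ + 2 * k
Odd z = Σ ℤ λ k → z ≡ + 1 + + 2 * k

even-+ : ∀ {a b} → Even a → Even b → Even (a + b)
even-+ (k , refl) (l , refl) = k + l , lem k l
  where lem : ∀ k l → + 2 * k + + 2 * l ≡ + 2 * (k + l)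
        lem = solve-∀

even-* : ∀ a {b} → Even b → Even (a * b)
even-* a (k , refl) = a * k , lem a k
  where lem : ∀ a k → a * (+ 2 * k) ≡ + 2 * (a * k)
        lem = solve-∀

even-neg : ∀ {a} → Even a → Even (- a)
even-neg (k , refl) = - k , lem k
  where lem : ∀ k → - (+ 2 * k) ≡ + 2 * (- k)
        lem = solve-∀

even-- : ∀ {a b} → Even a → Even b → Even (a - b)
even-- p q = even-+ p (even-neg q)

even-0 : Even (+ 0)
even-0 = + 0 , refl

two≢one : ∀ k → + 2 * k ≢ + 1
two≢one k e = lem ∣ k ∣ (trans (sym (ℤP.abs-* (+ 2) k)) (cong ∣_∣ e))
  where lem : ∀ n → 2 ℕ.* n ≢ 1
        lem zero ()
        lem (suc n) p with trans (sym (ℕP.+-suc n (n ℕ.+ 0))) (ℕP.suc-injective p)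
        ... | ()

¬even∧odd : ∀ {z} → Even z → Odd z → ⊥
¬even∧odd (k , refl) (l , e) = two≢one (k - l) (trans (lem k l) (trans (cong (_- + 2 * l) e) (lem' l)))
  where lem : ∀ k l → + 2 * (k - l) ≡ + 2 * k - + 2 * l
        lem = solve-∀
        lem' : ∀ l → + 1 + + 2 * l - + 2 * l ≡ + 1
        lem' = solve-∀

parity% : ∀ z → (Even z × ∣ z ∣ ℕ.% 2 ≡ 0) ⊎ (Odd z × ∣ z ∣ ℕ.% 2 ≡ 1)
parity% (+ n) = nat n
  where
  nat : ∀ n → (Even (+ n) × n ℕ.% 2 ≡ 0) ⊎ (Odd (+ n) × n ℕ.% 2 ≡ 1)
  nat 0 = inj₁ (even-0 , refl)
  nat 1 = inj₂ ((+ 0 , refl) , refl)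
  nat (suc (suc n)) with nat n
  ... | inj₁ ((k , e) , p) = inj₁ ((+ 1 + k , trans (cong (λ z → + 2 + z) e) (lem k)) , p)
    where lem : ∀ k → + 2 + + 2 * k ≡ + 2 * (+ 1 + k)
          lem = solve-∀
  ... | inj₂ ((k , e) , p) = inj₂ ((+ 1 + k , trans (cong (λ z → + 2 + z) e) (lem k)) , p)
    where lem : ∀ k → + 2 + (+ 1 + + 2 * k) ≡ + 1 + + 2 * (+ 1 + k)
          lem = solve-∀
parity% -[1+ n ] with parity% (+ suc n)
... | inj₁ (e , p) = inj₁ (even-neg e , p)
... | inj₂ ((k , e) , p) = inj₂ ((- k - + 1 , trans (cong -_ e) (lem k)) , p)
  where lem : ∀ k → - (+ 1 + + 2 * k) ≡ + 1 + + 2 * (- k - + 1)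
        lem = solve-∀

parity : ∀ z → Even z ⊎ Odd z
parity z with parity% z
... | inj₁ (e , _) = inj₁ e
... | inj₂ (o , _) = inj₂ o

odd-odd : ∀ {a b} → Odd a → Odd b → Even (a - b)
odd-odd (k , refl) (l , refl) = k - l , lem k l
  where lem : ∀ k l → + 1 + + 2 * k - (+ 1 + + 2 * l) ≡ + 2 * (k - l)
        lem = solve-∀

-- Summed over the coordinates, this makes the norm of a vector congruent to its coordinate sum
-- modulo 2.
even-square-diff : ∀ z → Even (z * z - z)
even-square-diff z with parity z
... | inj₁ (k , refl) = k * (+ 2 * k - + 1) , lem k
  where lem : ∀ k → + 2 * k * (+ 2 * k) - + 2 * k ≡ + 2 * (k * (+ 2 * k - + 1))
        lem = solve-∀
... | inj₂ (k , refl) = (+ 1 + + 2 * k) * k , lem k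
  where lem : ∀ k → (+ 1 + + 2 * k) * (+ 1 + + 2 * k) - (+ 1 + + 2 * k) ≡ + 2 * ((+ 1 + + 2 * k) * k)
        lem = solve-∀

cancel2 : ∀ {a b} → + 2 * a ≡ + 2 * b → a ≡ b
cancel2 {a} {b} = ℤP.*-cancelˡ-≡ (+ 2) a b

cancel4 : ∀ {a b} → + 4 * a ≡ + 4 * b → a ≡ b
cancel4 {a} {b} = ℤP.*-cancelˡ-≡ (+ 4) a b

-- Vectors and the inner product

2v-cancel : ∀ {n} {x y : Vec ℤ n} → (+ 2) ·v x ≡ (+ 2) ·v y → x ≡ y
2v-cancel {x = []} {[]} _ = refl
2v-cancel {x = a ∷ x} {c ∷ y} e =
  cong₂ _∷_ (cancel2 (cong head e)) (2v-cancel (cong tail e))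

dot-comm : ∀ {n} (x y : Vec ℤ n) → dot x y ≡ dot y x
dot-comm [] [] = refl
dot-comm (a ∷ x) (c ∷ y) = cong₂ _+_ (ℤP.*-comm a c) (dot-comm x y)

dot-+ʳ : ∀ {n} (x y z : Vec ℤ n) → dot x (y +v z) ≡ dot x y + dot x z
dot-+ʳ [] [] [] = refl
dot-+ʳ (a ∷ x) (b ∷ y) (c ∷ z) = trans (cong (λ t → a * (b + c) + t) (dot-+ʳ x y z)) (lem a b c (dot x y) (dot x z))
  where lem : ∀ a b c p q → a * (b + c) + (p + q) ≡ a * b + p + (a * c + q)
        lem = solve-∀

dot-·ʳ : ∀ {n} (x : Vec ℤ n) k (y : Vec ℤ n) → dot x (k ·v y) ≡ k * dot x y
dot-·ʳ [] k [] = sym (ℤP.*-zeroʳ k)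
dot-·ʳ (a ∷ x) k (b ∷ y) = trans (cong (λ t → a * (k * b) + t) (dot-·ʳ x k y)) (lem a b k (dot x y))
  where lem : ∀ a b k p → a * (k * b) + k * p ≡ k * (a * b + p)
        lem = solve-∀

dot--ʳ : ∀ {n} (x y z : Vec ℤ n) → dot x (y -v z) ≡ dot x y - dot x z
dot--ʳ [] [] [] = refl
dot--ʳ (a ∷ x) (b ∷ y) (c ∷ z) = trans (cong (λ t → a * (b - c) + t) (dot--ʳ x y z)) (lem a b c (dot x y) (dot x z))
  where lem : ∀ a b c p q → a * (b - c) + (p - q) ≡ a * b + p - (a * c + q)
        lem = solve-∀

dot-+ˡ : ∀ {n} (x y z : Vec ℤ n) → dot (x +v y) z ≡ dot x z + dot y z
dot-+ˡ x y z = trans (dot-comm (x +v y) z) (trans (dot-+ʳ z x y) (cong₂ _+_ (dot-comm z x) (dot-comm z y)))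

dot-·ˡ : ∀ {n} k (x y : Vec ℤ n) → dot (k ·v x) y ≡ k * dot x y
dot-·ˡ k x y = trans (dot-comm (k ·v x) y) (trans (dot-·ʳ y k x) (cong (k *_) (dot-comm y x)))

dot--ˡ : ∀ {n} (x y z : Vec ℤ n) → dot (x -v y) z ≡ dot x z - dot y z
dot--ˡ x y z = trans (dot-comm (x -v y) z) (trans (dot--ʳ z x y) (cong₂ _-_ (dot-comm z x) (dot-comm z y)))

dot-zeroʳ : ∀ {n} (x : Vec ℤ n) → dot x (replicate n (+ 0)) ≡ + 0
dot-zeroʳ [] = refl
dot-zeroʳ (a ∷ x) = cong₂ _+_ (ℤP.*-zeroʳ a) (dot-zeroʳ x)

norm-+ : ∀ x y → norm2 (x +v y) ≡ norm2 x + + 2 * dot x y + norm2 y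
norm-+ x y rewrite dot-+ˡ x y (x +v y) | dot-+ʳ x x y | dot-+ʳ y x y | dot-comm y x = lem (dot x x) (dot x y) (dot y y)
  where lem : ∀ a b c → a + b + (b + c) ≡ a + + 2 * b + c
        lem = solve-∀

norm-- : ∀ x y → norm2 (x -v y) ≡ norm2 x - + 2 * dot x y + norm2 y
norm-- x y rewrite dot--ˡ x y (x -v y) | dot--ʳ x x y | dot--ʳ y x y | dot-comm y x = lem (dot x x) (dot x y) (dot y y)
  where lem : ∀ a b c → a - b - (b - c) ≡ a - + 2 * b + c
        lem = solve-∀

norm-· : ∀ k x → norm2 (k ·v x) ≡ k * k * norm2 x
norm-· k x = trans (dot-·ˡ k x (k ·v x)) (trans (cong (k *_) (dot-·ʳ x k x)) (sym (ℤP.*-assoc k k (norm2 x))))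

0≤sq : ∀ a → + 0 ≤ a * a
0≤sq (+ n) = subst (+ 0 ≤_) (ℤP.pos-* n n) (+≤+ z≤n)
0≤sq -[1+ n ] = +≤+ z≤n

0≤dot : ∀ {n} (x : Vec ℤ n) → + 0 ≤ dot x x
0≤dot [] = +≤+ z≤n
0≤dot (a ∷ x) = ℤP.+-mono-≤ (0≤sq a) (0≤dot x)

sum-zero : ∀ {a b} → + 0 ≤ a → + 0 ≤ b → a + b ≡ + 0 → a ≡ + 0 × b ≡ + 0
sum-zero {+ m} {+ n} _ _ e =
  cong +_ (ℕP.m+n≡0⇒m≡0 m (ℤP.+-injective e)) , cong +_ (ℕP.m+n≡0⇒n≡0 m (ℤP.+-injective e))
sum-zero {+ _} { -[1+ _ ]} _ () _
sum-zero { -[1+ _ ]} () _ _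

sq-zero : ∀ a → a * a ≡ + 0 → a ≡ + 0
sq-zero a e = [ (λ p → p) , (λ p → p) ]′ (ℤP.i*j≡0⇒i≡0∨j≡0 a e)

dot-zero : ∀ {n} (x : Vec ℤ n) → dot x x ≡ + 0 → x ≡ replicate n (+ 0)
dot-zero [] _ = refl
dot-zero (a ∷ x) e with sum-zero (0≤sq a) (0≤dot x) e
... | p , q = cong₂ _∷_ (sq-zero a p) (dot-zero x q)

-v-zero : ∀ {n} (x y : Vec ℤ n) → x -v y ≡ replicate n (+ 0) → x ≡ y
-v-zero [] [] _ = refl
-v-zero (a ∷ x) (c ∷ y) e =
  cong₂ _∷_ (ℤP.i-j≡0⇒i≡j a c (cong head e)) (-v-zero x y (cong tail e))

dist-zero : ∀ x y → dist2 x y ≡ + 0 → x ≡ y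
dist-zero x y e = -v-zero x y (dot-zero (x -v y) e)

-- Tested against `x -v y`, the hypothesis gives this difference norm zero.
dot-ext : ∀ x y → (∀ z → dot x z ≡ dot y z) → x ≡ y
dot-ext x y h = dist-zero x y
  (trans (dot--ˡ x y (x -v y)) (ℤP.i≡j⇒i-j≡0 (h (x -v y))))

-- Matrices

·m-+ : ∀ m x y → m ·m (x +v y) ≡ (m ·m x) +v (m ·m y)
·m-+ (v4 p q r s) x y = v4≡ (dot-+ʳ p x y) (dot-+ʳ q x y) (dot-+ʳ r x y) (dot-+ʳ s x y)

·m-- : ∀ m x y → m ·m (x -v y) ≡ (m ·m x) -v (m ·m y)
·m-- (v4 p q r s) x y = v4≡ (dot--ʳ p x y) (dot--ʳ q x y) (dot--ʳ r x y) (dot--ʳ s x y)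

·m-· : ∀ m k x → m ·m (k ·v x) ≡ k ·v (m ·m x)
·m-· (v4 p q r s) k x = v4≡ (dot-·ʳ p k x) (dot-·ʳ q k x) (dot-·ʳ r k x) (dot-·ʳ s k x)

·m-zero : ∀ m → m ·m zeroV ≡ zeroV
·m-zero (v4 p q r s) = v4≡ (dot-zeroʳ p) (dot-zeroʳ q) (dot-zeroʳ r) (dot-zeroʳ s)

·m-lincomb : ∀ {n} m (k : Vec ℤ n) vs → m ·m lincomb k vs ≡ lincomb k (map (m ·m_) vs)
·m-lincomb m [] [] = ·m-zero m
·m-lincomb m (k ∷ ks) (v ∷ vs) =
  trans (·m-+ m (k ·v v) (lincomb ks vs)) (cong₂ _+v_ (·m-· m k v) (·m-lincomb m ks vs))

tr : Vec Pt 4 → Vec Pt 4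
tr (v4 (v4 a b c d) (v4 e f g h) (v4 i j k l) (v4 m n o p)) =
  v4 (v4 a e i m) (v4 b f j n) (v4 c g k o) (v4 d h l p)

tr-·m : ∀ m x → tr m ·m x ≡ lincomb x m
tr-·m (v4 (v4 a b c d) (v4 e f g h) (v4 i j k l) (v4 m n o p)) (v4 x y z w) =
  v4≡ (l4 a e i m) (l4 b f j n) (l4 c g k o) (l4 d h l p)
  where
  l4 : ∀ a b c d → a * x + (b * y + (c * z + (d * w + + 0))) ≡ x * a + (y * b + (z * c + (w * d + + 0)))
  l4 a b c d = cong₂ _+_ (ℤP.*-comm a x) (cong₂ _+_ (ℤP.*-comm b y) (cong₂ _+_ (ℤP.*-comm c z) (cong (_+ + 0) (ℤP.*-comm d w))))

dot-lincomb : ∀ {n} (m : Vec Pt n) x y → dot (lincomb y m) x ≡ dot (map (λ r → dot r x) m) y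
dot-lincomb [] (v4 _ _ _ _) [] = refl
dot-lincomb (r ∷ m) x (k ∷ y) =
  trans (dot-+ˡ (k ·v r) (lincomb y m) x)
        (cong₂ _+_ (trans (dot-·ˡ k r x) (ℤP.*-comm k (dot r x))) (dot-lincomb m x y))

adjoint : ∀ m x y → dot (m ·m x) y ≡ dot x (tr m ·m y)
adjoint m x y = trans (sym (dot-lincomb m x y))
  (trans (dot-comm (lincomb y m) x) (cong (dot x) (sym (tr-·m m y))))

-- The lattices V and D

-- `D` is the root lattice of type D₄ and `V` is twice its dual lattice. Differences from the first
-- coordinate are used in `V` so that a witness expresses every coordinate through `a`.
V D : Pt → Set
V (v4 a b c d) = Even (a - b) × Even (a - c) × Even (a - d)
D (v4 a b c d) = Even (a + (b + (c + d)))

Parity : Bool → ℤ → Set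
Parity false = Even
Parity true  = Odd

bit : Bool → ℕ
bit false = 0
bit true  = 1

parityBit : ∀ z → Σ Bool λ p → Parity p z × ∣ z ∣ ℕ.% 2 ≡ bit p
parityBit z with parity% z
... | inj₁ (e , q) = false , e , q
... | inj₂ (o , q) = true , o , q

pr-+ : ∀ {p q a b} → Parity p a → Parity q b → Parity (p xor q) (a + b)
pr-+ {false} {false} e f = even-+ e f
pr-+ {false} {true} (k , refl) (l , refl) = k + l , lem k l
  where lem : ∀ k l → + 2 * k + (+ 1 + + 2 * l) ≡ + 1 + + 2 * (k + l)
        lem = solve-∀
pr-+ {true} {false} (k , refl) (l , refl) = k + l , lem k l
  where lem : ∀ k l → + 1 + + 2 * k + + 2 * l ≡ + 1 + + 2 * (k + l)
        lem = solve-∀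
pr-+ {true} {true} (k , refl) (l , refl) = + 1 + k + l , lem k l
  where lem : ∀ k l → + 1 + + 2 * k + (+ 1 + + 2 * l) ≡ + 2 * (+ 1 + k + l)
        lem = solve-∀

pr-neg : ∀ {p a} → Parity p a → Parity p (- a)
pr-neg {false} e = even-neg e
pr-neg {true} (k , refl) = - k - + 1 , lem k
  where lem : ∀ k → - (+ 1 + + 2 * k) ≡ + 1 + + 2 * (- k - + 1)
        lem = solve-∀

pr-- : ∀ {p q a b} → Parity p a → Parity q b → Parity (p xor q) (a - b)
pr-- {p} {q} e f = pr-+ {p} {q} e (pr-neg {q} f)

-- The parity of the number of odd coordinates decides membership in `D`, and this number is 0 or 4
-- exactly on `V`. The trichotomy connects the counts behind `Vtx` and `Cen` with the two subgroups.
data Class (x : Pt) : Set where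
  is-vtx  : V x → D x → Vtx x → Class x
  is-cen  : ¬ V x → D x → Cen x → Class x
  is-none : ¬ V x → ¬ D x → numOdd x ≡ 1 ⊎ numOdd x ≡ 3 → Class x

classify : ∀ x → Class x
classify (v4 a b c d) with parityBit a | parityBit b | parityBit c | parityBit d
... | p , pa , ea | q , pb , eb | r , pc , ec | s , pd , ed =
  go p q r s (pr-- {p} {q} pa pb) (pr-- {p} {r} pa pc) (pr-- {p} {s} pa pd) (pr-+ {p} pa (pr-+ {q} pb (pr-+ {r} {s} pc pd)))
    (cong₂ ℕ._+_ ea (cong₂ ℕ._+_ eb (cong₂ ℕ._+_ ec (cong₂ ℕ._+_ ed refl))))
  where
  go : ∀ p q r s → Parity (p xor q) (a - b) → Parity (p xor r) (a - c) → Parity (p xor s) (a - d) →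
       Parity (p xor (q xor (r xor s))) (a + (b + (c + d))) →
       numOdd (v4 a b c d) ≡ bit p ℕ.+ (bit q ℕ.+ (bit r ℕ.+ (bit s ℕ.+ 0))) → Class (v4 a b c d)
  go false false false false ab ac ad dd n = is-vtx (ab , ac , ad) dd (inj₁ n)
  go false false false true ab ac ad dd n = is-none (λ v → ¬even∧odd (proj₂ (proj₂ v)) ad) (λ e → ¬even∧odd e dd) (inj₁ n)
  go false false true false ab ac ad dd n = is-none (λ v → ¬even∧odd (proj₁ (proj₂ v)) ac) (λ e → ¬even∧odd e dd) (inj₁ n)
  go false false true true ab ac ad dd n = is-cen (λ v → ¬even∧odd (proj₁ (proj₂ v)) ac) dd n
  go false true false false ab ac ad dd n = is-none (λ v → ¬even∧odd (proj₁ v) ab) (λ e → ¬even∧odd e dd) (inj₁ n)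
  go false true false true ab ac ad dd n = is-cen (λ v → ¬even∧odd (proj₁ v) ab) dd n
  go false true true false ab ac ad dd n = is-cen (λ v → ¬even∧odd (proj₁ v) ab) dd n
  go false true true true ab ac ad dd n = is-none (λ v → ¬even∧odd (proj₁ v) ab) (λ e → ¬even∧odd e dd) (inj₂ n)
  go true false false false ab ac ad dd n = is-none (λ v → ¬even∧odd (proj₁ v) ab) (λ e → ¬even∧odd e dd) (inj₁ n)
  go true false false true ab ac ad dd n = is-cen (λ v → ¬even∧odd (proj₁ v) ab) dd n
  go true false true false ab ac ad dd n = is-cen (λ v → ¬even∧odd (proj₁ v) ab) dd n
  go true false true true ab ac ad dd n = is-none (λ v → ¬even∧odd (proj₁ v) ab) (λ e → ¬even∧odd e dd) (inj₂ n)
  go true true false false ab ac ad dd n = is-cen (λ v → ¬even∧odd (proj₁ (proj₂ v)) ac) dd n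
  go true true false true ab ac ad dd n = is-none (λ v → ¬even∧odd (proj₁ (proj₂ v)) ac) (λ e → ¬even∧odd e dd) (inj₂ n)
  go true true true false ab ac ad dd n = is-none (λ v → ¬even∧odd (proj₂ (proj₂ v)) ad) (λ e → ¬even∧odd e dd) (inj₂ n)
  go true true true true ab ac ad dd n = is-vtx (ab , ac , ad) dd (inj₂ n)

V⇒Vtx : ∀ {x} → V x → Vtx x
V⇒Vtx {x} v with classify x
... | is-vtx _ _ n = n
... | is-cen ¬v _ _ = ⊥-elim (¬v v)
... | is-none ¬v _ _ = ⊥-elim (¬v v)

Vtx⇒V : ∀ {x} → Vtx x → V x
Vtx⇒V {x} n with classify x
Vtx⇒V n | is-vtx v _ _ = v
Vtx⇒V (inj₁ n) | is-cen _ _ m with trans (sym n) m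
... | ()
Vtx⇒V (inj₂ n) | is-cen _ _ m with trans (sym n) m
... | ()
Vtx⇒V (inj₁ n) | is-none _ _ (inj₁ m) with trans (sym n) m
... | ()
Vtx⇒V (inj₁ n) | is-none _ _ (inj₂ m) with trans (sym n) m
... | ()
Vtx⇒V (inj₂ n) | is-none _ _ (inj₁ m) with trans (sym n) m
... | ()
Vtx⇒V (inj₂ n) | is-none _ _ (inj₂ m) with trans (sym n) m
... | ()

Cen⇒D∖V : ∀ {x} → Cen x → D x × ¬ V x
Cen⇒D∖V {x} n with classify x
Cen⇒D∖V n | is-cen ¬v d _ = d , ¬v
Cen⇒D∖V n | is-vtx _ _ (inj₁ m) with trans (sym n) m
... | ()
Cen⇒D∖V n | is-vtx _ _ (inj₂ m) with trans (sym n) m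
... | ()
Cen⇒D∖V n | is-none _ _ (inj₁ m) with trans (sym n) m
... | ()
Cen⇒D∖V n | is-none _ _ (inj₂ m) with trans (sym n) m
... | ()

D∖V⇒Cen : ∀ {x} → D x → ¬ V x → Cen x
D∖V⇒Cen {x} d ¬v with classify x
... | is-vtx v _ _ = ⊥-elim (¬v v)
... | is-cen _ _ n = n
... | is-none _ ¬d _ = ⊥-elim (¬d d)

V⇒D : ∀ {x} → V x → D x
V⇒D {x} v with classify x
... | is-vtx _ d _ = d
... | is-cen ¬v _ _ = ⊥-elim (¬v v)
... | is-none ¬v _ _ = ⊥-elim (¬v v)

V? : ∀ x → Dec (V x)
V? x with classify x
... | is-vtx v _ _ = yes v
... | is-cen ¬v _ _ = no ¬v
... | is-none ¬v _ _ = no ¬v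

D? : ∀ x → Dec (D x)
D? x with classify x
... | is-vtx _ d _ = yes d
... | is-cen _ d _ = yes d
... | is-none _ ¬d _ = no ¬d

V-+ : ∀ {x y} → V x → V y → V (x +v y)
V-+ {v4 a b c d} {v4 e f g h} (p , q , r) (s , t , u) =
  subst Even (l a b e f) (even-+ p s) , subst Even (l a c e g) (even-+ q t) , subst Even (l a d e h) (even-+ r u)
  where l : ∀ a b e f → a - b + (e - f) ≡ a + e - (b + f)
        l = solve-∀

V-· : ∀ k {x} → V x → V (k ·v x)
V-· k {v4 a b c d} (p , q , r) = subst Even (l k a b) (even-* k p) , subst Even (l k a c) (even-* k q) , subst Even (l k a d) (even-* k r)
  where l : ∀ k a b → k * (a - b) ≡ k * a - k * b
        l = solve-∀

D-+ : ∀ {x y} → D x → D y → D (x +v y)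
D-+ {v4 a b c d} {v4 e f g h} p q = subst Even (l a b c d e f g h) (even-+ p q)
  where l : ∀ a b c d e f g h → a + (b + (c + d)) + (e + (f + (g + h))) ≡ a + e + (b + f + (c + g + (d + h)))
        l = solve-∀

D-· : ∀ k {x} → D x → D (k ·v x)
D-· k {v4 a b c d} p = subst Even (l k a b c d) (even-* k p)
  where l : ∀ k a b c d → k * (a + (b + (c + d))) ≡ k * a + (k * b + (k * c + k * d))
        l = solve-∀

-v-as-+ : ∀ {n} (x y : Vec ℤ n) → x +v ((- + 1) ·v y) ≡ x -v y
-v-as-+ [] [] = refl
-v-as-+ (a ∷ x) (c ∷ y) = cong₂ _∷_ (l a c) (-v-as-+ x y)
  where l : ∀ a c → a + (- + 1) * c ≡ a - c
        l = solve-∀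

V-- : ∀ {x y} → V x → V y → V (x -v y)
V-- {x} {y} p q = subst V (-v-as-+ x y) (V-+ p (V-· (- + 1) q))

D-- : ∀ {x y} → D x → D y → D (x -v y)
D-- {x} {y} p q = subst D (-v-as-+ x y) (D-+ {x} p (D-· (- + 1) {y} q))

V·D-even : ∀ {x y} → V x → D y → Even (dot x y)
V·D-even {v4 a b c d} {v4 e f g h} (p , q , r) s =
  subst Even (l a b c d e f g h)
    (even-- (even-- (even-- (even-* a s) (even-* f p)) (even-* g q)) (even-* h r))
  where l : ∀ a b c d e f g h → a * (e + (f + (g + h))) - f * (a - b) - g * (a - c) - h * (a - d) ≡ a * e + (b * f + (c * g + (d * h + + 0)))
        l = solve-∀

minuend : ∀ {a b k} → a - b ≡ + 2 * k → b ≡ a - + 2 * k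
minuend {a} {b} e = trans (f a b) (cong (λ t → a - t) e)
  where f : ∀ a b → b ≡ a - (a - b)
        f = solve-∀

-- Squared distances between vertices are therefore multiples of 4, whereas a tile centre has
-- squared distance 2 from the vertices of its tile.
V-norm : ∀ {x} → V x → Σ ℤ λ k → norm2 x ≡ + 4 * k
V-norm {v4 a b c d} ((k , p) , (l , q) , (m , r)) rewrite minuend {a} p | minuend {a} q | minuend {a} r =
  a * a - a * k - a * l - a * m + k * k + l * l + m * m , lem a k l m
  where
  lem : ∀ a k l m → a * a + ((a - + 2 * k) * (a - + 2 * k) + ((a - + 2 * l) * (a - + 2 * l) + ((a - + 2 * m) * (a - + 2 * m) + + 0)))
        ≡ + 4 * (a * a - a * k - a * l - a * m + k * k + l * l + m * m)
  lem = solve-∀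

norm≡sum : ∀ a b c d → Even (norm2 (v4 a b c d) - (a + (b + (c + d))))
norm≡sum a b c d = subst Even (l a b c d)
  (even-+ (even-square-diff a) (even-+ (even-square-diff b) (even-+ (even-square-diff c) (even-square-diff d))))
  where l : ∀ a b c d → (a * a - a) + ((b * b - b) + ((c * c - c) + (d * d - d))) ≡ a * a + (b * b + (c * c + (d * d + + 0))) - (a + (b + (c + d)))
        l = solve-∀

-- With this, an isometry that takes integral values on `D` maps `D` into itself, because it
-- preserves the parity of the norm.
evenNorm⇒D : ∀ {x} → Even (norm2 x) → D x
evenNorm⇒D {v4 a b c d} e = subst Even (l (norm2 (v4 a b c d)) (a + (b + (c + d)))) (even-- e (norm≡sum a b c d))
  where l : ∀ n s → n - (n - s) ≡ s
        l = solve-∀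

D-norm : ∀ {x} → D x → Even (norm2 x)
D-norm {v4 a b c d} e = subst Even (l (norm2 (v4 a b c d)) (a + (b + (c + d)))) (even-+ (norm≡sum a b c d) e)
  where l : ∀ n s → n - s + s ≡ n
        l = solve-∀

D-dual : ∀ {x} → Even (dot x (v4 (+ 1) (+ 1) (+ 1) (+ 1))) → D x
D-dual {v4 a b c d} = subst Even (l a b c d)
  where l : ∀ a b c d → a * + 1 + (b * + 1 + (c * + 1 + (d * + 1 + + 0))) ≡ a + (b + (c + d))
        l = solve-∀

V-dual : ∀ {x} → (∀ y → D y → Even (dot x y)) → V x
V-dual {v4 a b c d} h =
  subst Even (l₁ a b c d) (h (v4 (+ 1) (- + 1) (+ 0) (+ 0)) (+ 0 , refl)) ,
  subst Even (l₂ a b c d) (h (v4 (+ 1) (+ 0) (- + 1) (+ 0)) (+ 0 , refl)) ,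
  subst Even (l₃ a b c d) (h (v4 (+ 1) (+ 0) (+ 0) (- + 1)) (+ 0 , refl))
  where
  l₁ : ∀ a b c d → a * + 1 + (b * (- + 1) + (c * + 0 + (d * + 0 + + 0))) ≡ a - b
  l₁ = solve-∀
  l₂ : ∀ a b c d → a * + 1 + (b * + 0 + (c * (- + 1) + (d * + 0 + + 0))) ≡ a - c
  l₂ = solve-∀
  l₃ : ∀ a b c d → a * + 1 + (b * + 0 + (c * + 0 + (d * (- + 1) + + 0))) ≡ a - d
  l₃ = solve-∀

e₁ e₂ e₃ e₄ 𝟙 : Pt
e₁ = v4 (+ 1) (+ 0) (+ 0) (+ 0)
e₂ = v4 (+ 0) (+ 1) (+ 0) (+ 0)
e₃ = v4 (+ 0) (+ 0) (+ 1) (+ 0)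
e₄ = v4 (+ 0) (+ 0) (+ 0) (+ 1)
𝟙 = v4 (+ 1) (+ 1) (+ 1) (+ 1)

V-2· : ∀ x → V ((+ 2) ·v x)
V-2· (v4 a b c d) = (a - b , l a b) , (a - c , l a c) , (a - d , l a d)
  where l : ∀ a b → + 2 * a - + 2 * b ≡ + 2 * (a - b)
        l = solve-∀

dot-e₁ : ∀ a b c d → dot (v4 a b c d) e₁ ≡ a
dot-e₁ = l
  where l : ∀ a b c d → a * + 1 + (b * + 0 + (c * + 0 + (d * + 0 + + 0))) ≡ a
        l = solve-∀
dot-e₂ : ∀ a b c d → dot (v4 a b c d) e₂ ≡ b
dot-e₂ = l
  where l : ∀ a b c d → a * + 0 + (b * + 1 + (c * + 0 + (d * + 0 + + 0))) ≡ b
        l = solve-∀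
dot-e₃ : ∀ a b c d → dot (v4 a b c d) e₃ ≡ c
dot-e₃ = l
  where l : ∀ a b c d → a * + 0 + (b * + 0 + (c * + 1 + (d * + 0 + + 0))) ≡ c
        l = solve-∀
dot-e₄ : ∀ a b c d → dot (v4 a b c d) e₄ ≡ d
dot-e₄ = l
  where l : ∀ a b c d → a * + 0 + (b * + 0 + (c * + 0 + (d * + 1 + + 0))) ≡ d
        l = solve-∀

Half : Pt → Set
Half x = Σ Pt λ y → x ≡ (+ 2) ·v y

half-dual : ∀ {x} → (∀ e → Σ ℤ λ k → dot x ((+ 2) ·v e) ≡ + 4 * k) → Half x
half-dual {x@(v4 a b c d)} g = v4 (g e₁ .proj₁) (g e₂ .proj₁) (g e₃ .proj₁) (g e₄ .proj₁) ,
  v4≡ (halve e₁ (dot-e₁ a b c d)) (halve e₂ (dot-e₂ a b c d)) (halve e₃ (dot-e₃ a b c d)) (halve e₄ (dot-e₄ a b c d))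
  where
  halve : ∀ e {y} → dot x e ≡ y → y ≡ + 2 * g e .proj₁
  halve e refl = cancel2 (trans (sym (dot-·ʳ x (+ 2) e)) (trans (g e .proj₂) (ℤP.*-assoc (+ 2) (+ 2) (g e .proj₁))))

-- The point group: matrices 2N with N orthogonal, preserving V and D

-- Polarisation: the hypothesis is compared at `x`, `y` and `x +v y`.
iso-dot : ∀ m → (∀ x → norm2 (m ·m x) ≡ + 4 * norm2 x) → ∀ x y → dot (m ·m x) (m ·m y) ≡ + 4 * dot x y
iso-dot m iso x y = cancel2 (l (norm2 (m ·m x)) (norm2 x) (norm2 (m ·m y)) (norm2 y) _ (dot x y) (iso x) (iso y)
    (trans (sym (norm-+ (m ·m x) (m ·m y))) (trans (cong norm2 (sym (·m-+ m x y))) (trans (iso (x +v y)) (cong (+ 4 *_) (norm-+ x y))))))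
  where
  i₁ : ∀ a c d → + 2 * d ≡ (+ 4 * a + + 2 * d + + 4 * c) - + 4 * a - + 4 * c
  i₁ = solve-∀
  i₂ : ∀ a c d → + 4 * (a + + 2 * d + c) - + 4 * a - + 4 * c ≡ + 2 * (+ 4 * d)
  i₂ = solve-∀
  l : ∀ A a C c d' d → A ≡ + 4 * a → C ≡ + 4 * c → A + + 2 * d' + C ≡ + 4 * (a + + 2 * d + c) → + 2 * d' ≡ + 2 * (+ 4 * d)
  l A a C c d' d refl refl e = trans (i₁ a c d') (trans (cong (λ t → t - + 4 * a - + 4 * c) e) (i₂ a c d))

tr-left-inverse : ∀ m → (∀ x → norm2 (m ·m x) ≡ + 4 * norm2 x) → ∀ x → tr m ·m (m ·m x) ≡ (+ 4) ·v x
tr-left-inverse m iso x = dot-ext _ _ λ z →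
  trans (dot-comm (tr m ·m (m ·m x)) z) (trans (sym (adjoint m z (m ·m x)))
    (trans (iso-dot m iso z x) (trans (cong (+ 4 *_) (dot-comm z x)) (sym (dot-·ˡ (+ 4) x z)))))

columns : ∀ r₁ r₂ r₃ r₄ → let m = v4 r₁ r₂ r₃ r₄ in
  tr m ≡ v4 (m ·m e₁) (m ·m e₂) (m ·m e₃) (m ·m e₄)
columns (v4 a b c d) (v4 e f g h) (v4 i j k l) (v4 m n o p) = sym (cong₂ _∷_ (at e₁ (λ a _ _ _ → a) dot-e₁) (cong₂ _∷_ (at e₂ (λ _ b _ _ → b) dot-e₂) (cong₂ _∷_ (at e₃ (λ _ _ c _ → c) dot-e₃) (cong₂ _∷_ (at e₄ (λ _ _ _ d → d) dot-e₄) refl))))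
  where
  at : ∀ x (π : ℤ → ℤ → ℤ → ℤ → ℤ) → (∀ a b c d → dot (v4 a b c d) x ≡ π a b c d) → _≡_ {A = Pt}
    (v4 (dot (v4 a b c d) x) (dot (v4 e f g h) x) (dot (v4 i j k l) x) (dot (v4 m n o p) x)) (v4 (π a b c d) (π e f g h) (π i j k l) (π m n o p))
  at _ _ q = v4≡ (q a b c d) (q e f g h) (q i j k l) (q m n o p)

-- Both sides add the squares of all sixteen entries, once by columns and once by rows.
frobenius : ∀ m → norm2 (m ·m e₁) + (norm2 (m ·m e₂) + (norm2 (m ·m e₃) + norm2 (m ·m e₄)))
                ≡ norm2 (tr m ·m e₁) + (norm2 (tr m ·m e₂) + (norm2 (tr m ·m e₃) + norm2 (tr m ·m e₄)))
frobenius (v4 r₁@(v4 a b c d) r₂@(v4 e f g h) r₃@(v4 i j k l) r₄@(v4 m n o p)) =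
  trans (sym (cong sum (columns r₁ r₂ r₃ r₄))) (trans
    (swap (a * a) (b * b) (c * c) (d * d) (e * e) (f * f) (g * g) (h * h) (i * i) (j * j) (k * k) (l * l) (m * m) (n * n) (o * o) (p * p))
    (cong sum (columns (v4 a e i m) (v4 b f j n) (v4 c g k o) (v4 d h l p))))
  where
  sum : Vec Pt 4 → ℤ
  sum (v4 x y z w) = norm2 x + (norm2 y + (norm2 z + norm2 w))
  swap : ∀ a b c d e f g h i j k l m n o p →
    a + (e + (i + (m + + 0))) + (b + (f + (j + (n + + 0))) + (c + (g + (k + (o + + 0))) + (d + (h + (l + (p + + 0)))))) ≡
    a + (b + (c + (d + + 0))) + (e + (f + (g + (h + + 0))) + (i + (j + (k + (l + + 0))) + (m + (n + (o + (p + + 0))))))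
  swap = solve-∀

e-expand : ∀ (y : Pt) → y ≡ lincomb y idRows
e-expand (v4 a b c d) = v4≡ (l₁ a b c d) (l₂ a b c d) (l₃ a b c d) (l₄ a b c d)
  where
  l₁ : ∀ a b c d → a ≡ a * + 1 + (b * + 0 + (c * + 0 + (d * + 0 + + 0)))
  l₁ = solve-∀
  l₂ : ∀ a b c d → b ≡ a * + 0 + (b * + 1 + (c * + 0 + (d * + 0 + + 0)))
  l₂ = solve-∀
  l₃ : ∀ a b c d → c ≡ a * + 0 + (b * + 0 + (c * + 1 + (d * + 0 + + 0)))
  l₃ = solve-∀
  l₄ : ∀ a b c d → d ≡ a * + 0 + (b * + 0 + (c * + 0 + (d * + 1 + + 0)))
  l₄ = solve-∀

lincomb-· : ∀ {n} k (c : Vec ℤ n) vs → lincomb c (map (k ·v_) vs) ≡ k ·v lincomb c vs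
lincomb-· k [] [] = v4≡ (sym (ℤP.*-zeroʳ k)) (sym (ℤP.*-zeroʳ k)) (sym (ℤP.*-zeroʳ k)) (sym (ℤP.*-zeroʳ k))
lincomb-· k (c ∷ cs) (v ∷ vs) = trans (cong ((c ·v (k ·v v)) +v_) (lincomb-· k cs vs)) (l v (lincomb cs vs))
  where
  p : ∀ c k v w → c * (k * v) + k * w ≡ k * (c * v + w)
  p = solve-∀
  l : ∀ {n} (v w : Vec ℤ n) → (c ·v (k ·v v)) +v (k ·v w) ≡ k ·v ((c ·v v) +v w)
  l [] [] = refl
  l (x ∷ v) (y ∷ w) = cong₂ _∷_ (p c k x y) (l v w)

-- The defects |m mᵀ eᵢ - 4 eᵢ|² = 16 - 4 |mᵀ eᵢ|² are nonnegative, and they sum to 0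
-- because the Frobenius norms of m and mᵀ agree.
tr-right-inverse : ∀ m → (∀ x → norm2 (m ·m x) ≡ + 4 * norm2 x) → ∀ y → m ·m (tr m ·m y) ≡ (+ 4) ·v y
tr-right-inverse m iso y = trans (cong (λ t → m ·m (tr m ·m t)) (e-expand y))
  (trans (cong (m ·m_) (·m-lincomb (tr m) y idRows))
  (trans (·m-lincomb m y (map (tr m ·m_) idRows))
  (trans (cong (lincomb y) basis) (trans (lincomb-· (+ 4) y idRows) (cong ((+ 4) ·v_) (sym (e-expand y)))))))
  where
  def : Pt → ℤ
  def y = dist2 (m ·m (tr m ·m y)) ((+ 4) ·v y)
  def≡ : ∀ y → def y ≡ + 16 * norm2 y - + 4 * norm2 (tr m ·m y)
  def≡ y = trans (norm-- (m ·m z) ((+ 4) ·v y))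
    (trans (cong₂ _+_ (cong₂ _-_ (iso z) (cong (+ 2 *_) (trans (dot-·ʳ (m ·m z) (+ 4) y) (cong (+ 4 *_) (adjoint m z y)))))
      (norm-· (+ 4) y)) (l (norm2 z) (norm2 y)))
    where z = tr m ·m y
          l : ∀ a c → + 4 * a - + 2 * (+ 4 * a) + + 16 * c ≡ + 16 * c - + 4 * a
          l = solve-∀
  sums : norm2 (tr m ·m e₁) + (norm2 (tr m ·m e₂) + (norm2 (tr m ·m e₃) + norm2 (tr m ·m e₄))) ≡ + 16
  sums = trans (sym (frobenius m)) (cong₂ _+_ (iso e₁) (cong₂ _+_ (iso e₂) (cong₂ _+_ (iso e₃) (iso e₄))))
  total : def e₁ + (def e₂ + (def e₃ + def e₄)) ≡ + 0
  total = trans (cong₂ _+_ (def≡ e₁) (cong₂ _+_ (def≡ e₂) (cong₂ _+_ (def≡ e₃) (def≡ e₄))))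
    (trans (l (norm2 (tr m ·m e₁)) (norm2 (tr m ·m e₂)) (norm2 (tr m ·m e₃)) (norm2 (tr m ·m e₄))) (cong (λ t → + 64 - + 4 * t) sums))
    where l : ∀ a b c d → + 16 * + 1 - + 4 * a + (+ 16 * + 1 - + 4 * b + (+ 16 * + 1 - + 4 * c + (+ 16 * + 1 - + 4 * d))) ≡ + 64 - + 4 * (a + (b + (c + d)))
          l = solve-∀
  pos : ∀ y → + 0 ≤ def y
  pos y = 0≤dot ((m ·m (tr m ·m y)) -v ((+ 4) ·v y))
  z₁ = sum-zero (pos e₁) (ℤP.+-mono-≤ (pos e₂) (ℤP.+-mono-≤ (pos e₃) (pos e₄))) total
  z₂ = sum-zero (pos e₂) (ℤP.+-mono-≤ (pos e₃) (pos e₄)) (proj₂ z₁)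
  z₃ = sum-zero (pos e₃) (pos e₄) (proj₂ z₂)
  basis : map (m ·m_) (map (tr m ·m_) idRows) ≡ map ((+ 4) ·v_) idRows
  basis = cong₂ _∷_ (dist-zero _ _ (proj₁ z₁)) (cong₂ _∷_ (dist-zero _ _ (proj₁ z₂))
    (cong₂ _∷_ (dist-zero _ _ (proj₁ z₃)) (cong₂ _∷_ (dist-zero _ _ (proj₂ z₃)) refl)))

tr-iso : ∀ m → (∀ x → norm2 (m ·m x) ≡ + 4 * norm2 x) → ∀ x → norm2 (tr m ·m x) ≡ + 4 * norm2 x
tr-iso m iso x = cancel4 (trans (sym (iso (tr m ·m x))) (trans (cong norm2 (tr-right-inverse m iso x))
    (trans (norm-· (+ 4) x) (ℤP.*-assoc (+ 4) (+ 4) (norm2 x)))))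

-- The matrix is doubled because N can have half-integral entries, as the reflection in `𝟙` has.
-- Preservation is recorded in the forward direction; the inverse of N is its transpose, which
-- preserves `V` and `D` because these are dual to each other.
record W : Set where
  field
    mat   : Vec Pt 4
    iso   : ∀ x → norm2 (mat ·m x) ≡ + 4 * norm2 x
    presV : ∀ x → V x → Σ Pt λ y → V y × mat ·m x ≡ (+ 2) ·v y
    presD : ∀ x → D x → Σ Pt λ y → D y × mat ·m x ≡ (+ 2) ·v y
open W

-- A relation and not a function, since N maps some integral vectors to non-integral ones.
_⊢_↦_ : W → Pt → Pt → Set
w ⊢ x ↦ y = mat w ·m x ≡ (+ 2) ·v y

·v-assoc : ∀ {n} k l (x : Vec ℤ n) → k ·v (l ·v x) ≡ (k * l) ·v x
·v-assoc k l [] = refl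
·v-assoc k l (a ∷ x) = cong₂ _∷_ (sym (ℤP.*-assoc k l a)) (·v-assoc k l x)

·v-comm : ∀ {n} k l (x : Vec ℤ n) → k ·v (l ·v x) ≡ l ·v (k ·v x)
·v-comm k l x = trans (·v-assoc k l x) (trans (cong (_·v x) (ℤP.*-comm k l)) (sym (·v-assoc l k x)))

·v-+ : ∀ {n} k (x y : Vec ℤ n) → k ·v (x +v y) ≡ (k ·v x) +v (k ·v y)
·v-+ k [] [] = refl
·v-+ k (a ∷ x) (c ∷ y) = cong₂ _∷_ (ℤP.*-distribˡ-+ k a c) (·v-+ k x y)

·v-- : ∀ {n} k (x y : Vec ℤ n) → k ·v (x -v y) ≡ (k ·v x) -v (k ·v y)
·v-- k [] [] = refl
·v-- k (a ∷ x) (c ∷ y) = cong₂ _∷_ (l k a c) (·v-- k x y)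
  where l : ∀ k a c → k * (a - c) ≡ k * a - k * c
        l = solve-∀

module _ (w : W) where

  ↦-+ : ∀ {x y x' y'} → w ⊢ x ↦ y → w ⊢ x' ↦ y' → w ⊢ (x +v x') ↦ (y +v y')
  ↦-+ {x} {y} {x'} {y'} p q = trans (·m-+ (mat w) x x') (trans (cong₂ _+v_ p q) (sym (·v-+ (+ 2) y y')))

  ↦-- : ∀ {x y x' y'} → w ⊢ x ↦ y → w ⊢ x' ↦ y' → w ⊢ (x -v x') ↦ (y -v y')
  ↦-- {x} {y} {x'} {y'} p q = trans (·m-- (mat w) x x') (trans (cong₂ _-v_ p q) (sym (·v-- (+ 2) y y')))

  ↦-· : ∀ k {x y} → w ⊢ x ↦ y → w ⊢ (k ·v x) ↦ (k ·v y)
  ↦-· k {x} {y} p = trans (·m-· (mat w) k x) (trans (cong (k ·v_) p) (·v-comm k (+ 2) y))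

  ↦-unique : ∀ {x y y'} → w ⊢ x ↦ y → w ⊢ x ↦ y' → y ≡ y'
  ↦-unique p q = 2v-cancel (trans (sym p) q)

  ↦-dot : ∀ {x y x' y'} → w ⊢ x ↦ y → w ⊢ x' ↦ y' → dot y y' ≡ dot x x'
  ↦-dot {x} {y} {x'} {y'} p q = cancel4 (trans (sym (trans (dot-·ˡ (+ 2) y ((+ 2) ·v y')) (trans (cong (+ 2 *_) (dot-·ʳ y (+ 2) y')) (sym (ℤP.*-assoc (+ 2) (+ 2) (dot y y'))))))
    (trans (sym (cong₂ dot p q)) (iso-dot (mat w) (iso w) x x')))

  ↦-lincomb : ∀ {n} (k : Vec ℤ n) {xs ys} → map (mat w ·m_) xs ≡ map ((+ 2) ·v_) ys → w ⊢ lincomb k xs ↦ lincomb k ys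
  ↦-lincomb k {xs} {ys} e = trans (·m-lincomb (mat w) k xs) (trans (cong (lincomb k) e) (lincomb-· (+ 2) k ys))

  ↦-tr : ∀ {x y} → w ⊢ x ↦ y → tr (mat w) ·m y ≡ (+ 2) ·v x
  ↦-tr {x} {y} p = 2v-cancel (trans (sym (·m-· (tr (mat w)) (+ 2) y)) (trans (cong (tr (mat w) ·m_) (sym p))
    (trans (tr-left-inverse (mat w) (iso w) x) (sym (·v-assoc (+ 2) (+ 2) x)))))

  tr-↦ : ∀ {x y} → tr (mat w) ·m y ≡ (+ 2) ·v x → w ⊢ x ↦ y
  tr-↦ {x} {y} p = 2v-cancel (trans (sym (·m-· (mat w) (+ 2) x)) (trans (cong (mat w ·m_) (sym p))
    (trans (tr-right-inverse (mat w) (iso w) y) (sym (·v-assoc (+ 2) (+ 2) y)))))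

  private
    pairing : ∀ {x z z'} → w ⊢ z ↦ z' → dot (tr (mat w) ·m x) z ≡ + 2 * dot x z'
    pairing {x} {z} {z'} p = trans (dot-comm (tr (mat w) ·m x) z) (trans (sym (adjoint (mat w) z x))
      (trans (cong (λ t → dot t x) p) (trans (dot-·ˡ (+ 2) z' x) (cong (+ 2 *_) (dot-comm z' x)))))

    quarter : ∀ {a c} → a ≡ + 2 * c → Even c → Σ ℤ λ k → a ≡ + 4 * k
    quarter refl (k , refl) = k , sym (ℤP.*-assoc (+ 2) (+ 2) k)

    half-even : ∀ {x y z : Pt} → x ≡ (+ 2) ·v y → (Σ ℤ λ k → dot x z ≡ + 4 * k) → Even (dot y z)
    half-even {y = y} {z} refl (k , e) = k , cancel2 (trans (sym (dot-·ˡ (+ 2) y z)) (trans e (ℤP.*-assoc (+ 2) (+ 2) k)))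

  abstract
    -- V and D are dual to each other up to a factor 2, so that N preserving D forces Nᵀ to preserve V and conversely.
    tr-presV : ∀ x → V x → Σ Pt λ y → V y × tr (mat w) ·m x ≡ (+ 2) ·v y
    tr-presV x v = let y , e = half-dual {tr (mat w) ·m x} (λ e → pair ((+ 2) ·v e) (V⇒D (V-2· e))) in
      y , V-dual {y} (λ z d → half-even {tr (mat w) ·m x} {y} {z} e (pair z d)) , e
      where
      pair : ∀ z → D z → Σ ℤ λ k → dot (tr (mat w) ·m x) z ≡ + 4 * k
      pair z d with presD w z d
      ... | z' , d' , p = quarter (pairing {x} p) (V·D-even {x} {z'} v d')

    tr-presD : ∀ x → D x → Σ Pt λ y → D y × tr (mat w) ·m x ≡ (+ 2) ·v y
    tr-presD x v = let y , e = half-dual {tr (mat w) ·m x} (λ e → pair ((+ 2) ·v e) (V-2· e)) in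
      y , D-dual {y} (half-even {tr (mat w) ·m x} {y} {𝟙} e (pair 𝟙 ((+ 0 , refl) , (+ 0 , refl) , (+ 0 , refl)))) , e
      where
      pair : ∀ z → V z → Σ ℤ λ k → dot (tr (mat w) ·m x) z ≡ + 4 * k
      pair z d with presV w z d
      ... | z' , d' , p = quarter (pairing {x} p) (subst Even (dot-comm z' x) (V·D-even {z'} {x} d' v))

  inv : W
  inv = record { mat = tr (mat w) ; iso = tr-iso (mat w) (iso w) ; presV = tr-presV ; presD = tr-presD }

  abstract
    onV : ∀ y → V y → Σ Pt λ x → V x × w ⊢ x ↦ y
    onV y v = let x , v' , p = tr-presV y v in x , v' , tr-↦ p

    onD : ∀ y → D y → Σ Pt λ x → D x × w ⊢ x ↦ y
    onD y v = let x , v' , p = tr-presD y v in x , v' , tr-↦ p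

    ↦V⁻ : ∀ {x y} → w ⊢ x ↦ y → V y → V x
    ↦V⁻ {x} {y} p v = let x' , v' , q = tr-presV y v in subst V (2v-cancel (trans (sym q) (↦-tr p))) v'

module _ (w' w : W) where
  private
    abstract
      -- The product of the two doubled matrices is four times the composite isometry, so it has to
      -- be halved. Since twice `e` lies in `V`, `mat w` sends `e` itself into `V`, and there
      -- `mat w'` has even values; this halves the product column by column.
      image : ∀ e → Σ Pt λ z → mat w' ·m (mat w ·m e) ≡ (+ 2) ·v z
      image e = let y , v , p = presV w ((+ 2) ·v e) (V-2· e) ; z , _ , q = presV w' y v in
        z , trans (cong (mat w' ·m_) (2v-cancel (trans (sym (·m-· (mat w) (+ 2) e)) p))) q

      cols : Vec Pt 4
      cols = v4 (image e₁ .proj₁) (image e₂ .proj₁) (image e₃ .proj₁) (image e₄ .proj₁)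

      prod : Vec Pt 4
      prod = tr cols

      2prod : ∀ x → (+ 2) ·v (prod ·m x) ≡ mat w' ·m (mat w ·m x)
      2prod x = trans (cong ((+ 2) ·v_) (tr-·m cols x)) (trans (sym (lincomb-· (+ 2) x cols))
        (sym (trans (cong (λ t → mat w' ·m (mat w ·m t)) (e-expand x))
          (trans (cong (mat w' ·m_) (·m-lincomb (mat w) x idRows))
          (trans (·m-lincomb (mat w') x (map (mat w ·m_) idRows)) (cong (lincomb x)
            (cong₂ _∷_ (image e₁ .proj₂) (cong₂ _∷_ (image e₂ .proj₂) (cong₂ _∷_ (image e₃ .proj₂) (cong₂ _∷_ (image e₄ .proj₂) refl))))))))))

      prod-↦ : ∀ {x y z} → w ⊢ x ↦ y → w' ⊢ y ↦ z → prod ·m x ≡ (+ 2) ·v z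
      prod-↦ {x} {y} {z} p q = 2v-cancel (trans (2prod x) (trans (cong (mat w' ·m_) p)
        (trans (·m-· (mat w') (+ 2) y) (cong ((+ 2) ·v_) q))))

  infixr 9 _∘w_
  _∘w_ : W
  _∘w_ = record
    { mat = prod
    ; iso = λ x → cancel4 (trans (sym (norm-· (+ 2) (prod ·m x))) (trans (cong norm2 (2prod x))
        (trans (iso w' (mat w ·m x)) (cong (+ 4 *_) (iso w x)))))
    ; presV = λ x v → let y , v' , p = presV w x v ; z , v'' , q = presV w' y v' in z , v'' , prod-↦ p q
    ; presD = λ x v → let y , v' , p = presD w x v ; z , v'' , q = presD w' y v' in z , v'' , prod-↦ p q
    }

  ↦-∘ : ∀ {x y z} → w ⊢ x ↦ y → w' ⊢ y ↦ z → _∘w_ ⊢ x ↦ z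
  ↦-∘ = prod-↦

  ∘-↦ : ∀ {x y z} → _∘w_ ⊢ x ↦ z → w ⊢ x ↦ y → w' ⊢ y ↦ z
  ∘-↦ {x} {y} {z} p q = 2v-cancel (trans (sym (·m-· (mat w') (+ 2) y)) (trans (cong (mat w' ·m_) (sym q))
    (trans (sym (2prod x)) (cong ((+ 2) ·v_) p))))

-- Isometries built from orthogonal frames

Orthogonal : ∀ {n} → Vec Pt n → Set
Orthogonal [] = ⊤
Orthogonal (c ∷ cs) = norm2 c ≡ + 4 × All (λ v → dot c v ≡ + 0) cs × Orthogonal cs

orth-norm : ∀ {n} (cs : Vec Pt n) → Orthogonal cs → ∀ k → norm2 (lincomb k cs) ≡ + 4 * dot k k
orth-norm [] _ [] = refl
orth-norm (c ∷ cs) (n , o , os) (k ∷ ks) = trans (norm-+ (k ·v c) (lincomb ks cs))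
  (trans (cong₂ _+_ (cong₂ _+_ (trans (norm-· k c) (cong (k * k *_) n)) (cong (+ 2 *_) (trans (dot-·ˡ k c (lincomb ks cs)) (cong (k *_) (perp cs o ks)))))
     (orth-norm cs os ks)) (l k (dot ks ks)))
  where
  l : ∀ k s → k * k * + 4 + + 2 * (k * + 0) + + 4 * s ≡ + 4 * (k * k + s)
  l = solve-∀
  perp : ∀ {n} (cs : Vec Pt n) → All (λ v → dot c v ≡ + 0) cs → ∀ k → dot c (lincomb k cs) ≡ + 0
  perp [] [] [] = dot-zeroʳ c
  perp (v ∷ cs) (p ∷ ps) (k ∷ ks) = trans (dot-+ʳ c (k ·v v) (lincomb ks cs))
    (cong₂ _+_ (trans (dot-·ʳ c k v) (trans (cong (k *_) p) (ℤP.*-zeroʳ k))) (perp cs ps ks))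

-- The isometry sends `2eᵢ` to `cᵢ`. A vector of `V` is an integral combination of `𝟙`, `2e₂`,
-- `2e₃`, `2e₄`, with images `h`, `c₂`, `c₃`, `c₄`; a vector of `D` is one of `2e₁` and the
-- differences `eᵢ - e₁`, with images `c₁` and `pᵢ`. For `D` it suffices that these images are
-- integral, by `evenNorm⇒D`.
module _ (c₁ c₂ c₃ c₄ h : Pt) (orth : Orthogonal (v4 c₁ c₂ c₃ c₄))
         (v₂ : V c₂) (v₃ : V c₃) (v₄ : V c₄) (vh : V h) (sum : lincomb 𝟙 (v4 c₁ c₂ c₃ c₄) ≡ (+ 2) ·v h)
         (p₂ p₃ p₄ : Pt) (q₂ : c₂ -v c₁ ≡ (+ 2) ·v p₂) (q₃ : c₃ -v c₁ ≡ (+ 2) ·v p₃) (q₄ : c₄ -v c₁ ≡ (+ 2) ·v p₄) where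
  private
    cs = v4 c₁ c₂ c₃ c₄

    isoC : ∀ x → norm2 (tr cs ·m x) ≡ + 4 * norm2 x
    isoC x = trans (cong norm2 (tr-·m cs x)) (orth-norm cs orth x)

    -- The zero vector that ends `lincomb` is generalised to `z` so that the scalar identity can be
    -- applied coordinate by coordinate, by induction on the dimension.
    lemV : ∀ {n} a k l m (c₁ c₂ c₃ c₄ h z : Vec ℤ n) →
      ((+ 1) ·v c₁) +v (((+ 1) ·v c₂) +v (((+ 1) ·v c₃) +v (((+ 1) ·v c₄) +v z))) ≡ (+ 2) ·v h → z ≡ replicate n (+ 0) →
      (a ·v c₁) +v (((a - + 2 * k) ·v c₂) +v (((a - + 2 * l) ·v c₃) +v (((a - + 2 * m) ·v c₄) +v z)))
      ≡ (+ 2) ·v ((((a ·v h) -v (k ·v c₂)) -v (l ·v c₃)) -v (m ·v c₄))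
    lemV a k l m [] [] [] [] [] [] _ _ = refl
    lemV a k l m (p ∷ c₁) (q ∷ c₂) (r ∷ c₃) (s ∷ c₄) (t ∷ h) (z ∷ zs) e o =
      cong₂ _∷_ (u a k l m p q r s t z (cong head e) (cong head o))
                (lemV a k l m c₁ c₂ c₃ c₄ h zs (cong tail e) (cong tail o))
      where
      i₁ : ∀ a k l m p q r s → a * p + ((a - + 2 * k) * q + ((a - + 2 * l) * r + ((a - + 2 * m) * s + + 0)))
           ≡ a * (+ 1 * p + (+ 1 * q + (+ 1 * r + (+ 1 * s + + 0)))) - + 2 * (k * q + l * r + m * s)
      i₁ = solve-∀
      i₂ : ∀ a k l m q r s t → a * (+ 2 * t) - + 2 * (k * q + l * r + m * s) ≡ + 2 * (a * t - k * q - l * r - m * s)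
      i₂ = solve-∀
      u : ∀ a k l m p q r s t z → + 1 * p + (+ 1 * q + (+ 1 * r + (+ 1 * s + z))) ≡ + 2 * t → z ≡ + 0 →
          a * p + ((a - + 2 * k) * q + ((a - + 2 * l) * r + ((a - + 2 * m) * s + z))) ≡ + 2 * (a * t - k * q - l * r - m * s)
      u a k l m p q r s t z e refl = trans (i₁ a k l m p q r s) (trans (cong (λ y → a * y - + 2 * (k * q + l * r + m * s)) e) (i₂ a k l m q r s t))

    presVC : ∀ x → V x → Σ Pt λ y → V y × tr cs ·m x ≡ (+ 2) ·v y
    presVC (v4 a b c d) ((k , p) , (l , q) , (m , r)) rewrite minuend {a} p | minuend {a} q | minuend {a} r =
      (((a ·v h) -v (k ·v c₂)) -v (l ·v c₃)) -v (m ·v c₄) ,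
      V-- (V-- (V-- (V-· a vh) (V-· k v₂)) (V-· l v₃)) (V-· m v₄) ,
      trans (tr-·m cs _) (lemV a k l m c₁ c₂ c₃ c₄ h zeroV sum refl)

    lemD : ∀ {n} k b c d (c₁ c₂ c₃ c₄ p₂ p₃ p₄ z : Vec ℤ n) →
      c₂ -v c₁ ≡ (+ 2) ·v p₂ → c₃ -v c₁ ≡ (+ 2) ·v p₃ → c₄ -v c₁ ≡ (+ 2) ·v p₄ → z ≡ replicate n (+ 0) →
      ((+ 2 * k - (b + (c + d))) ·v c₁) +v ((b ·v c₂) +v ((c ·v c₃) +v ((d ·v c₄) +v z)))
      ≡ (+ 2) ·v ((k ·v c₁) +v ((b ·v p₂) +v ((c ·v p₃) +v (d ·v p₄))))
    lemD k b c d [] [] [] [] [] [] [] [] _ _ _ _ = refl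
    lemD k b c d (p ∷ c₁) (q ∷ c₂) (r ∷ c₃) (s ∷ c₄) (t₂ ∷ p₂) (t₃ ∷ p₃) (t₄ ∷ p₄) (z ∷ zs) e₂ e₃ e₄ o =
      cong₂ _∷_ (u k b c d p q r s t₂ t₃ t₄ z (cong head e₂) (cong head e₃) (cong head e₄) (cong head o))
        (lemD k b c d c₁ c₂ c₃ c₄ p₂ p₃ p₄ zs (cong tail e₂) (cong tail e₃) (cong tail e₄) (cong tail o))
      where
      i₁ : ∀ k b c d p q r s → (+ 2 * k - (b + (c + d))) * p + (b * q + (c * r + (d * s + + 0)))
           ≡ + 2 * (k * p) + (b * (q - p) + (c * (r - p) + d * (s - p)))
      i₁ = solve-∀
      i₂ : ∀ k b c d p t₂ t₃ t₄ → + 2 * (k * p) + (b * (+ 2 * t₂) + (c * (+ 2 * t₃) + d * (+ 2 * t₄))) ≡ + 2 * (k * p + (b * t₂ + (c * t₃ + d * t₄)))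
      i₂ = solve-∀
      u : ∀ k b c d p q r s t₂ t₃ t₄ z → q - p ≡ + 2 * t₂ → r - p ≡ + 2 * t₃ → s - p ≡ + 2 * t₄ → z ≡ + 0 →
          (+ 2 * k - (b + (c + d))) * p + (b * q + (c * r + (d * s + z))) ≡ + 2 * (k * p + (b * t₂ + (c * t₃ + d * t₄)))
      u k b c d p q r s t₂ t₃ t₄ z e₂ e₃ e₄ refl = trans (i₁ k b c d p q r s)
        (trans (cong (λ t → + 2 * (k * p) + t) (cong₂ _+_ (cong (b *_) e₂) (cong₂ _+_ (cong (c *_) e₃) (cong (d *_) e₄)))) (i₂ k b c d p t₂ t₃ t₄))

    presDC : ∀ x → D x → Σ Pt λ y → D y × tr cs ·m x ≡ (+ 2) ·v y
    presDC (v4 a b c d) (k , e) = y , evenNorm⇒D {y} (subst Even nrm (D-norm {v4 a b c d} (k , e))) , eq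
      where
      y = (k ·v c₁) +v ((b ·v p₂) +v ((c ·v p₃) +v (d ·v p₄)))
      a≡ : a ≡ + 2 * k - (b + (c + d))
      a≡ = trans (f a (b + (c + d))) (cong (_- (b + (c + d))) e)
        where f : ∀ a s → a ≡ a + s - s
              f = solve-∀
      eq : tr cs ·m (v4 a b c d) ≡ (+ 2) ·v y
      eq = trans (tr-·m cs (v4 a b c d)) (trans (cong (λ t → lincomb (v4 t b c d) cs) a≡)
             (lemD k b c d c₁ c₂ c₃ c₄ p₂ p₃ p₄ zeroV q₂ q₃ q₄ refl))
      nrm : norm2 (v4 a b c d) ≡ norm2 y
      nrm = sym (cancel4 (trans (sym (norm-· (+ 2) y)) (trans (cong norm2 (sym eq)) (isoC (v4 a b c d)))))

  fromColumns : W
  fromColumns = record { mat = tr cs ; iso = isoC ; presV = presVC ; presD = presDC }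

-- Symmetries of the tessellations

record Gp : Set where
  constructor gp
  field
    lin    : W
    shift  : Pt
    shiftV : V shift
open Gp

toAff : Gp → Aff
toAff g = aff (mat (lin g)) ((+ 2) ·v shift g)

R : Gp → Pt → Pt → Set
R g = Maps (toAff g)

+v-comm : ∀ {n} (x y : Vec ℤ n) → x +v y ≡ y +v x
+v-comm [] [] = refl
+v-comm (a ∷ x) (c ∷ y) = cong₂ _∷_ (ℤP.+-comm a c) (+v-comm x y)

+-cancel : ∀ {n} (x y : Vec ℤ n) → (x +v y) -v y ≡ x
+-cancel [] [] = refl
+-cancel (a ∷ x) (c ∷ y) = cong₂ _∷_ (l a c) (+-cancel x y)
  where l : ∀ a c → a + c - c ≡ a
        l = solve-∀

sub-zero : ∀ {n} (y : Vec ℤ n) → y -v replicate n (+ 0) ≡ y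
sub-zero [] = refl
sub-zero (a ∷ y) = cong₂ _∷_ (ℤP.+-identityʳ a) (sub-zero y)

-+-cancel : ∀ {n} (x y : Vec ℤ n) → (x -v y) +v y ≡ x
-+-cancel [] [] = refl
-+-cancel (a ∷ x) (c ∷ y) = cong₂ _∷_ (l a c) (-+-cancel x y)
  where l : ∀ a c → a - c + c ≡ a
        l = solve-∀

sub-cancel : ∀ {n} (x y z : Vec ℤ n) → (x -v z) -v (y -v z) ≡ x -v y
sub-cancel [] [] [] = refl
sub-cancel (a ∷ x) (c ∷ y) (e ∷ z) = cong₂ _∷_ (l a c e) (sub-cancel x y z)
  where l : ∀ a c e → a - e - (c - e) ≡ a - c
        l = solve-∀

dist-sym : ∀ x y → dist2 x y ≡ dist2 y x
dist-sym x y = trans (norm-- x y) (trans (l (norm2 x) (dot x y) (norm2 y))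
  (trans (cong (λ t → norm2 y - + 2 * t + norm2 x) (dot-comm x y)) (sym (norm-- y x))))
  where l : ∀ a b c → a - + 2 * b + c ≡ c - + 2 * b + a
        l = solve-∀

maps-linear : ∀ {g x y x' y'} → Maps g x y → Maps g x' y' → Aff.M g ·m (x -v x') ≡ (+ 2) ·v (y -v y')
maps-linear {g} {x} {y} {x'} {y'} p q = trans (·m-- (Aff.M g) x x')
  (trans (sym (l (Aff.M g ·m x) (Aff.M g ·m x') (Aff.b g))) (trans (cong₂ _-v_ p q) (sym (·v-- (+ 2) y y'))))
  where
  l : ∀ {n} (x y z : Vec ℤ n) → (x +v z) -v (y +v z) ≡ x -v y
  l [] [] [] = refl
  l (a ∷ x) (c ∷ y) (e ∷ z) = cong₂ _∷_ (i a c e) (l x y z)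
    where i : ∀ a c e → a + e - (c + e) ≡ a - c
          i = solve-∀

maps-dist : ∀ {g x y x' y'} → IsIso g → Maps g x y → Maps g x' y' → dist2 y y' ≡ dist2 x x'
maps-dist {g} {x} {y} {x'} {y'} iso p q = cancel4 (trans (sym (norm-· (+ 2) (y -v y')))
  (trans (cong norm2 (sym (maps-linear {g} p q))) (iso (x -v x'))))

module _ (g : Gp) where
  R⇒↦ : ∀ {x y} → R g x y → lin g ⊢ x ↦ (y -v shift g)
  R⇒↦ {x} {y} p = trans (sym (+-cancel (mat (lin g) ·m x) ((+ 2) ·v shift g)))
    (trans (cong (_-v ((+ 2) ·v shift g)) p) (sym (·v-- (+ 2) y (shift g))))

  ↦⇒R : ∀ {x y} → lin g ⊢ x ↦ (y -v shift g) → R g x y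
  ↦⇒R {x} {y} p = trans (cong (_+v ((+ 2) ·v shift g)) p)
    (trans (sym (·v-+ (+ 2) (y -v shift g) (shift g))) (cong ((+ 2) ·v_) (-+-cancel y (shift g))))

  ↦⇒R⁺ : ∀ {x y} → lin g ⊢ x ↦ y → R g x (y +v shift g)
  ↦⇒R⁺ {x} {y} p = ↦⇒R (subst (lin g ⊢ x ↦_) (sym (+-cancel y (shift g))) p)

  R-unique : ∀ {x y y'} → R g x y → R g x y' → y ≡ y'
  R-unique p q = 2v-cancel (trans (sym p) q)

  R-dist : ∀ {x y x' y'} → R g x y → R g x' y' → dist2 y y' ≡ dist2 x x'
  R-dist = maps-dist {toAff g} (iso (lin g))

  R-inj : ∀ {x x' y} → R g x y → R g x' y → x ≡ x'
  R-inj {x} {x'} {y} p q = dist-zero x x' (trans (sym (R-dist p q)) (lem y))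
    where lem : ∀ y → dist2 y y ≡ + 0
          lem y = trans (norm-- y y) (l (norm2 y))
            where l : ∀ a → a - + 2 * a + a ≡ + 0
                  l = solve-∀

  actV : ∀ x → V x → Σ Pt λ y → V y × R g x y
  actV x v = let y , v' , p = presV (lin g) x v in y +v shift g , V-+ v' (shiftV g) , ↦⇒R⁺ p

  actD : ∀ x → D x → Σ Pt λ y → D y × R g x y
  actD x v = let y , v' , p = presD (lin g) x v in y +v shift g , D-+ {y} v' (V⇒D (shiftV g)) , ↦⇒R⁺ p

  onV' : ∀ y → V y → Σ Pt λ x → V x × R g x y
  onV' y v = let x , v' , p = onV (lin g) (y -v shift g) (V-- v (shiftV g)) in x , v' , ↦⇒R p

  onD' : ∀ y → D y → Σ Pt λ x → D x × R g x y
  onD' y v = let x , v' , p = onD (lin g) (y -v shift g) (D-- {y} v (V⇒D (shiftV g))) in x , v' , ↦⇒R p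

  R-V : ∀ {x y} → R g x y → V x → V y
  R-V {x} p v = let y' , v' , q = actV x v in subst V (R-unique q p) v'

  R-V⁻ : ∀ {x y} → R g x y → V y → V x
  R-V⁻ {x} {y} p v = let x' , v' , q = onV' y v in subst V (R-inj q p) v'

  R-D : ∀ {x y} → R g x y → D x → D y
  R-D {x} p v = let y' , v' , q = actD x v in subst D (R-unique q p) v'

  R-D⁻ : ∀ {x y} → R g x y → D y → D x
  R-D⁻ {x} {y} p v = let x' , v' , q = onD' y v in subst D (R-inj q p) v'

  R-Cen : ∀ {x y} → R g x y → Cen x → Cen y
  R-Cen {x} {y} p c = let d , ¬v = Cen⇒D∖V c in D∖V⇒Cen (R-D p d) (λ v → ¬v (R-V⁻ p v))

  R-Cen⁻ : ∀ {x y} → R g x y → Cen y → Cen x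
  R-Cen⁻ {x} {y} p c = let d , ¬v = Cen⇒D∖V c in D∖V⇒Cen (R-D⁻ p d) (λ v → ¬v (R-V p v))

  invg : Gp
  invg = let t , tv , _ = onV (lin g) (shift g) (shiftV g) in gp (inv (lin g)) ((- + 1) ·v t) (V-· (- + 1) tv)

R-inv : ∀ g {x y} → R g x y → R (invg g) y x
R-inv g {x} {y} p = let t , tv , q = onV (lin g) (shift g) (shiftV g) in
  ↦⇒R (invg g) {y} {x} (subst₂ (inv (lin g) ⊢_↦_) (-+-cancel y (shift g)) (lem x t)
    (↦-+ (inv (lin g)) (↦-tr (lin g) (R⇒↦ g p)) (↦-tr (lin g) q)))
  where
  lem : ∀ {n} (x t : Vec ℤ n) → x +v t ≡ x -v ((- + 1) ·v t)
  lem [] [] = refl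
  lem (a ∷ x) (c ∷ t) = cong₂ _∷_ (i a c) (lem x t)
    where i : ∀ a c → a + c ≡ a - (- + 1) * c
          i = solve-∀

_∘g_ : Gp → Gp → Gp
h ∘g g = let t , tv , _ = presV (lin h) (shift g) (shiftV g) in gp (lin h ∘w lin g) (t +v shift h) (V-+ tv (shiftV h))

R-∘ : ∀ h g {x y z} → R g x y → R h y z → R (h ∘g g) x z
R-∘ h g {x} {y} {z} p q = let t , tv , r = presV (lin h) (shift g) (shiftV g) in
  ↦⇒R (h ∘g g) (subst ((lin h ∘w lin g) ⊢ x ↦_) (lem z t (shift h))
    (↦-∘ (lin h) (lin g) (R⇒↦ g p) (↦-- (lin h) (R⇒↦ h q) r)))
  where
  lem : ∀ {n} (z t s : Vec ℤ n) → (z -v s) -v t ≡ z -v (t +v s)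
  lem [] [] [] = refl
  lem (a ∷ z) (c ∷ t) (e ∷ s) = cong₂ _∷_ (i a c e) (lem z t s)
    where i : ∀ a c e → a - e - c ≡ a - (c + e)
          i = solve-∀

R-inv⁻ : ∀ g {x y} → D y → R (invg g) y x → R g x y
R-inv⁻ g {x} {y} d p with onD' g y d
... | x' , _ , q = subst (λ t → R g t y) (R-unique (invg g) (R-inv g q) p) q

infixr 9 _∘g_

-- Images of faces under symmetries

≐-sym : ∀ {F G} → F ≐ G → G ≐ F
≐-sym (p , q) = q , p

≐-trans : ∀ {F G H} → F ≐ G → G ≐ H → F ≐ H
≐-trans (p , q) (p' , q') = (λ x h → p' x (p x h)) , (λ x h → q x (q' x h))

im : Gp → Pred → Pred
im g = img (toAff g)

im-mono : ∀ g {F G} → F ⊆ G → im g F ⊆ im g G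
im-mono g s y (x , f , r) = x , s x f , r

im-cong : ∀ g {F G} → F ≐ G → im g F ≐ im g G
im-cong g (p , q) = im-mono g p , im-mono g q

-- `img` drops the points whose image is not integral, which happens outside `D`, for instance to
-- `e₁` under the reflection in `𝟙`. Inside `D` the intermediate image always exists.
im-∘ : ∀ h g {F} → F ⊆ D → im (h ∘g g) F ≐ im h (im g F)
im-∘ h g {F} s = to , λ { z (y , (x , f , r) , r') → x , f , R-∘ h g r r' }
  where
  to : im (h ∘g g) F ⊆ im h (im g F)
  to z (x , f , r) with actD g x (s x f)
  ... | y , d , p with actD h y d
  ... | z' , _ , q rewrite R-unique (h ∘g g) r (R-∘ h g p q) = y , (x , f , p) , q

im-inv : ∀ g {F F'} → F ⊆ D → im g F ≐ F' → im (invg g) F' ≐ F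
im-inv g {F} {F'} s (a , c) = to , from
  where
  to : im (invg g) F' ⊆ F
  to x (y , f' , r) = let x' , f , r' = c y f' in subst F (R-unique (invg g) (R-inv g r') r) f
  from : F ⊆ im (invg g) F'
  from x f = let y , _ , r = actD g x (s x f) in y , a y (x , f , r) , R-inv g r

im-inv⁻ : ∀ g {F} → F ⊆ D → im g (im (invg g) F) ≐ F
im-inv⁻ g {F} s = to , from
  where
  to : im g (im (invg g) F) ⊆ F
  to y (x , (y' , f , r') , r) = subst F (R-unique g (R-inv⁻ g (s y' f) r') r) f
  from : F ⊆ im g (im (invg g) F)
  from y f = let x , _ , r = onD' g y (s y f) in x , (y , f , R-inv g r) , r

TileU-V : ∀ {c} → TileU c ⊆ V
TileU-V x (v , _) = Vtx⇒V v

im-TileU : ∀ g {c c'} → R g c c' → im g (TileU c) ≐ TileU c'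
im-TileU g {c} {c'} r =
  (λ { y (x , (v , e) , p) → V⇒Vtx (R-V g p (Vtx⇒V v)) , trans (R-dist g p r) e }) ,
  (λ { y (v , e) → let x , xv , p = onV' g y (Vtx⇒V v) in x , (V⇒Vtx xv , trans (sym (R-dist g p r)) e) , p })

actC : ∀ g c → Cen c → Σ Pt λ c' → Cen c' × R g c c'
actC g c h = let c' , _ , r = actD g c (proj₁ (Cen⇒D∖V h)) in c' , R-Cen g r h , r

onC : ∀ g c → Cen c → Σ Pt λ c' → Cen c' × R g c' c
onC g c h = let c' , _ , r = onD' g c (proj₁ (Cen⇒D∖V h)) in c' , R-Cen⁻ g r h , r

im-SubFace : ∀ g k {F} → SubFace k F → SubFace k (im g F)
im-SubFace g k {F} (c , cc , vs , inT , sep , mem) = c' , cc' , vs' , inT' , sep' , λ y → to y , from y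
  where
  c' = actC g c cc .proj₁
  cc' = actC g c cc .proj₂ .proj₁
  rc = actC g c cc .proj₂ .proj₂
  f : Fin (suc k) → Pt
  f i = actV g (lookup vs i) (TileU-V _ (inT i)) .proj₁
  vs' = tabulate f
  r : ∀ i → R g (lookup vs i) (lookup vs' i)
  r i = subst (R g (lookup vs i)) (sym (lookup∘tabulate f i)) (actV g (lookup vs i) (TileU-V _ (inT i)) .proj₂ .proj₂)
  inT' : ∀ i → TileU c' (lookup vs' i)
  inT' i = im-TileU g rc .proj₁ _ (lookup vs i , inT i , r i)
  double : ∀ {n} (x : Vec ℤ n) → x +v x ≡ (+ 2) ·v x
  double [] = refl
  double (a ∷ x) = cong₂ _∷_ (l a) (double x)
    where l : ∀ a → a + a ≡ + 2 * a
          l = solve-∀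
  mid : ∀ {n} (x y z s : Vec ℤ n) → x +v y ≡ (+ 2) ·v z → (x -v s) +v (y -v s) ≡ (+ 2) ·v (z -v s)
  mid [] [] [] [] _ = refl
  mid (a ∷ x) (c ∷ y) (e ∷ z) (t ∷ s) h = cong₂ _∷_ (i a c e t (cong head h)) (mid x y z s (cong tail h))
    where
    i₁ : ∀ a c t → a - t + (c - t) ≡ a + c - + 2 * t
    i₁ = solve-∀
    i₂ : ∀ e t → + 2 * e - + 2 * t ≡ + 2 * (e - t)
    i₂ = solve-∀
    i : ∀ a c e t → a + c ≡ + 2 * e → a - t + (c - t) ≡ + 2 * (e - t)
    i a c e t h = trans (i₁ a c t) (trans (cong (_- + 2 * t) h) (i₂ e t))
  sep' : ∀ i j → i ≢ j → (lookup vs' i ≢ lookup vs' j) × ((lookup vs' i +v lookup vs' j) ≢ (+ 2) ·v c')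
  sep' i j ne = (λ e → sep i j ne .proj₁ (R-inj g (r i) (subst (R g _) (sym e) (r j)))) , λ e →
    sep i j ne .proj₂ (2v-cancel (trans (sym (↦-tr (lin g) (↦-+ (lin g) (R⇒↦ g (r i)) (R⇒↦ g (r j)))))
      (trans (cong (tr (mat (lin g)) ·m_) (mid _ _ c' (shift g) e))
        (trans (·m-· (tr (mat (lin g))) (+ 2) (c' -v shift g)) (cong ((+ 2) ·v_) (↦-tr (lin g) (R⇒↦ g rc)))))))
  to : ∀ y → im g F y → y ∈ vs'
  to y (x , fx , p) = subst (_∈ vs') (sym (R-unique g p (subst (λ t → R g t (lookup vs' (index q))) (sym (lookup-index q)) (r (index q))))) (∈-lookup (index q) vs')
    where q = mem x .proj₁ fx
  from : ∀ y → y ∈ vs' → im g F y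
  from y q = lookup vs (index q) , mem _ .proj₂ (∈-lookup (index q) vs) , subst (R g _) (sym (lookup-index q)) (r (index q))

im-FaceU : ∀ g k {F} → FaceU k F → FaceU k (im g F)
im-FaceU g zero = im-SubFace g 0
im-FaceU g 1F = im-SubFace g 1
im-FaceU g 2F = im-SubFace g 2
im-FaceU g 3F = im-SubFace g 3
im-FaceU g 4F (c , cc , e) = let c' , cc' , r = actC g c cc in
  c' , cc' , ≐-trans (im-cong g e) (im-TileU g r)

SubFace-V : ∀ k {F} → SubFace k F → F ⊆ V
SubFace-V k (c , cc , vs , inT , sep , mem) x fx = subst V (sym (lookup-index q)) (TileU-V _ (inT (index q)))
  where q = mem x .proj₁ fx

FaceU-V : ∀ k {F} → FaceU k F → F ⊆ V
FaceU-V zero = SubFace-V 0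
FaceU-V 1F = SubFace-V 1
FaceU-V 2F = SubFace-V 2
FaceU-V 3F = SubFace-V 3
FaceU-V 4F (c , cc , e) x fx = TileU-V x (proj₁ e x fx)

Dual-anti : ∀ {F G} → F ⊆ G → Dual G ⊆ Dual F
Dual-anti s w (c , h) = c , λ x fx → h x (s x fx)

Dual-cong : ∀ {F G} → F ≐ G → Dual F ≐ Dual G
Dual-cong (p , q) = Dual-anti q , Dual-anti p

Dual-D : ∀ {F} → Dual F ⊆ D
Dual-D w (c , _) = proj₁ (Cen⇒D∖V c)

im-Dual : ∀ g {F} → F ⊆ V → im g (Dual F) ≐ Dual (im g F)
im-Dual g {F} s = to , from
  where
  to : im g (Dual F) ⊆ Dual (im g F)
  to w' (w , (c , h) , r) = R-Cen g r c , λ { y (x , fx , p) → im-TileU g r .proj₁ y (x , h x fx , p) }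
  from : Dual (im g F) ⊆ im g (Dual F)
  from w' (c' , h) = let w , c , r = onC g w' c' in w , (c , λ x fx → let y , yv , p = actV g x (s x fx) in
    V⇒Vtx (s x fx) , trans (sym (R-dist g p r)) (proj₂ (h y (x , fx , p)))) , r

im-Face : ∀ T g k {F} → Face T k F → Face T k (im g F)
im-Face cross g k (lift f) = lift (im-FaceU g k f)
im-Face icosi g k (F , f , e) = im g F , im-FaceU g (opposite k) f , ≐-trans (im-cong g e) (im-Dual g (FaceU-V (opposite k) f))

Face-D : ∀ T k {F} → Face T k F → F ⊆ D
Face-D cross k (lift f) x fx = V⇒D (FaceU-V k f x fx)
Face-D icosi k (F , f , e) x fx = Dual-D {F} x (proj₁ e x fx)

Gp⇒Sym : ∀ T g → Sym T (toAff g)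
Gp⇒Sym T g = iso (lin g) , (λ C f → im-Face T g (opposite zero) f) ,
  λ C' f → im (invg g) C' , im-Face T (invg g) (opposite zero) f , im-inv⁻ g (Face-D T (opposite zero) f)

-- Every symmetry arises from Gp

-- The parallelogram law for `x - c` and `y - c`. If both have norm 2, the right side is 8 minus the
-- squared distance of `x` and `y`: that distance is at most 8, and 8 means antipodal about `c`.
parallelogram : ∀ x y c → norm2 ((x +v y) -v ((+ 2) ·v c)) ≡ + 2 * dist2 x c + + 2 * dist2 y c - dist2 x y
parallelogram x y c = trans (norm-- (x +v y) ((+ 2) ·v c))
  (trans (cong₂ _+_ (cong₂ _-_ (norm-+ x y) (cong (+ 2 *_) (trans (dot-·ʳ (x +v y) (+ 2) c) (cong (+ 2 *_) (dot-+ˡ x y c))))) (norm-· (+ 2) c))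
  (trans (l (norm2 x) (norm2 y) (norm2 c) (dot x y) (dot x c) (dot y c))
   (sym (cong₂ _-_ (cong₂ _+_ (cong (+ 2 *_) (norm-- x c)) (cong (+ 2 *_) (norm-- y c))) (norm-- x y)))))
  where l : ∀ x y c xy xc yc → x + + 2 * xy + y - + 2 * (+ 2 * (xc + yc)) + + 4 * c ≡
            + 2 * (x - + 2 * xc + c) + + 2 * (y - + 2 * yc + c) - (x - + 2 * xy + y)
        l = solve-∀

antipodal : ∀ {x y c} → dist2 x c ≡ + 2 → dist2 y c ≡ + 2 → dist2 x y ≡ + 8 → x +v y ≡ (+ 2) ·v c
antipodal {x} {y} {c} p q r = dist-zero _ _ (trans (parallelogram x y c)
  (cong₂ _-_ (cong₂ _+_ (cong (+ 2 *_) p) (cong (+ 2 *_) q)) r))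

tr-tr : ∀ m → tr (tr m) ≡ m
tr-tr (v4 (v4 a b c d) (v4 e f g h) (v4 i j k l) (v4 m n o p)) = refl

maps-mid : ∀ {g x y x' y' c c'} → Maps g x y → Maps g x' y' → x +v x' ≡ (+ 2) ·v c → y +v y' ≡ (+ 2) ·v c' → Maps g c c'
maps-mid {g} {x} {y} {x'} {y'} {c} {c'} p q e e' = 2v-cancel
  (trans (·v-+ (+ 2) (Aff.M g ·m c) (Aff.b g)) (trans (cong (_+v ((+ 2) ·v Aff.b g)) (trans (sym (·m-· (Aff.M g) (+ 2) c))
    (trans (cong (Aff.M g ·m_) (sym e)) (·m-+ (Aff.M g) x x'))))
  (trans (l (Aff.M g ·m x) (Aff.M g ·m x') (Aff.b g)) (trans (cong₂ _+v_ p q) (trans (sym (·v-+ (+ 2) y y')) (cong ((+ 2) ·v_) e'))))))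
  where
  l : ∀ {n} (x y z : Vec ℤ n) → (x +v y) +v ((+ 2) ·v z) ≡ (x +v z) +v (y +v z)
  l [] [] [] = refl
  l (a ∷ x) (c ∷ y) (e ∷ z) = cong₂ _∷_ (i a c e) (l x y z)
    where i : ∀ a c e → a + c + + 2 * e ≡ a + e + (c + e)
          i = solve-∀

d₂ d₃ d₄ : Pt
d₂ = e₂ -v e₁
d₃ = e₃ -v e₁
d₄ = e₄ -v e₁

-- Surjectivity on tiles provides preimages, so it is the transposed matrix that is seen to preserve
-- `V` and `D`; the wanted element of `W` is its inverse. Centres of norm 2 suffice because `2e₁`
-- and the differences `eᵢ - e₁` generate `D`.
fromPreimages : ∀ g → IsIso g → (∀ y → V y → Σ Pt λ x → V x × Maps g x y) →
  (∀ c → Cen c → norm2 c ≡ + 2 → Σ Pt λ x → Cen x × Maps g x c) → Σ Gp λ h → toAff h ≡ g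
fromPreimages (aff m b) isom ov oc = gp w t tv , cong₂ aff (tr-tr m) teq
  where
  g = aff m b
  z = ov zeroV ((+ 0 , refl) , (+ 0 , refl) , (+ 0 , refl))
  x₀ = proj₁ z
  pre : ∀ {x y} → Maps g x y → m ·m (x -v x₀) ≡ (+ 2) ·v y
  pre {x} {y} p = trans (maps-linear {g} p (proj₂ (proj₂ z))) (cong ((+ 2) ·v_) (sub-zero y))
  flip : ∀ {x y} → m ·m x ≡ (+ 2) ·v y → tr m ·m y ≡ (+ 2) ·v x
  flip {x} {y} p = 2v-cancel (trans (sym (·m-· (tr m) (+ 2) y)) (trans (cong (tr m ·m_) (sym p))
    (trans (tr-left-inverse m isom x) (sym (·v-assoc (+ 2) (+ 2) x)))))
  pV : ∀ y → V y → Σ Pt λ x → V x × tr m ·m y ≡ (+ 2) ·v x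
  pV y v = let x , xv , p = ov y v in x -v x₀ , V-- xv (proj₁ (proj₂ z)) , flip (pre p)
  pC : ∀ c → Cen c → norm2 c ≡ + 2 → Σ Pt λ x → D x × tr m ·m c ≡ (+ 2) ·v x
  pC y v n = let x , xc , p = oc y v n in x -v x₀ , D-- {x} (proj₁ (Cen⇒D∖V xc)) (V⇒D (proj₁ (proj₂ z))) , flip (pre p)
  pD : ∀ y → D y → Σ Pt λ x → D x × tr m ·m y ≡ (+ 2) ·v x
  pD (v4 a b c d) (k , e) =
    let x₁ , v₁ , p₁ = pV ((+ 2) ·v e₁) (V-2· e₁)
        x₂ , v₂ , p₂ = pC d₂ refl refl
        x₃ , v₃ , p₃ = pC d₃ refl refl
        x₄ , v₄ , p₄ = pC d₄ refl refl
        xs = v4 x₁ x₂ x₃ x₄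
        ks = v4 k b c d
    in lincomb ks xs ,
       D-+ {k ·v x₁} (D-· k {x₁} (V⇒D v₁)) (D-+ {b ·v x₂} (D-· b {x₂} v₂) (D-+ {c ·v x₃} (D-· c {x₃} v₃) (D-+ {d ·v x₄} {zeroV} (D-· d {x₄} v₄) (+ 0 , refl)))) ,
       trans (cong (tr m ·m_) (v4≡ (trans a≡ (i₁ k b c d)) (i₂ k b c d) (i₃ k b c d) (i₄ k b c d)))
         (trans (·m-lincomb (tr m) ks (v4 ((+ 2) ·v e₁) d₂ d₃ d₄))
          (trans (cong (lincomb ks) (cong₂ _∷_ p₁ (cong₂ _∷_ p₂ (cong₂ _∷_ p₃ (cong₂ _∷_ p₄ (refl {x = []})))))) (lincomb-· (+ 2) ks xs)))
    where
    a≡ : a ≡ + 2 * k - (b + (c + d))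
    a≡ = trans (f a (b + (c + d))) (cong (_- (b + (c + d))) e)
      where f : ∀ a s → a ≡ a + s - s
            f = solve-∀
    i₁ : ∀ k b c d → + 2 * k - (b + (c + d)) ≡ k * + 2 + (b * (- + 1) + (c * (- + 1) + (d * (- + 1) + + 0)))
    i₁ = solve-∀
    i₂ : ∀ k b c d → b ≡ k * + 0 + (b * + 1 + (c * + 0 + (d * + 0 + + 0)))
    i₂ = solve-∀
    i₃ : ∀ k b c d → c ≡ k * + 0 + (b * + 0 + (c * + 1 + (d * + 0 + + 0)))
    i₃ = solve-∀
    i₄ : ∀ k b c d → d ≡ k * + 0 + (b * + 0 + (c * + 0 + (d * + 1 + + 0)))
    i₄ = solve-∀
  w : W
  w = inv (record { mat = tr m ; iso = tr-iso m isom ; presV = pV ; presD = pD })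
  -- As `g` sends `x₀` to the origin, its translation part is the negative of the image of `x₀`
  -- under the linear part.
  τ = presV w x₀ (proj₁ (proj₂ z))
  t = (- + 1) ·v proj₁ τ
  tv = V-· (- + 1) (proj₁ (proj₂ τ))
  neg : ∀ {n} (x y c : Vec ℤ n) → x +v c ≡ (+ 2) ·v replicate n (+ 0) → x ≡ (+ 2) ·v y → (+ 2) ·v ((- + 1) ·v y) ≡ c
  neg [] [] [] _ _ = refl
  neg (a ∷ x) (u ∷ y) (c ∷ cs) p q = cong₂ _∷_ (i a u c (cong head p) (cong head q)) (neg x y cs (cong tail p) (cong tail q))
    where
    j : ∀ u c → + 2 * ((- + 1) * u) ≡ c - (+ 2 * u + c)
    j = solve-∀
    i : ∀ a u c → a + c ≡ + 0 → a ≡ + 2 * u → + 2 * ((- + 1) * u) ≡ c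
    i a u c p refl = trans (j u c) (trans (cong (λ s → c - s) p) (ℤP.+-identityʳ c))
  teq : (+ 2) ·v t ≡ b
  teq = neg (m ·m x₀) (proj₁ τ) b (proj₂ (proj₂ z)) (subst (λ n → n ·m x₀ ≡ (+ 2) ·v proj₁ τ) (tr-tr m) (proj₂ (proj₂ τ)))

dist-0ʳ : ∀ x → dist2 x zeroV ≡ norm2 x
dist-0ʳ x = cong norm2 (sub-zero x)

dist-0ˡ : ∀ x → dist2 zeroV x ≡ norm2 x
dist-0ˡ x = trans (dist-sym zeroV x) (dist-0ʳ x)

dist-+ : ∀ x u → dist2 (x +v u) x ≡ norm2 u
dist-+ x u = cong norm2 (trans (cong (_-v x) (+v-comm x u)) (+-cancel u x))

-- The difference `z -v v` has norm 2, which is even, so it lies in `D`, but not divisible by 4, so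
-- it does not lie in `V`.
cen-near : ∀ {z v} → V v → dist2 z v ≡ + 2 → Cen z
cen-near {z} {v} vv e = D∖V⇒Cen
  (subst D (-+-cancel z v) (D-+ {z -v v} (evenNorm⇒D {z -v v} (+ 1 , e)) (V⇒D vv)))
  λ zv → let k , p = V-norm (V-- zv vv) in two≢one k (cancel2 (trans (sym (ℤP.*-assoc (+ 2) (+ 2) k)) (trans (sym p) e)))

V0 : V zeroV
V0 = (+ 0 , refl) , (+ 0 , refl) , (+ 0 , refl)

lincomb-V : ∀ {n} (k : Vec ℤ n) vs → (∀ i → V (lookup vs i)) → V (lincomb k vs)
lincomb-V [] [] _ = V0
lincomb-V (k ∷ ks) (v ∷ vs) h = V-+ (V-· k (h zero)) (lincomb-V ks vs (λ i → h (suc i)))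

≐-refl : ∀ {F} → F ≐ F
≐-refl = (λ _ h → h) , (λ _ h → h)

c₀ : Pt
c₀ = v4 (+ 1) (+ 1) (+ 0) (+ 0)

cen-+ : ∀ {v} u → V v → norm2 u ≡ + 2 → Cen (v +v u)
cen-+ {v} u vv n = cen-near {v +v u} {v} vv (trans (dist-+ v u) n)

-- The vertex set of the 24-cell tile of {3,4,3,3} centred at the vertex `v` of {3,3,4,3}.
BallC : Pt → Pred
BallC v w = Cen w × dist2 v w ≡ + 2

single : ∀ {v} → V v → SubFace 0 (_≡ v)
single {v} vv = v +v c₀ , cen-+ c₀ vv refl , v ∷ [] ,
  (λ { zero → V⇒Vtx vv , trans (dist-sym v (v +v c₀)) (dist-+ v c₀) }) ,
  (λ { zero zero ne → ⊥-elim (ne refl) }) , λ x → (λ e → here e) , λ { (here e) → e ; (there ()) }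

BallC-face : ∀ {v} → V v → Face icosi (opposite zero) (BallC v)
BallC-face {v} vv = (_≡ v) , single vv , (λ { w (c , e) → c , λ { x refl → V⇒Vtx vv , e } }) , (λ { w (c , h) → c , proj₂ (h v refl) })

face-BallC : ∀ {C} → Face icosi (opposite zero) C → Σ Pt λ v → V v × C ≐ BallC v
face-BallC (F , (c , cc , v ∷ [] , inT , sep , mem) , e) = v , TileU-V v (inT zero) , ≐-trans e
  ((λ { w (c , h) → c , proj₂ (h v (mem v .proj₂ (here refl))) }) ,
   (λ { w (c , d) → c , λ x fx → tile (mem x .proj₁ fx) d }))
  where
  tile : ∀ {x w} → x ∈ v ∷ [] → dist2 v w ≡ + 2 → TileU w x
  tile (here refl) d = proj₁ (inT zero) , d

-- A symmetry is controlled only on vertices of tiles, so tile centres are reached as midpoints of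
-- antipodal vertices. A cross-polytope centre `d` of norm 2 lies between `0` and `2d`; a 24-cell
-- centre `y` lies between `y + c₀` and `y - c₀`. Preimages of such a pair are again at squared
-- distance 8, hence antipodal in the preimage tile.
Sym⇒Gp : ∀ T {g} → Sym T g → Σ Gp λ h → toAff h ≡ g
Sym⇒Gp cross {g} (isom , _ , onto) = fromPreimages g isom ov oc
  where
  ov : ∀ y → V y → Σ Pt λ x → V x × Maps g x y
  ov y v with onto (TileU (y +v c₀)) (lift (y +v c₀ , cen-+ c₀ v refl , ≐-refl))
  ... | C , lift (c , cc , e) , _ , im⊇ with im⊇ y (V⇒Vtx v , trans (dist-sym y (y +v c₀)) (dist-+ y c₀))
  ... | x , cx , p = x , TileU-V x (proj₁ e x cx) , p
  oc : ∀ d → Cen d → norm2 d ≡ + 2 → Σ Pt λ x → Cen x × Maps g x d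
  oc d cd n with onto (TileU d) (lift (d , cd , ≐-refl))
  ... | C , lift (c , cc , e) , _ , im⊇
    with im⊇ zeroV (inj₁ refl , trans (dist-0ˡ d) n)
       | im⊇ ((+ 2) ·v d) (V⇒Vtx (V-2· d) , trans (cong norm2 (half d)) n)
    where
    half : ∀ {n} (d : Vec ℤ n) → ((+ 2) ·v d) -v d ≡ d
    half [] = refl
    half (a ∷ d) = cong₂ _∷_ (l a) (half d)
      where l : ∀ a → + 2 * a - a ≡ a
            l = solve-∀
  ... | x , cx , p | y , cy , q = c , cc , maps-mid {g} p q
          (antipodal (proj₂ (proj₁ e x cx)) (proj₂ (proj₁ e y cy))
            (trans (sym (maps-dist {g} isom p q)) (trans (dist-0ˡ ((+ 2) ·v d)) (trans (norm-· (+ 2) d) (cong (+ 4 *_) n)))))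
          (zero+ ((+ 2) ·v d))
    where
    zero+ : ∀ {n} (x : Vec ℤ n) → replicate n (+ 0) +v x ≡ x
    zero+ [] = refl
    zero+ (a ∷ x) = cong₂ _∷_ (ℤP.+-identityˡ a) (zero+ x)
Sym⇒Gp icosi {g} (isom , _ , onto) = fromPreimages g isom ov oc
  where
  u⁻ : Pt
  u⁻ = (- + 1) ·v c₀
  ov : ∀ y → V y → Σ Pt λ x → V x × Maps g x y
  ov y v with onto (BallC y) (BallC-face v)
  ... | C , f , _ , im⊇ with face-BallC f
                           | im⊇ (y +v c₀) (cen-+ c₀ v refl , trans (dist-sym y (y +v c₀)) (dist-+ y c₀))
                           | im⊇ (y +v u⁻) (cen-+ u⁻ v refl , trans (dist-sym y (y +v u⁻)) (dist-+ y u⁻))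
  ... | t , tv , e | x , cx , p | x' , cx' , p' = t , tv , maps-mid {g} p p'
          (antipodal (trans (dist-sym x t) (proj₂ (proj₁ e x cx))) (trans (dist-sym x' t) (proj₂ (proj₁ e x' cx')))
            (trans (sym (maps-dist {g} isom p p')) (cong norm2 (diff y c₀))))
          (tot y c₀)
    where
    diff : ∀ {n} (y u : Vec ℤ n) → (y +v u) -v (y +v ((- + 1) ·v u)) ≡ (+ 2) ·v u
    diff [] [] = refl
    diff (a ∷ y) (c ∷ u) = cong₂ _∷_ (l a c) (diff y u)
      where l : ∀ a c → a + c - (a + (- + 1) * c) ≡ + 2 * c
            l = solve-∀
    tot : ∀ {n} (y u : Vec ℤ n) → (y +v u) +v (y +v ((- + 1) ·v u)) ≡ (+ 2) ·v y
    tot [] [] = refl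
    tot (a ∷ y) (c ∷ u) = cong₂ _∷_ (l a c) (tot y u)
      where l : ∀ a c → a + c + (a + (- + 1) * c) ≡ + 2 * a
            l = solve-∀
  oc : ∀ d → Cen d → norm2 d ≡ + 2 → Σ Pt λ x → Cen x × Maps g x d
  oc d cd n with onto (BallC zeroV) (BallC-face V0)
  ... | C , f , _ , im⊇ with face-BallC f | im⊇ d (cd , trans (dist-0ˡ d) n)
  ... | t , tv , e | x , cx , p = x , proj₁ (proj₁ e x cx) , p

-- The base flag and the flags of {3,3,4,3}

p₀ p₁ p₂ p₃ : Pt
p₀ = zeroV
p₁ = v4 (+ 2) (+ 0) (+ 0) (+ 0)
p₂ = 𝟙
p₃ = v4 (+ 1) (+ 1) (+ 1) (- + 1)

-- The last two hypotheses make `b * b` congruent to `a * a` and `d * d` to `c * c` modulo 4. So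
-- twice `a * a + c * c` is divisible by 4, and squares have the parity of their roots.
coordinate-parity : ∀ {a b c d k l} → a * a + (b * b + (c * c + (d * d + + 0))) ≡ + 4 →
  b - a ≡ + 2 * k → c - d ≡ + 2 * l → Even (c - a)
coordinate-parity {a} {b} {c} {d} {k} {l} e p q = subst Even (i₁ a c)
  (even-- (even-- (even-- (+ 1 - a * k - k * k + c * l - l * l ,
    cancel2 (trans (i₂ a c k l) (trans (cong (λ t → t - + 4 * (a * k) - + 4 * (k * k) + + 4 * (c * l) - + 4 * (l * l)) e') (i₃ a c k l))))
    (even-square-diff a)) (even-square-diff c)) (a , refl))
  where
  f : ∀ b a → b ≡ b - a + a
  f = solve-∀
  f' : ∀ c d → d ≡ c - (c - d)
  f' = solve-∀
  e' : a * a + ((+ 2 * k + a) * (+ 2 * k + a) + (c * c + ((c - + 2 * l) * (c - + 2 * l) + + 0))) ≡ + 4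
  e' = trans (cong₂ (λ b d → a * a + (b * b + (c * c + (d * d + + 0)))) (sym (trans (f b a) (cong (_+ a) p))) (sym (trans (f' c d) (cong (λ t → c - t) q)))) e
  i₁ : ∀ a c → a * a + c * c - (a * a - a) - (c * c - c) - + 2 * a ≡ c - a
  i₁ = solve-∀
  i₂ : ∀ a c k l → + 2 * (a * a + c * c) ≡
    a * a + ((+ 2 * k + a) * (+ 2 * k + a) + (c * c + ((c - + 2 * l) * (c - + 2 * l) + + 0))) - + 4 * (a * k) - + 4 * (k * k) + + 4 * (c * l) - + 4 * (l * l)
  i₂ = solve-∀
  i₃ : ∀ a c k l → + 4 - + 4 * (a * k) - + 4 * (k * k) + + 4 * (c * l) - + 4 * (l * l) ≡
    + 2 * (+ 2 * (+ 1 - a * k - k * k + c * l - l * l))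
  i₃ = solve-∀

-- The transpose of twice an isometry is again twice an isometry, so each row of the matrix with
-- columns `cᵢ` has norm 4, as `coordinate-parity` requires.
column-parity : ∀ c₁ c₂ c₃ c₄ p q → (∀ x → norm2 (tr (v4 c₁ c₂ c₃ c₄) ·m x) ≡ + 4 * norm2 x) →
  c₂ -v c₁ ≡ (+ 2) ·v p → c₃ -v c₄ ≡ (+ 2) ·v q → Half (c₃ -v c₁)
column-parity (v4 a b c d) (v4 e f g h) (v4 i j k l) (v4 m n o p) (v4 s₁ s₂ s₃ s₄) (v4 t₁ t₂ t₃ t₄) isom u w =
  v4 (r₁ .proj₁) (r₂ .proj₁) (r₃ .proj₁) (r₄ .proj₁) , v4≡ (r₁ .proj₂) (r₂ .proj₂) (r₃ .proj₂) (r₄ .proj₂)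
  where
  cs = v4 (v4 a b c d) (v4 e f g h) (v4 i j k l) (v4 m n o p)
  row : ∀ x → norm2 (cs ·m x) ≡ + 4 * norm2 x
  row = tr-iso (tr cs) isom
  at : (i : Fin 4) → ∀ {x y : Pt} → x ≡ y → lookup x i ≡ lookup y i
  at i = cong (λ x → lookup x i)
  r₁ = coordinate-parity {a} {e} {i} {m} (trans (sym (cong norm2 (v4≡ (dot-e₁ a b c d) (dot-e₁ e f g h) (dot-e₁ i j k l) (dot-e₁ m n o p)))) (row e₁)) (at zero u) (at zero w)
  r₂ = coordinate-parity {b} {f} {j} {n} (trans (sym (cong norm2 (v4≡ (dot-e₂ a b c d) (dot-e₂ e f g h) (dot-e₂ i j k l) (dot-e₂ m n o p)))) (row e₂)) (at 1F u) (at 1F w)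
  r₃ = coordinate-parity {c} {g} {k} {o} (trans (sym (cong norm2 (v4≡ (dot-e₃ a b c d) (dot-e₃ e f g h) (dot-e₃ i j k l) (dot-e₃ m n o p)))) (row e₃)) (at 2F u) (at 2F w)
  r₄ = coordinate-parity {d} {h} {l} {p} (trans (sym (cong norm2 (v4≡ (dot-e₄ a b c d) (dot-e₄ e f g h) (dot-e₄ i j k l) (dot-e₄ m n o p)))) (row e₄)) (at 3F u) (at 3F w)

-- Once the Gram matrix of `fs` consists of literals, inner products of explicit combinations are
-- decided by evaluation.
dot-gram : ∀ fs x y → dot (lincomb x fs) (lincomb y fs) ≡ dot (map (λ r → map (λ s → dot s r) fs) fs ·m y) x
dot-gram fs x y = trans (dot-lincomb fs (lincomb y fs) x) (cong (λ t → dot t x) (rows fs))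
  where
  rows : ∀ {n} (gs : Vec Pt n) → map (λ r → dot r (lincomb y fs)) gs ≡ map (λ row → dot row y) (map (λ r → map (λ s → dot s r) fs) gs)
  rows [] = refl
  rows (r ∷ gs) = cong₂ _∷_ (trans (dot-comm r (lincomb y fs)) (dot-lincomb fs r y)) (rows gs)

lincomb-+ˡ : ∀ {n} (x y : Vec ℤ n) fs → lincomb (x +v y) fs ≡ lincomb x fs +v lincomb y fs
lincomb-+ˡ [] [] [] = refl
lincomb-+ˡ (x ∷ xs) (y ∷ ys) (f ∷ fs) = trans (cong (((x + y) ·v f) +v_) (lincomb-+ˡ xs ys fs)) (l f (lincomb xs fs) (lincomb ys fs))
  where
  l : ∀ {n} (f u w : Vec ℤ n) → ((x + y) ·v f) +v (u +v w) ≡ ((x ·v f) +v u) +v ((y ·v f) +v w)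
  l [] [] [] = refl
  l (f ∷ fs) (u ∷ us) (w ∷ ws) = cong₂ _∷_ (i x y f u w) (l fs us ws)
    where i : ∀ x y f u w → (x + y) * f + (u + w) ≡ x * f + u + (y * f + w)
          i = solve-∀

lincomb-·ˡ : ∀ {n} k (x : Vec ℤ n) fs → lincomb (k ·v x) fs ≡ k ·v lincomb x fs
lincomb-·ˡ k [] [] = v4≡ (sym (ℤP.*-zeroʳ k)) (sym (ℤP.*-zeroʳ k)) (sym (ℤP.*-zeroʳ k)) (sym (ℤP.*-zeroʳ k))
lincomb-·ˡ k (x ∷ xs) (f ∷ fs) = trans (cong₂ _+v_ (sym (·v-assoc k x f)) (lincomb-·ˡ k xs fs)) (sym (·v-+ k (x ·v f) (lincomb xs fs)))

lincomb-zeroˡ : ∀ {n} (fs : Vec Pt n) → lincomb (replicate n (+ 0)) fs ≡ zeroV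
lincomb-zeroˡ [] = refl
lincomb-zeroˡ (v4 a b c d ∷ fs) = cong (zeroV +v_) (lincomb-zeroˡ fs)

lincomb-lincomb : ∀ {n} (x : Vec ℤ n) K fs → lincomb x (map (λ k → lincomb k fs) K) ≡ lincomb (lincomb x K) fs
lincomb-lincomb [] [] fs = sym (lincomb-zeroˡ fs)
lincomb-lincomb (x ∷ xs) (k ∷ K) fs = trans (cong₂ _+v_ (sym (lincomb-·ˡ x k fs)) (lincomb-lincomb xs K fs)) (sym (lincomb-+ˡ (x ·v k) (lincomb xs K) fs))

-- The differences from `v₀` have the same Gram matrix `G` as `p₁`, `p₂`, `p₃`, `c₀`, so an isometry
-- carries the base configuration to the given one. What takes work is that it preserves `V` and
-- `D`.
module _ {v₀ v₁ v₂ v₃ c : Pt} (V₀ : V v₀) (V₁ : V v₁) (V₂ : V v₂) (V₃ : V v₃)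
  (t₀ : dist2 v₀ c ≡ + 2) (t₁ : dist2 v₁ c ≡ + 2) (t₂ : dist2 v₂ c ≡ + 2) (t₃ : dist2 v₃ c ≡ + 2)
  (d₀₁ : dist2 v₁ v₀ ≡ + 4) (d₀₂ : dist2 v₂ v₀ ≡ + 4) (d₀₃ : dist2 v₃ v₀ ≡ + 4)
  (d₁₂ : dist2 v₂ v₁ ≡ + 4) (d₁₃ : dist2 v₃ v₁ ≡ + 4) (d₂₃ : dist2 v₃ v₂ ≡ + 4) where
  private
    a = v₁ -v v₀
    b' = v₂ -v v₀
    d = v₃ -v v₀
    e = c -v v₀
    fs = v4 a b' d e

    inner : ∀ x y {n m k} → norm2 (x -v v₀) ≡ + n → norm2 (y -v v₀) ≡ + m → dist2 x y ≡ + k →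
            + 2 * dot (x -v v₀) (y -v v₀) ≡ + n + + m - + k
    inner x y {n} {m} {k} p q r = trans (l (norm2 (x -v v₀)) _ (norm2 (y -v v₀)))
      (cong₂ _-_ (cong₂ _+_ p q) (trans (sym (norm-- (x -v v₀) (y -v v₀))) (trans (cong norm2 (sub-cancel x y v₀)) r)))
      where l : ∀ a b c → + 2 * b ≡ a + c - (a - + 2 * b + c)
            l = solve-∀
    ee : norm2 e ≡ + 2
    ee = trans (dist-sym c v₀) t₀
    ba : dot b' a ≡ + 2
    ba = cancel2 (inner v₂ v₁ d₀₂ d₀₁ d₁₂)
    da : dot d a ≡ + 2
    da = cancel2 (inner v₃ v₁ d₀₃ d₀₁ d₁₃)
    db : dot d b' ≡ + 2
    db = cancel2 (inner v₃ v₂ d₀₃ d₀₂ d₂₃)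
    ea : dot e a ≡ + 2
    ea = cancel2 (inner c v₁ ee d₀₁ (trans (dist-sym c v₁) t₁))
    eb : dot e b' ≡ + 2
    eb = cancel2 (inner c v₂ ee d₀₂ (trans (dist-sym c v₂) t₂))
    ed : dot e d ≡ + 2
    ed = cancel2 (inner c v₃ ee d₀₃ (trans (dist-sym c v₃) t₃))
    flip : ∀ {x y n} → dot {4} x y ≡ n → dot y x ≡ n
    flip {x} {y} h = trans (dot-comm y x) h

    G : Vec Pt 4
    G = v4 (v4 (+ 4) (+ 2) (+ 2) (+ 2)) (v4 (+ 2) (+ 4) (+ 2) (+ 2)) (v4 (+ 2) (+ 2) (+ 4) (+ 2)) (v4 (+ 2) (+ 2) (+ 2) (+ 2))
    gram : map (λ r → map (λ s → dot s r) fs) fs ≡ G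
    gram = cong₂ _∷_ (v4≡ d₀₁ ba da ea) (cong₂ _∷_ (v4≡ (flip {b'} ba) d₀₂ db eb)
      (cong₂ _∷_ (v4≡ (flip {d} da) (flip {d} db) d₀₃ ed) (cong₂ _∷_ (v4≡ (flip {e} ea) (flip {e} eb) (flip {e} ed) ee) refl)))
    gd : ∀ x y → dot (lincomb x fs) (lincomb y fs) ≡ dot (G ·m y) x
    gd x y = trans (dot-gram fs x y) (cong (λ t → dot (t ·m y) x) gram)

    -- kᵢ expresses 2eᵢ in terms of p₁, p₂, p₃ and c₀
    k₁ k₂ k₃ k₄ : Pt
    k₁ = v4 (+ 1) (+ 0) (+ 0) (+ 0)
    k₂ = v4 (- + 1) (+ 0) (+ 0) (+ 2)
    k₃ = v4 (+ 0) (+ 1) (+ 1) (- + 2)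
    k₄ = v4 (+ 0) (+ 1) (- + 1) (+ 0)
    c₁ = lincomb k₁ fs
    c₂ = lincomb k₂ fs
    c₃ = lincomb k₃ fs
    c₄ = lincomb k₄ fs
    cs = v4 c₁ c₂ c₃ c₄

    orth : Orthogonal cs
    orth = gd k₁ k₁ , gd k₁ k₂ ∷ gd k₁ k₃ ∷ gd k₁ k₄ ∷ [] , gd k₂ k₂ , gd k₂ k₃ ∷ gd k₂ k₄ ∷ [] ,
           gd k₃ k₃ , gd k₃ k₄ ∷ [] , gd k₄ k₄ , [] , tt

    -- The coefficient of `e` is even because `e` joins a vertex to a centre: twice `e` is
    -- guaranteed to lie in `V`.
    vfs : ∀ x y z w → V (lincomb (v4 x y z (w * + 2)) fs)
    vfs x y z w = V-+ (V-· x (V-- V₁ V₀)) (V-+ (V-· y (V-- V₂ V₀)) (V-+ (V-· z (V-- V₃ V₀))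
      (V-+ (subst V (·v-assoc w (+ 2) e) (V-· w (V-2· e))) V0)))

    K : Vec Pt 4
    K = v4 k₁ k₂ k₃ k₄

    halve : ∀ x k → lincomb x K ≡ (+ 2) ·v k → lincomb x cs ≡ (+ 2) ·v lincomb k fs
    halve x k h = trans (lincomb-lincomb x K fs) (trans (cong (λ t → lincomb t fs) h) (lincomb-·ˡ (+ 2) k fs))

    diff : ∀ {k l m} → k ≡ ((+ 2) ·v m) +v l → lincomb k fs -v lincomb l fs ≡ (+ 2) ·v lincomb m fs
    diff {k} {l} {m} h = trans (cong (λ t → lincomb t fs -v lincomb l fs) h)
      (trans (cong (_-v lincomb l fs) (lincomb-+ˡ ((+ 2) ·v m) l fs))
        (trans (+-cancel (lincomb ((+ 2) ·v m) fs) (lincomb l fs)) (lincomb-·ˡ (+ 2) m fs)))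

    κ₂ κ₃₄ : Pt
    κ₂ = v4 (- + 1) (+ 0) (+ 0) (+ 1)
    κ₃₄ = v4 (+ 0) (+ 0) (+ 1) (- + 1)

    diffs₂ : c₂ -v c₁ ≡ (+ 2) ·v lincomb κ₂ fs
    diffs₂ = diff {k₂} {k₁} {κ₂} refl

    diffs₃₄ : c₃ -v c₄ ≡ (+ 2) ·v lincomb κ₃₄ fs
    diffs₃₄ = diff {k₃} {k₄} {κ₃₄} refl

    -- Unlike `e₂ - e₁` and `e₃ - e₄`, the vector `e₃ - e₁` is not an integral combination of `p₁`,
    -- `p₂`, `p₃`, `c₀`, so its image is not visibly integral; the parity of the rows supplies this.
    half₃ : Half (c₃ -v c₁)
    half₃ = column-parity c₁ c₂ c₃ c₄ (lincomb κ₂ fs) (lincomb κ₃₄ fs)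
      (λ x → trans (cong norm2 (tr-·m cs x)) (orth-norm cs orth x)) diffs₂ diffs₃₄

    diff₄ : ∀ {n} (x y z p q : Vec ℤ n) → x -v y ≡ (+ 2) ·v p → x -v z ≡ (+ 2) ·v q → z -v y ≡ (+ 2) ·v (p -v q)
    diff₄ [] [] [] [] [] _ _ = refl
    diff₄ (x ∷ xs) (y ∷ ys) (z ∷ zs) (p ∷ ps) (q ∷ qs) h k = cong₂ _∷_
      (trans (i x y z) (trans (cong₂ _-_ (cong head h) (cong head k)) (j p q))) (diff₄ xs ys zs ps qs (cong tail h) (cong tail k))
      where
      i : ∀ x y z → z - y ≡ (x - y) - (x - z)
      i = solve-∀
      j : ∀ p q → + 2 * p - + 2 * q ≡ + 2 * (p - q)
      j = solve-∀

  frameW : W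
  frameW = fromColumns c₁ c₂ c₃ c₄ (lincomb e₂ fs) orth (vfs (- + 1) (+ 0) (+ 0) (+ 1)) (vfs (+ 0) (+ 1) (+ 1) (- + 1)) (vfs (+ 0) (+ 1) (- + 1) (+ 0))
    (vfs (+ 0) (+ 1) (+ 0) (+ 0)) (halve 𝟙 e₂ refl) (lincomb κ₂ fs) (proj₁ half₃) (proj₁ half₃ -v lincomb κ₃₄ fs) diffs₂ (proj₂ half₃)
    (diff₄ c₃ c₁ c₄ (proj₁ half₃) (lincomb κ₃₄ fs) (proj₂ half₃) diffs₃₄)

  frameGp : Gp
  frameGp = gp frameW v₀ V₀

  private
    at : ∀ x k {y} → lincomb x K ≡ (+ 2) ·v k → lincomb k fs ≡ y -v v₀ → R frameGp x y
    at x k {y} h q = ↦⇒R frameGp {x} {y} (trans (tr-·m cs x) (trans (halve x k h) (cong ((+ 2) ·v_) q)))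

    unit₁ : ∀ a b d e → lincomb e₁ (v4 a b d e) ≡ a
    unit₁ (v4 a₁ a₂ a₃ a₄) (v4 _ _ _ _) (v4 _ _ _ _) (v4 _ _ _ _) = v4≡ (l a₁) (l a₂) (l a₃) (l a₄)
      where l : ∀ a → + 1 * a + + 0 ≡ a
            l = solve-∀
    unit₂ : ∀ a b d e → lincomb e₂ (v4 a b d e) ≡ b
    unit₂ (v4 _ _ _ _) (v4 a₁ a₂ a₃ a₄) (v4 _ _ _ _) (v4 _ _ _ _) = v4≡ (l a₁) (l a₂) (l a₃) (l a₄)
      where l : ∀ a → + 0 + (+ 1 * a + + 0) ≡ a
            l = solve-∀
    unit₃ : ∀ a b d e → lincomb e₃ (v4 a b d e) ≡ d
    unit₃ (v4 _ _ _ _) (v4 _ _ _ _) (v4 a₁ a₂ a₃ a₄) (v4 _ _ _ _) = v4≡ (l a₁) (l a₂) (l a₃) (l a₄)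
      where l : ∀ a → + 0 + (+ 0 + (+ 1 * a + + 0)) ≡ a
            l = solve-∀
    unit₄ : ∀ a b d e → lincomb e₄ (v4 a b d e) ≡ e
    unit₄ (v4 _ _ _ _) (v4 _ _ _ _) (v4 _ _ _ _) (v4 a₁ a₂ a₃ a₄) = v4≡ (l a₁) (l a₂) (l a₃) (l a₄)
      where l : ∀ a → + 0 + (+ 0 + (+ 0 + (+ 1 * a + + 0))) ≡ a
            l = solve-∀

    zz : ∀ x → x -v x ≡ zeroV
    zz (v4 a b c d) = v4≡ (ℤP.+-inverseʳ a) (ℤP.+-inverseʳ b) (ℤP.+-inverseʳ c) (ℤP.+-inverseʳ d)

  frame-p₀ : R frameGp p₀ v₀
  frame-p₀ = ↦⇒R frameGp {p₀} {v₀} (trans (·m-zero (tr cs)) (cong ((+ 2) ·v_) (sym (zz v₀))))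
  frame-p₁ : R frameGp p₁ v₁
  frame-p₁ = at p₁ e₁ refl (unit₁ a b' d e)
  frame-p₂ : R frameGp p₂ v₂
  frame-p₂ = at p₂ e₂ refl (unit₂ a b' d e)
  frame-p₃ : R frameGp p₃ v₃
  frame-p₃ = at p₃ e₃ refl (unit₃ a b' d e)
  frame-c₀ : R frameGp c₀ c
  frame-c₀ = at c₀ e₄ refl (unit₄ a b' d e)

  abstract
    frame : Σ Gp λ g → R g p₀ v₀ × R g p₁ v₁ × R g p₂ v₂ × R g p₃ v₃ × R g c₀ c
    frame = frameGp , frame-p₀ , frame-p₁ , frame-p₂ , frame-p₃ , frame-c₀

-- Vertices of the faces in a flag

V-dist : ∀ {x y} → V x → V y → (x ≡ y) ⊎ Σ ℕ λ n → dist2 x y ≡ + 4 * (+ 1 + + n)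
V-dist {x} {y} vx vy with V-norm (V-- vx vy)
... | + 0 , e = inj₁ (dist-zero x y e)
... | + suc n , e = inj₂ (n , e)
... | -[1+ n ] , e with subst (+ 0 ≤_) e (0≤dot (x -v y))
... | ()

-- The squared distance is a positive multiple of 4. A value of at least 12 would make the norm in
-- `parallelogram` negative.
tile-dist : ∀ {x y c} → V x → V y → dist2 x c ≡ + 2 → dist2 y c ≡ + 2 → x ≢ y → dist2 x y ≢ + 8 → dist2 x y ≡ + 4
tile-dist {x} {y} {c} vx vy p q ne n8 with V-dist vx vy
... | inj₁ e = ⊥-elim (ne e)
... | inj₂ (0 , e) = e
... | inj₂ (1 , e) = ⊥-elim (n8 e)
... | inj₂ (suc (suc n) , e) = ⊥-elim (neg (subst (+ 0 ≤_) eq (0≤dot ((x +v y) -v ((+ 2) ·v c)))))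
  where
  l : ∀ n → + 2 * + 2 + + 2 * + 2 - + 4 * (+ 1 + (+ 2 + n)) ≡ - (+ 4 + + 4 * n)
  l = solve-∀
  eq : norm2 ((x +v y) -v ((+ 2) ·v c)) ≡ - (+ 4 + + (4 ℕ.* n))
  eq = trans (parallelogram x y c) (trans (cong₂ _-_ (cong₂ _+_ (cong (+ 2 *_) p) (cong (+ 2 *_) q)) e)
    (trans (l (+ n)) (cong (λ t → - (+ 4 + t)) (sym (ℤP.pos-* 4 n)))))
  neg : ¬ (+ 0 ≤ - (+ 4 + + (4 ℕ.* n)))
  neg ()

Distinct : ∀ {n} → Vec Pt n → Set
Distinct [] = ⊤
Distinct (v ∷ vs) = (∀ y → y ∈ vs → y ≢ v) × Distinct vs

distinct : ∀ {n} (vs : Vec Pt n) → (∀ i j → i ≢ j → lookup vs i ≢ lookup vs j) → Distinct vs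
distinct [] _ = tt
distinct (v ∷ vs) h = (λ y q e → h (suc (index q)) zero (λ ()) (trans (sym (lookup-index q)) e)) ,
  distinct vs (λ i j ne → h (suc i) (suc j) (λ { refl → ne refl }))

remove : ∀ {n} (vs : Vec Pt (suc n)) {x} → Distinct vs → x ∈ vs → Σ (Vec Pt n) λ ws → Distinct ws ×
  (∀ y → y ∈ ws → y ∈ vs × y ≢ x) × (∀ y → y ∈ vs → y ≡ x ⊎ y ∈ ws)
remove (v ∷ vs) (nv , ds) (here refl) = vs , ds , (λ y q → there q , nv y q) , λ { y (here e) → inj₁ e ; y (there q) → inj₂ q }
remove {zero} (v ∷ []) _ (there ())
remove {suc n} (v ∷ vs) {x} (nv , ds) (there p) with remove vs ds p
... | ws , dw , sub , cov = v ∷ ws , ((λ y q → nv y (sub y q .proj₁)) , dw) ,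
  (λ { y (here refl) → here refl , (λ e → nv x p (sym e)) ; y (there q) → there (sub y q .proj₁) , sub y q .proj₂ }) ,
  λ { y (here e) → inj₂ (here e) ; y (there q) → [ inj₁ , (λ r → inj₂ (there r)) ]′ (cov y q) }

-- Each face of dimension at most 3 in a flag has one vertex more than the preceding one; this finds
-- it. Repetition orders the vertices of the facet so that they record the flag, newest vertex at
-- the head.
extend : ∀ {n} (us : Vec Pt n) (vs : Vec Pt (suc n)) → Distinct us → Distinct vs → (∀ y → y ∈ us → y ∈ vs) →
  Σ Pt λ v → Distinct (v ∷ us) × (∀ y → y ∈ vs → y ∈ v ∷ us) × (∀ y → y ∈ v ∷ us → y ∈ vs)
extend [] (v ∷ []) _ _ _ = v , ((λ { y () }) , tt) , (λ y q → q) , (λ y q → q)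
extend (u ∷ us) vs (nu , du) dv s with remove vs dv (s u (here refl))
... | ws , dw , sub , cov with extend us ws du dw (λ y q → [ (λ e → ⊥-elim (nu y q e)) , (λ r → r) ]′ (cov y (s y (there q))))
... | v , (nv , _) , to , from = v ,
  ((λ { y (here refl) e → sub v (from v (here refl)) .proj₂ (sym e) ; y (there q) → nv y q }) , nu , du) ,
  (λ y q → [ (λ { refl → there (here refl) }) , (λ r → ins (to y r)) ]′ (cov y q)) ,
  λ { y (here e) → sub y (from y (here e)) .proj₁ ; y (there (here refl)) → s u (here refl) ; y (there (there q)) → sub y (from y (there q)) .proj₁ }
  where
  ins : ∀ {y} → y ∈ v ∷ us → y ∈ v ∷ u ∷ us
  ins (here e) = here e
  ins (there q) = there (there q)

-- Each `SubFace` brings a tile centre of its own, possibly different from the centre of the tile in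
-- the flag. Excluding the distance 8 expresses the absence of antipodal pairs without reference to
-- a centre.
record Cells (n : ℕ) (us : Vec Pt (suc n)) (F : Pred) : Set where
  field
    distinct-us : Distinct us
    enum : F ≐ (_∈ us)
    separated : ∀ x y → F x → F y → x ≢ y → dist2 x y ≢ + 8
    vertices : F ⊆ V
open Cells

first : ∀ {n F} → SubFace n F → Σ (Vec Pt (suc n)) λ vs → Cells n vs F
first {n} {F} f@(c , cc , vs , inT , sep , mem) = vs , record
  { distinct-us = distinct vs (λ i j ne → sep i j ne .proj₁)
  ; enum = (λ x → mem x .proj₁) , (λ x → mem x .proj₂)
  ; separated = λ x y fx fy ne d → let p = mem x .proj₁ fx ; q = mem y .proj₁ fy in
      sep (index p) (index q) (λ e → ne (trans (lookup-index p) (trans (cong (lookup vs) e) (sym (lookup-index q))))) .proj₂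
        (subst₂ (λ a b → a +v b ≡ (+ 2) ·v c) (lookup-index p) (lookup-index q)
          (antipodal (subst (λ t → dist2 t c ≡ + 2) (sym (lookup-index p)) (inT (index p) .proj₂)) (subst (λ t → dist2 t c ≡ + 2) (sym (lookup-index q)) (inT (index q) .proj₂)) d))
  ; vertices = SubFace-V n f }

next : ∀ {n us E F} → Cells n us E → SubFace (suc n) F → E ⊆ F → Σ Pt λ v → Cells (suc n) (v ∷ us) F
next {us = us} C f s with first f
... | vs , C' with extend us vs (distinct-us C) (distinct-us C') (λ y q → proj₁ (enum C') y (s y (proj₂ (enum C) y q)))
... | v , dv , to , from = v , record
  { distinct-us = dv ; enum = (λ y fy → to y (proj₁ (enum C') y fy)) , (λ y q → proj₂ (enum C') y (from y q))
  ; separated = separated C' ; vertices = vertices C' }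

facet-frame : ∀ {v₀ v₁ v₂ v₃ F c} → Cells 3 (v4 v₃ v₂ v₁ v₀) F → F ⊆ TileU c →
  Σ Gp λ g → R g p₀ v₀ × R g p₁ v₁ × R g p₂ v₂ × R g p₃ v₃ × R g c₀ c
facet-frame {v₀} {v₁} {v₂} {v₃} {F} {c} C s = frame (V' m₀) (V' m₁) (V' m₂) (V' m₃) (T' m₀) (T' m₁) (T' m₂) (T' m₃)
  (δ m₁ m₀ (λ e → d .proj₂ .proj₂ .proj₁ v₀ (here refl) (sym e)))
  (δ m₂ m₀ (λ e → d .proj₂ .proj₁ v₀ (there (here refl)) (sym e)))
  (δ m₃ m₀ (λ e → d .proj₁ v₀ (there (there (here refl))) (sym e)))
  (δ m₂ m₁ (λ e → d .proj₂ .proj₁ v₁ (here refl) (sym e)))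
  (δ m₃ m₁ (λ e → d .proj₁ v₁ (there (here refl)) (sym e)))
  (δ m₃ m₂ (λ e → d .proj₁ v₂ (here refl) (sym e)))
  where
  d = distinct-us C
  us = v4 v₃ v₂ v₁ v₀
  m₃ : v₃ ∈ us
  m₃ = here refl
  m₂ : v₂ ∈ us
  m₂ = there (here refl)
  m₁ : v₁ ∈ us
  m₁ = there (there (here refl))
  m₀ : v₀ ∈ us
  m₀ = there (there (there (here refl)))
  F' : ∀ {x} → x ∈ us → F x
  F' q = proj₂ (enum C) _ q
  V' : ∀ {x} → x ∈ us → V x
  V' {x} q = vertices C x (F' q)
  T' : ∀ {x} → x ∈ us → dist2 x c ≡ + 2
  T' {x} q = proj₂ (s x (F' q))
  δ : ∀ {x y} → x ∈ us → y ∈ us → x ≢ y → dist2 x y ≡ + 4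
  δ {x} {y} p q ne = tile-dist {x} {y} {c} (V' p) (V' q) (T' p) (T' q) ne (separated C x y (F' p) (F' q) ne)

im-list : ∀ g {n} {us vs : Vec Pt n} → Pointwise (R g) us vs → im g (_∈ us) ≐ (_∈ vs)
im-list g {us = us} {vs} h = (λ { y (x , q , r) → to h q r }) , λ y q → from h q
  where
  to : ∀ {n} {us vs : Vec Pt n} → Pointwise (R g) us vs → ∀ {x y} → x ∈ us → R g x y → y ∈ vs
  to (p ∷ h) (here refl) r = here (R-unique g r p)
  to (p ∷ h) (there q) r = there (to h q r)
  from : ∀ {n} {us vs : Vec Pt n} → Pointwise (R g) us vs → ∀ {y} → y ∈ vs → Σ Pt λ x → x ∈ us × R g x y
  from (p ∷ h) (here refl) = _ , here refl , p
  from (p ∷ h) (there q) = let x , m , r = from h q in x , there m , r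

base : Fin 5 → Pred
base zero = _∈ p₀ ∷ []
base 1F = _∈ p₁ ∷ p₀ ∷ []
base 2F = _∈ p₂ ∷ p₁ ∷ p₀ ∷ []
base 3F = _∈ p₃ ∷ p₂ ∷ p₁ ∷ p₀ ∷ []
base 4F = TileU c₀

list-face : ∀ {n} (ps : Vec Pt (suc n)) → (∀ i → TileU c₀ (lookup ps i)) →
  (∀ i j → i ≢ j → (lookup ps i ≢ lookup ps j) × ((lookup ps i +v lookup ps j) ≢ (+ 2) ·v c₀)) → SubFace n (_∈ ps)
list-face ps t s = c₀ , refl , ps , t , s , λ x → (λ q → q) , (λ q → q)

tail-sep : ∀ {n} {p} {ps : Vec Pt n} →
  (∀ i j → i ≢ j → (lookup (p ∷ ps) i ≢ lookup (p ∷ ps) j) × ((lookup (p ∷ ps) i +v lookup (p ∷ ps) j) ≢ (+ 2) ·v c₀)) →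
  (∀ i j → i ≢ j → (lookup ps i ≢ lookup ps j) × ((lookup ps i +v lookup ps j) ≢ (+ 2) ·v c₀))
tail-sep h i j ne = h (suc i) (suc j) (λ { refl → ne refl })

base-tile : ∀ i → TileU c₀ (lookup (v4 p₃ p₂ p₁ p₀) i)
base-tile zero = inj₂ refl , refl
base-tile 1F = inj₂ refl , refl
base-tile 2F = inj₁ refl , refl
base-tile 3F = inj₁ refl , refl

base-sep : ∀ i j → i ≢ j → (lookup (v4 p₃ p₂ p₁ p₀) i ≢ lookup (v4 p₃ p₂ p₁ p₀) j) × ((lookup (v4 p₃ p₂ p₁ p₀) i +v lookup (v4 p₃ p₂ p₁ p₀) j) ≢ (+ 2) ·v c₀)
base-sep = toWitness {a? = all? λ i → all? λ j → ¬? (i ≟F j) →-dec (¬? (≡-dec ℤP._≟_ _ _) ×-dec ¬? (≡-dec ℤP._≟_ _ _))} tt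

base-face : ∀ k → FaceU k (base k)
base-face zero = list-face (p₀ ∷ []) (λ i → base-tile (suc (suc (suc i)))) (tail-sep (tail-sep (tail-sep base-sep)))
base-face 1F = list-face (p₁ ∷ p₀ ∷ []) (λ i → base-tile (suc (suc i))) (tail-sep (tail-sep base-sep))
base-face 2F = list-face (p₂ ∷ p₁ ∷ p₀ ∷ []) (λ i → base-tile (suc i)) (tail-sep base-sep)
base-face 3F = list-face (v4 p₃ p₂ p₁ p₀) base-tile base-sep
base-face 4F = c₀ , refl , ≐-refl

base-incl : ∀ k → base (inject₁ k) ⊆ base (suc k)
base-incl zero x q = there q
base-incl 1F x q = there q
base-incl 2F x q = there q
base-incl 3F x q = subst (TileU c₀) (sym (lookup-index q)) (base-tile (index q))

cross-transitive : (Φ : Fin 5 → Pred) → (∀ k → FaceU k (Φ k)) → (∀ k → Φ (inject₁ k) ⊆ Φ (suc k)) →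
  Σ Gp λ g → ∀ k → im g (base k) ≐ Φ k
cross-transitive Φ f s = go (first (f zero)) (f 4F)
  where
  go : (Σ (Vec Pt 1) λ vs → Cells 0 vs (Φ zero)) → FaceU 4F (Φ 4F) →
    Σ Gp λ g → ∀ k → im g (base k) ≐ Φ k
  go (v₀ ∷ [] , C₀) (c , cc , T) =
    let v₁ , C₁ = next C₀ (f 1F) (s zero)
        v₂ , C₂ = next C₁ (f 2F) (s 1F)
        v₃ , C₃ = next C₂ (f 3F) (s 2F)
        g , r₀ , r₁ , r₂ , r₃ , rc = facet-frame C₃ (λ x h → proj₁ T x (s 3F x h))
    in g , build g v₀ v₁ v₂ v₃ r₀ r₁ r₂ r₃ rc C₀ C₁ C₂ C₃ T
    where
    build : ∀ g v₀ v₁ v₂ v₃ → R g p₀ v₀ → R g p₁ v₁ → R g p₂ v₂ → R g p₃ v₃ → R g c₀ c →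
      Cells 0 (v₀ ∷ []) (Φ zero) → Cells 1 (v₁ ∷ v₀ ∷ []) (Φ 1F) → Cells 2 (v₂ ∷ v₁ ∷ v₀ ∷ []) (Φ 2F) →
      Cells 3 (v₃ ∷ v₂ ∷ v₁ ∷ v₀ ∷ []) (Φ 3F) → Φ 4F ≐ TileU c →
      ∀ k → im g (base k) ≐ Φ k
    build g v₀ v₁ v₂ v₃ r₀ r₁ r₂ r₃ rc C₀ C₁ C₂ C₃ T zero = ≐-trans (im-list g {us = p₀ ∷ []} {v₀ ∷ []} (r₀ ∷ [])) (≐-sym (enum C₀))
    build g v₀ v₁ v₂ v₃ r₀ r₁ r₂ r₃ rc C₀ C₁ C₂ C₃ T 1F = ≐-trans (im-list g {us = p₁ ∷ p₀ ∷ []} {v₁ ∷ v₀ ∷ []} (r₁ ∷ r₀ ∷ [])) (≐-sym (enum C₁))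
    build g v₀ v₁ v₂ v₃ r₀ r₁ r₂ r₃ rc C₀ C₁ C₂ C₃ T 2F = ≐-trans (im-list g {us = p₂ ∷ p₁ ∷ p₀ ∷ []} {v₂ ∷ v₁ ∷ v₀ ∷ []} (r₂ ∷ r₁ ∷ r₀ ∷ [])) (≐-sym (enum C₂))
    build g v₀ v₁ v₂ v₃ r₀ r₁ r₂ r₃ rc C₀ C₁ C₂ C₃ T 3F = ≐-trans (im-list g {us = v4 p₃ p₂ p₁ p₀} {v4 v₃ v₂ v₁ v₀} (r₃ ∷ r₂ ∷ r₁ ∷ r₀ ∷ [])) (≐-sym (enum C₃))
    build g v₀ v₁ v₂ v₃ r₀ r₁ r₂ r₃ rc C₀ C₁ C₂ C₃ T 4F = ≐-trans (im-TileU g rc) (≐-sym T)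

-- Duality, and the flags of {3,4,3,3}

-- F is the intersection of the tiles that contain it.
Closed : Pred → Set
Closed F = ∀ x → V x → (∀ w → Dual F w → dist2 x w ≡ + 2) → F x

Closed-cong : ∀ {F G} → F ≐ G → Closed F → Closed G
Closed-cong e h x v t = proj₁ e x (h x v (λ w d → t w (proj₁ (Dual-cong e) w d)))

Closed-im : ∀ g {F} → F ⊆ V → Closed F → Closed (im g F)
Closed-im g {F} s h y v t = let x , xv , r = onV' g y v in
  x , h x xv (λ w d → let w' , c' , r' = actC g w (proj₁ d) in
    trans (sym (R-dist g r r')) (t w' (proj₁ (im-Dual g s) w' (w , d , r')))) , r

in-dual : ∀ {n} {ps : Vec Pt n} w → Cen w → All (TileU w) ps → Dual (_∈ ps) w
in-dual w c a = c , λ x q → go a q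
  where
  go : ∀ {n} {ps : Vec Pt n} {x} → All (TileU w) ps → x ∈ ps → TileU w x
  go (t ∷ _) (here refl) = t
  go (_ ∷ a) (there q) = go a q

far : ∀ {x p} → V x → V p → x ≡ p ⊎ + 4 ≤ dist2 x p
far {x} {p} vx vp with V-dist vx vp
... | inj₁ e = inj₁ e
... | inj₂ (n , e) = inj₂ (subst (+ 4 ≤_) (sym (trans e (l (+ n)))) (subst (λ t → + 4 ≤ + 4 + t) (ℤP.pos-* 4 n) (ℤP.+-monoʳ-≤ (+ 4) (+≤+ z≤n))))
  where l : ∀ n → + 4 * (+ 1 + n) ≡ + 4 + + 4 * n
        l = solve-∀

V𝟙 : V 𝟙
V𝟙 = (+ 0 , refl) , (+ 0 , refl) , (+ 0 , refl)

Vp₃ : V p₃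
Vp₃ = (+ 0 , refl) , (+ 0 , refl) , (+ 1 , refl)

Vp₁ : V p₁
Vp₁ = V-2· e₁

sumDist : Pt → ∀ {n} → Vec Pt n → ℤ
sumDist x [] = + 0
sumDist x (p ∷ ps) = dist2 x p + sumDist x ps

vsum : ∀ {n} → Vec Pt n → Pt
vsum [] = zeroV
vsum (p ∷ ps) = p +v vsum ps

nsum : ∀ {n} → Vec Pt n → ℤ
nsum [] = + 0
nsum (p ∷ ps) = norm2 p + nsum ps

sumDist-expand : ∀ x {n} (ps : Vec Pt n) → sumDist x ps ≡ + n * norm2 x - + 2 * dot x (vsum ps) + nsum ps
sumDist-expand x [] = sym (trans (cong (λ t → + 0 * norm2 x - + 2 * t + + 0) (dot-zeroʳ x)) (l (norm2 x)))
  where l : ∀ a → + 0 * a - + 2 * + 0 + + 0 ≡ + 0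
        l = solve-∀
sumDist-expand x {suc n} (p ∷ ps) = trans (cong₂ _+_ (norm-- x p) (sumDist-expand x ps))
  (trans (l (+ n) (norm2 x) (dot x p) (dot x (vsum ps)) (norm2 p) (nsum ps))
    (cong (λ t → (+ 1 + + n) * norm2 x - + 2 * t + (norm2 p + nsum ps)) (sym (dot-+ʳ x p (vsum ps)))))
  where l : ∀ n x p v q r → x - + 2 * p + q + (n * x - + 2 * v + r) ≡ (+ 1 + n) * x - + 2 * (p + v) + (q + r)
        l = solve-∀

-- The mean distance to the centres ws determines the mean distance to the vertices ps, which is
-- too small for x to be at distance at least 2 from all of them.
closed-by : ∀ {n} (ps ws : Vec Pt n) → All V ps → All (Dual (_∈ ps)) ws → vsum ps ≡ vsum ws →
  nsum ps < nsum ws + + (2 ℕ.* n) → Closed (_∈ ps)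
closed-by {n} ps ws vs ds e lt x v t = [ (λ q → q) , (λ h → ⊥-elim (ℤP.<⇒≱ lt (bound h))) ]′ (search ps vs)
  where
  search : ∀ {n} (ps : Vec Pt n) → All V ps → x ∈ ps ⊎ + (4 ℕ.* n) ≤ sumDist x ps
  search [] [] = inj₂ (+≤+ z≤n)
  search {suc n} (p ∷ ps) (pv ∷ vs) with far {x} {p} v pv | search ps vs
  ... | inj₁ q | _ = inj₁ (here q)
  ... | inj₂ _ | inj₁ q = inj₁ (there q)
  ... | inj₂ h | inj₂ h' = inj₂ (subst (_≤ dist2 x p + sumDist x ps) (cong +_ (sym (ℕP.*-suc 4 n))) (ℤP.+-mono-≤ h h'))
  centres : ∀ {m} (ws : Vec Pt m) → All (Dual (_∈ ps)) ws → sumDist x ws ≡ + (2 ℕ.* m)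
  centres [] [] = refl
  centres {suc m} (w ∷ ws) (d ∷ ds) = trans (cong₂ _+_ (t w d) (centres ws ds)) (cong +_ (sym (ℕP.*-suc 2 m)))
  balance : sumDist x ps + nsum ws ≡ + (2 ℕ.* n) + nsum ps
  balance = trans (cong (_+ nsum ws) (trans (sumDist-expand x ps) (cong (λ u → + n * norm2 x - + 2 * dot x u + nsum ps) e)))
    (trans (l (+ n * norm2 x) (dot x (vsum ws)) (nsum ps) (nsum ws)) (cong (_+ nsum ps) (trans (sym (sumDist-expand x ws)) (centres ws ds))))
    where l : ∀ a b p w → a - + 2 * b + p + w ≡ a - + 2 * b + w + p
          l = solve-∀
  l₁ : ∀ m w → (m + m) + w - m ≡ w + m
  l₁ = solve-∀
  l₂ : ∀ m p → m + p - m ≡ p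
  l₂ = solve-∀
  4n : + (4 ℕ.* n) ≡ + (2 ℕ.* n) + + (2 ℕ.* n)
  4n = cong +_ (ℕP.*-distribʳ-+ n 2 2)
  bound : + (4 ℕ.* n) ≤ sumDist x ps → nsum ws + + (2 ℕ.* n) ≤ nsum ps
  bound h = subst₂ _≤_ (trans (cong (λ u → u + nsum ws - + (2 ℕ.* n)) 4n) (l₁ (+ (2 ℕ.* n)) (nsum ws))) (l₂ (+ (2 ℕ.* n)) (nsum ps))
    (ℤP.+-monoˡ-≤ (- + (2 ℕ.* n)) (subst (+ (4 ℕ.* n) + nsum ws ≤_) balance (ℤP.+-monoˡ-≤ (nsum ws) h)))

pattern on-even = inj₁ refl , refl
pattern on-odd = inj₂ refl , refl

-- The centres belong to tiles that contain the face. Vertices and centres are repeated where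
-- necessary to give two lists of the same length and sum: `p₀` is doubled to balance the opposite
-- centres `c₀` and `-c₀`, and two centres are doubled to match the four vertices of the facet. For
-- the tile itself, `c₀` is already in the dual.
base-closed : ∀ k → Closed (base k)
base-closed zero = Closed-cong ((λ { x (here e) → here e ; x (there q) → q }) , (λ x q → there q))
  (closed-by (p₀ ∷ p₀ ∷ []) (c₀ ∷ v4 (- + 1) (- + 1) (+ 0) (+ 0) ∷ []) (V0 ∷ V0 ∷ [])
    (in-dual c₀ refl (on-even ∷ on-even ∷ []) ∷ in-dual _ refl (on-even ∷ on-even ∷ []) ∷ []) refl (toWitness {a? = _ ℤ.<? _} tt))
base-closed 1F = closed-by (p₁ ∷ p₀ ∷ []) (c₀ ∷ v4 (+ 1) (- + 1) (+ 0) (+ 0) ∷ []) (Vp₁ ∷ V0 ∷ [])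
    (in-dual c₀ refl (on-even ∷ on-even ∷ []) ∷ in-dual _ refl (on-even ∷ on-even ∷ []) ∷ []) refl (toWitness {a? = _ ℤ.<? _} tt)
base-closed 2F = closed-by (p₂ ∷ p₁ ∷ p₀ ∷ []) (c₀ ∷ v4 (+ 1) (+ 0) (+ 1) (+ 0) ∷ v4 (+ 1) (+ 0) (+ 0) (+ 1) ∷ []) (V𝟙 ∷ Vp₁ ∷ V0 ∷ [])
    (in-dual c₀ refl (on-odd ∷ on-even ∷ on-even ∷ []) ∷ in-dual _ refl (on-odd ∷ on-even ∷ on-even ∷ []) ∷ in-dual _ refl (on-odd ∷ on-even ∷ on-even ∷ []) ∷ []) refl (toWitness {a? = _ ℤ.<? _} tt)
base-closed 3F = closed-by (p₃ ∷ p₂ ∷ p₁ ∷ p₀ ∷ []) (c₀ ∷ c₀ ∷ v4 (+ 1) (+ 0) (+ 1) (+ 0) ∷ v4 (+ 1) (+ 0) (+ 1) (+ 0) ∷ []) (Vp₃ ∷ V𝟙 ∷ Vp₁ ∷ V0 ∷ [])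
    (in-dual c₀ refl (on-odd ∷ on-odd ∷ on-even ∷ on-even ∷ []) ∷ in-dual c₀ refl (on-odd ∷ on-odd ∷ on-even ∷ on-even ∷ []) ∷ in-dual _ refl (on-odd ∷ on-odd ∷ on-even ∷ on-even ∷ []) ∷ in-dual _ refl (on-odd ∷ on-odd ∷ on-even ∷ on-even ∷ []) ∷ []) refl (toWitness {a? = _ ℤ.<? _} tt)
base-closed 4F x v t = V⇒Vtx v , t c₀ (refl , λ _ h → h)

-- Any point of `F` lies on every tile that contains `G`, and a closed `G` contains all such
-- vertices. This reads inclusions between dual faces backwards.
dual-reflects : ∀ {F G} → F ⊆ V → Closed G → Dual G ⊆ Dual F → F ⊆ G
dual-reflects s h i x fx = h x (s x fx) (λ w d → proj₂ (proj₂ (i w d) x fx))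

frame-closed : ∀ {v₀ v₁ v₂ v₃ F c} → Cells 3 (v4 v₃ v₂ v₁ v₀) F → F ⊆ TileU c →
  Closed (_∈ v4 v₃ v₂ v₁ v₀) × Closed (_∈ v₂ ∷ v₁ ∷ v₀ ∷ []) × Closed (_∈ v₁ ∷ v₀ ∷ [])
frame-closed {v₀} {v₁} {v₂} {v₃} C s = let g , r₀ , r₁ , r₂ , r₃ , rc = facet-frame C s in go g r₀ r₁ r₂ r₃
  where
  go : ∀ g → R g p₀ v₀ → R g p₁ v₁ → R g p₂ v₂ → R g p₃ v₃ →
    Closed (_∈ v4 v₃ v₂ v₁ v₀) × Closed (_∈ v₂ ∷ v₁ ∷ v₀ ∷ []) × Closed (_∈ v₁ ∷ v₀ ∷ [])
  go g r₀ r₁ r₂ r₃ =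
    Closed-cong (im-list g {us = v4 p₃ p₂ p₁ p₀} {v4 v₃ v₂ v₁ v₀} (r₃ ∷ r₂ ∷ r₁ ∷ r₀ ∷ [])) (tr-closed 3F) ,
    Closed-cong (im-list g {us = p₂ ∷ p₁ ∷ p₀ ∷ []} {v₂ ∷ v₁ ∷ v₀ ∷ []} (r₂ ∷ r₁ ∷ r₀ ∷ [])) (tr-closed 2F) ,
    Closed-cong (im-list g {us = p₁ ∷ p₀ ∷ []} {v₁ ∷ v₀ ∷ []} (r₁ ∷ r₀ ∷ [])) (tr-closed 1F)
    where
    tr-closed : ∀ k → Closed (im g (base k))
    tr-closed k = Closed-im g (FaceU-V k (base-face k)) (base-closed k)

facet-closed : ∀ {F c} → SubFace 3 F → F ⊆ TileU c → Closed F
facet-closed {F} {c} f s = go (first f)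
  where
  go : (Σ (Vec Pt 4) λ vs → Cells 3 vs F) → Closed F
  go (v4 v₃ v₂ v₁ v₀ , C) = Closed-cong (≐-sym (enum C)) (frame-closed C s .proj₁)

triangle-closed : ∀ {E F c} → SubFace 2 E → SubFace 3 F → E ⊆ F → F ⊆ TileU c → Closed E
triangle-closed {E} {F} {c} e f i s = go (first e)
  where
  go : (Σ (Vec Pt 3) λ vs → Cells 2 vs E) → Closed E
  go (v₂ ∷ v₁ ∷ v₀ ∷ [] , C) = let v₃ , C' = next C f i in
    Closed-cong (≐-sym (enum C)) (frame-closed C' s .proj₂ .proj₁)

edge-closed : ∀ {E' E F c} → SubFace 1 E' → SubFace 2 E → SubFace 3 F → E' ⊆ E → E ⊆ F → F ⊆ TileU c → Closed E'
edge-closed {E'} {E} {F} {c} e' e f i' i s = go (first e')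
  where
  go : (Σ (Vec Pt 2) λ vs → Cells 1 vs E') → Closed E'
  go (v₁ ∷ v₀ ∷ [] , C) = let v₂ , C' = next C e i' ; v₃ , C'' = next C' f i in
    Closed-cong (≐-sym (enum C)) (frame-closed C'' s .proj₂ .proj₂)

-- Reversing an inclusion needs the larger face to be closed, and closedness is transported from the
-- base flag by a frame, which needs the inclusions above that face. The circle is avoided by
-- descending from the tile: each inclusion gives closedness of the smaller face, which gives the
-- next inclusion.
icosi-transitive : (Ψ : Flag icosi) → Σ Gp λ g → ∀ k → im g (Dual (base (opposite k))) ≐ proj₁ Ψ k
icosi-transitive (Ψ , f , s) = go (cross-transitive Φ Φ-face Φ-incl)
  where
  F : Fin 5 → Pred
  F j = proj₁ (f j)
  F-face : ∀ j → FaceU (opposite j) (F j)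
  F-face j = proj₁ (proj₂ (f j))
  F-dual : ∀ j → Ψ j ≐ Dual (F j)
  F-dual j = proj₂ (proj₂ (f j))
  F-V : ∀ j → F j ⊆ V
  F-V j = FaceU-V (opposite j) (F-face j)
  incl : ∀ (j : Fin 4) → Dual (F (inject₁ j)) ⊆ Dual (F (suc j))
  incl j w d = proj₁ (F-dual (suc j)) w (s j w (proj₂ (F-dual (inject₁ j)) w d))
  c = proj₁ (F-face zero)
  F₁-tile : F 1F ⊆ TileU c
  F₁-tile = proj₂ (incl zero c (proj₁ (proj₂ (F-face zero)) , proj₁ (proj₂ (proj₂ (F-face zero)))))
  s₁ : F 1F ⊆ F zero
  s₁ x h = proj₂ (proj₂ (proj₂ (F-face zero))) x (F₁-tile x h)
  s₂ : F 2F ⊆ F 1F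
  s₂ = dual-reflects (F-V 2F) (facet-closed (F-face 1F) F₁-tile) (incl 1F)
  s₃ : F 3F ⊆ F 2F
  s₃ = dual-reflects (F-V 3F) (triangle-closed (F-face 2F) (F-face 1F) s₂ F₁-tile) (incl 2F)
  s₄ : F 4F ⊆ F 3F
  s₄ = dual-reflects (F-V 4F)
    (edge-closed (F-face 3F) (F-face 2F) (F-face 1F) s₃ s₂ F₁-tile) (incl 3F)
  Φ : Fin 5 → Pred
  Φ k = F (opposite k)
  Φ-face : ∀ k → FaceU k (Φ k)
  Φ-face zero = F-face 4F
  Φ-face 1F = F-face 3F
  Φ-face 2F = F-face 2F
  Φ-face 3F = F-face 1F
  Φ-face 4F = F-face zero
  Φ-incl : ∀ k → Φ (inject₁ k) ⊆ Φ (suc k)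
  Φ-incl zero = s₄
  Φ-incl 1F = s₃
  Φ-incl 2F = s₂
  Φ-incl 3F = s₁
  go : (Σ Gp λ g → ∀ k → im g (base k) ≐ Φ k) → Σ Gp λ g → ∀ k → im g (Dual (base (opposite k))) ≐ Ψ k
  go (g , h) = g , λ k → ≐-trans (im-Dual g (FaceU-V (opposite k) (base-face (opposite k)))) (≐-trans (Dual-cong (hk k)) (≐-sym (F-dual k)))
    where
    hk : ∀ k → im g (base (opposite k)) ≐ F k
    hk zero = h 4F
    hk 1F = h 3F
    hk 2F = h 2F
    hk 3F = h 1F
    hk 4F = h zero

-- The flags of either tessellation and the stabiliser of the base flag

baseT : Kind → Fin 5 → Pred
baseT cross k = base k
baseT icosi k = Dual (base (opposite k))

baseT-face : ∀ T k → Face T k (baseT T k)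
baseT-face cross k = lift (base-face k)
baseT-face icosi k = base (opposite k) , base-face (opposite k) , ≐-refl

baseT-incl : ∀ T k → baseT T (inject₁ k) ⊆ baseT T (suc k)
baseT-incl cross k = base-incl k
baseT-incl icosi zero = Dual-anti (base-incl 3F)
baseT-incl icosi 1F = Dual-anti (base-incl 2F)
baseT-incl icosi 2F = Dual-anti (base-incl 1F)
baseT-incl icosi 3F = Dual-anti (base-incl zero)

flagOf : ∀ T → Gp → Flag T
flagOf T g = (λ k → im g (baseT T k)) , (λ k → im-Face T g k (baseT-face T k)) , (λ k → im-mono g (baseT-incl T k))

transitive : ∀ T (Ψ : Flag T) → Σ Gp λ g → ∀ k → im g (baseT T k) ≐ proj₁ Ψ k
transitive cross (Φ , f , s) = cross-transitive Φ (λ k → lower (f k)) s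
transitive icosi Ψ = icosi-transitive Ψ

-- Each of the first four faces adds one vertex to those already known to be fixed, so `p₀`, `p₁`,
-- `p₂`, `p₃` are fixed in turn. Together with the antipode of `p₁` in the tile they yield all
-- doubled coordinate vectors.
cross-stabiliser : ∀ f → (∀ k → im f (base k) ≐ base k) → ∀ x → lin f ⊢ x ↦ x
cross-stabiliser f h x = 2v-cancel (trans (sym (·m-· (mat (lin f)) (+ 2) x))
  (trans (cong (mat (lin f) ·m_) (2e-expand x)) (trans (↦-lincomb (lin f) x {es} {es}
    (cong₂ _∷_ l₁ (cong₂ _∷_ l₂ (cong₂ _∷_ l₃ (cong₂ _∷_ l₄ refl))))) (cong ((+ 2) ·v_) (sym (2e-expand x))))))
  where
  es = map ((+ 2) ·v_) idRows
  2e-expand : ∀ x → (+ 2) ·v x ≡ lincomb x es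
  2e-expand x = trans (cong ((+ 2) ·v_) (e-expand x)) (sym (lincomb-· (+ 2) x idRows))
  -- The antipode of `p₁` in the base tile, twice `c₀` minus `p₁`.
  q : Pt
  q = v4 (+ 0) (+ 2) (+ 0) (+ 0)
  clash : ∀ {A : Set} x y → x ≢ y → R f x x → R f x y → A
  clash x y ne r r' = ⊥-elim (ne (R-unique f {x} {x} {y} r r'))
  r₀ : R f p₀ p₀
  r₀ with proj₂ (h zero) p₀ (here refl)
  ... | _ , here refl , r = r
  r₁ : R f p₁ p₁
  r₁ with proj₂ (h 1F) p₁ (here refl)
  ... | _ , here refl , r = r
  ... | _ , there (here refl) , r = clash p₀ p₁ (λ ()) r₀ r
  r₂ : R f p₂ p₂
  r₂ with proj₂ (h 2F) p₂ (here refl)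
  ... | _ , here refl , r = r
  ... | _ , there (here refl) , r = clash p₁ p₂ (λ ()) r₁ r
  ... | _ , there (there (here refl)) , r = clash p₀ p₂ (λ ()) r₀ r
  r₃ : R f p₃ p₃
  r₃ with proj₂ (h 3F) p₃ (here refl)
  ... | _ , here refl , r = r
  ... | _ , there (here refl) , r = clash p₂ p₃ (λ ()) r₂ r
  ... | _ , there (there (here refl)) , r = clash p₁ p₃ (λ ()) r₁ r
  ... | _ , there (there (there (here refl))) , r = clash p₀ p₃ (λ ()) r₀ r
  rq : R f q q
  rq = let y , (_ , d) , r = proj₂ (h 4F) q (inj₁ refl , refl)
           s = antipodal {y} {p₁} {c₀} d refl (sym (R-dist f {y} {q} {p₁} {p₁} r r₁))
       in subst (λ t → R f t q) (trans (sym (+-cancel y p₁)) (cong (_-v p₁) s)) r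
  fix : ∀ {y} → R f y y → lin f ⊢ y ↦ y
  fix {y} r = subst₂ (lin f ⊢_↦_) (sub-zero y) (trans (sub-cancel y p₀ (shift f)) (sub-zero y)) (↦-- (lin f) (R⇒↦ f r) (R⇒↦ f r₀))
  l₁ : lin f ⊢ p₁ ↦ p₁
  l₁ = fix r₁
  l₂ : lin f ⊢ q ↦ q
  l₂ = fix rq
  l₃ : lin f ⊢ ((+ 2) ·v e₃) ↦ ((+ 2) ·v e₃)
  l₃ = ↦-- (lin f) {p₂ +v p₃} {p₂ +v p₃} {p₁ +v q} {p₁ +v q} (↦-+ (lin f) {p₂} {p₂} {p₃} {p₃} (fix r₂) (fix r₃)) (↦-+ (lin f) {p₁} {p₁} {q} {q} l₁ l₂)
  l₄ : lin f ⊢ ((+ 2) ·v e₄) ↦ ((+ 2) ·v e₄)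
  l₄ = ↦-- (lin f) {p₂} {p₂} {p₃} {p₃} (fix r₂) (fix r₃)

stabiliser : ∀ T f → (∀ k → im f (baseT T k) ≐ baseT T k) → ∀ x → lin f ⊢ x ↦ x
stabiliser cross f h = cross-stabiliser f h
stabiliser icosi f h = cross-stabiliser f λ
  { zero → fixed zero (h 4F)
  ; 1F → fixed 1F (h 3F)
  ; 2F → fixed 2F (h 2F)
  ; 3F → fixed 3F (h 1F)
  ; 4F → fixed 4F (h zero) }
  where
  fixed : ∀ k → im f (Dual (base k)) ≐ Dual (base k) → im f (base k) ≐ base k
  fixed k e = dual-reflects (FaceU-V k (im-FaceU f k (base-face k))) (base-closed k) (proj₂ d) ,
              dual-reflects (FaceU-V k (base-face k)) (Closed-im f (FaceU-V k (base-face k)) (base-closed k)) (proj₁ d)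
    where
    d : Dual (im f (base k)) ≐ Dual (base k)
    d = ≐-trans (≐-sym (im-Dual f (FaceU-V k (base-face k)))) e

-- Flag orbits of T/L correspond to the lattices N⁻¹L, with N in the point group

pre : W → Pred → Pred
pre w K t = Σ Pt λ s → K s × w ⊢ t ↦ s

Cj : W → Pred → Pred → Set
Cj w K K' = (∀ t → K t → Σ Pt λ t' → K' t' × w ⊢ t ↦ t') × (∀ t' → K' t' → Σ Pt λ t → K t × w ⊢ t ↦ t')

-- Naming the lattices by representatives indexed by `Fin 3` lets every element of `W` act as a map
-- of this index set.
ThreeLattices : Pred → Set
ThreeLattices K = Σ (Fin 3 → W) λ a → (∀ i j → pre (a i) K ≐ pre (a j) K → i ≡ j) × (∀ g → Σ (Fin 3) λ i → pre g K ≐ pre (a i) K)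

pairwise : ∀ (A : Fin 3 → Pred) → ¬ (A zero ≐ A 1F) → ¬ (A zero ≐ A 2F) → ¬ (A 1F ≐ A 2F) → ∀ i j → A i ≐ A j → i ≡ j
pairwise A n₀₁ n₀₂ n₁₂ zero zero _ = refl
pairwise A n₀₁ n₀₂ n₁₂ zero 1F e = ⊥-elim (n₀₁ e)
pairwise A n₀₁ n₀₂ n₁₂ zero 2F e = ⊥-elim (n₀₂ e)
pairwise A n₀₁ n₀₂ n₁₂ 1F zero e = ⊥-elim (n₀₁ (≐-sym e))
pairwise A n₀₁ n₀₂ n₁₂ 1F 1F _ = refl
pairwise A n₀₁ n₀₂ n₁₂ 1F 2F e = ⊥-elim (n₁₂ e)
pairwise A n₀₁ n₀₂ n₁₂ 2F zero e = ⊥-elim (n₀₂ (≐-sym e))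
pairwise A n₀₁ n₀₂ n₁₂ 2F 1F e = ⊥-elim (n₁₂ (≐-sym e))
pairwise A n₀₁ n₀₂ n₁₂ 2F 2F _ = refl

pre⇒Cj : ∀ g a {K} → K ⊆ V → pre g K ≐ pre a K → Cj (g ∘w inv a) K K
pre⇒Cj g a {K} s (to , from) =
  (λ t k → let x , _ , p = onV a t (s t k) ; t' , k' , q = from x (t , k , p) in t' , k' , ↦-∘ g (inv a) (↦-tr a p) q) ,
  (λ t' k' → let x , _ , p = onV g t' (s t' k') ; t , k , q = to x (t' , k' , p) in t , k , ↦-∘ g (inv a) (↦-tr a q) p)

-- If `g` is the composite of `k` and `a` on `V`, and `k` preserves `K`, then `g` maps a vector into
-- `K` exactly when `a` does. Comparison on `V` is enough because `V` contains the preimages of `K`.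
Cj⇒pre : ∀ g a k {K} → K ⊆ V → (∀ {x y z} → V x → a ⊢ x ↦ y → k ⊢ y ↦ z → g ⊢ x ↦ z) → Cj k K K → pre g K ≐ pre a K
Cj⇒pre g a k {K} s c (to , from) = τ , φ
  where
  τ : pre g K ⊆ pre a K
  τ t (z , kz , p) =
    let tv = ↦V⁻ g p (s z kz) ; y , yv , q = presV a t tv ; z' , zv' , r = presV k y yv
        y' , ky' , r' = from z kz
        z≡ = ↦-unique g (c tv q r) p
        y≡ = 2v-cancel (trans (sym (↦-tr k r')) (↦-tr k (subst (k ⊢ y ↦_) z≡ r)))
    in y , subst K y≡ ky' , q
  φ : pre a K ⊆ pre g K
  φ t (y , ky , q) = let z , kz , r = to y ky in z , kz , c (↦V⁻ a q (s y ky)) q r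

module _ (T : Kind) (B : Vec Pt 4) (sub : InLat B ⊆ V) where

  sameOrbit⇒pre : ∀ {Φ Ψ} a g → (∀ k → im a (baseT T k) ≐ proj₁ Φ k) → (∀ k → im g (baseT T k) ≐ proj₁ Ψ k) →
    SameOrbit T B Φ Ψ → pre (lin g) (InLat B) ≐ pre (lin a) (InLat B)
  sameOrbit⇒pre {Φ} {Ψ} a g ha hg (h , sy , cj , im-h) = go (Sym⇒Gp T sy) cj im-h
    where
    go : (Σ Gp λ k → toAff k ≡ h) → ConjBy h B B → (∀ k → img h (proj₁ Φ k) ≐ proj₁ Ψ k) → pre (lin g) (InLat B) ≐ pre (lin a) (InLat B)
    go (k , refl) cj im-k = Cj⇒pre (lin g) (lin a) (lin k) sub comp cj
      where
      baseD : ∀ i → baseT T i ⊆ D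
      baseD i = Face-D T i (baseT-face T i)
      -- `a` and `g` carry the base flag to the two given flags, so `f` fixes the base flag and its
      -- linear part is the identity; hence `k` after `a` and `g` have the same linear part.
      f = invg g ∘g (k ∘g a)
      fixes : ∀ i → im f (baseT T i) ≐ baseT T i
      fixes i = ≐-trans (im-∘ (invg g) (k ∘g a) (baseD i)) (≐-trans (im-cong (invg g) (≐-trans (im-∘ k a (baseD i)) (≐-trans (im-cong k (ha i)) (im-k i))))
        (im-inv g (baseD i) (hg i)))
      comp : ∀ {x y z} → V x → lin a ⊢ x ↦ y → lin k ⊢ y ↦ z → lin g ⊢ x ↦ z
      comp {x} {y} {z} v p q = tr-↦ (lin g) (∘-↦ (inv (lin g)) (lin k ∘w lin a) (stabiliser T f fixes x) (↦-∘ (lin k) (lin a) p q))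

  pre⇒sameOrbit : ∀ {Φ Ψ} a g → (∀ k → im a (baseT T k) ≐ proj₁ Φ k) → (∀ k → im g (baseT T k) ≐ proj₁ Ψ k) →
    pre (lin g) (InLat B) ≐ pre (lin a) (InLat B) → SameOrbit T B Φ Ψ
  pre⇒sameOrbit {Φ} {Ψ} a g ha hg e = toAff (g ∘g invg a) , Gp⇒Sym T (g ∘g invg a) , pre⇒Cj (lin g) (lin a) sub e ,
    λ k → ≐-trans (im-∘ g (invg a) (Face-D T k (proj₁ (proj₂ Φ) k)))
      (≐-trans (im-cong g (im-inv a (Face-D T k (baseT-face T k)) (ha k))) (hg k))

  three⇒lattices : ThreeFlagOrbits T B → ThreeLattices (InLat B)
  three⇒lattices (Φ₁ , Φ₂ , Φ₃ , n₁₂ , n₁₃ , n₂₃ , cov) = (λ i → lin (a i)) , apart , cover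
    where
    Φ : Fin 3 → Flag T
    Φ zero = Φ₁
    Φ 1F = Φ₂
    Φ 2F = Φ₃
    a : Fin 3 → Gp
    a i = proj₁ (transitive T (Φ i))
    ha : ∀ i k → im (a i) (baseT T k) ≐ proj₁ (Φ i) k
    ha i = proj₂ (transitive T (Φ i))
    so : ∀ i j → pre (lin (a i)) (InLat B) ≐ pre (lin (a j)) (InLat B) → SameOrbit T B (Φ j) (Φ i)
    so i j = pre⇒sameOrbit {Φ j} {Φ i} (a j) (a i) (ha j) (ha i)
    apart : ∀ i j → pre (lin (a i)) (InLat B) ≐ pre (lin (a j)) (InLat B) → i ≡ j
    apart = pairwise (λ i → pre (lin (a i)) (InLat B)) (λ e → n₁₂ (so 1F zero (≐-sym e)))
      (λ e → n₁₃ (so 2F zero (≐-sym e))) (λ e → n₂₃ (so 2F 1F (≐-sym e)))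
    cover : ∀ w → Σ (Fin 3) λ i → pre w (InLat B) ≐ pre (lin (a i)) (InLat B)
    cover w = pick (cov (flagOf T g))
      where
      g = gp w zeroV V0
      to : ∀ i → SameOrbit T B (Φ i) (flagOf T g) → pre w (InLat B) ≐ pre (lin (a i)) (InLat B)
      to i = sameOrbit⇒pre {Φ i} {flagOf T g} (a i) g (ha i) (λ k → ≐-refl)
      pick : SameOrbit T B Φ₁ (flagOf T g) ⊎ SameOrbit T B Φ₂ (flagOf T g) ⊎ SameOrbit T B Φ₃ (flagOf T g) →
        Σ (Fin 3) λ i → pre w (InLat B) ≐ pre (lin (a i)) (InLat B)
      pick (inj₁ h) = zero , to zero h
      pick (inj₂ (inj₁ h)) = 1F , to 1F h
      pick (inj₂ (inj₂ h)) = 2F , to 2F h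

  lattices⇒three : ThreeLattices (InLat B) → ThreeFlagOrbits T B
  lattices⇒three (a , apart , cover) = Φ zero , Φ 1F , Φ 2F ,
    ne (λ ()) , ne (λ ()) , ne (λ ()) , cov
    where
    g : Fin 3 → Gp
    g i = gp (a i) zeroV V0
    Φ : Fin 3 → Flag T
    Φ i = flagOf T (g i)
    ne : ∀ {i j} → j ≢ i → ¬ SameOrbit T B (Φ i) (Φ j)
    ne {i} {j} n h = n (apart j i (sameOrbit⇒pre {Φ i} {Φ j} (g i) (g j) (λ k → ≐-refl) (λ k → ≐-refl) h))
    cov : (Ψ : Flag T) → SameOrbit T B (Φ zero) Ψ ⊎ SameOrbit T B (Φ 1F) Ψ ⊎ SameOrbit T B (Φ 2F) Ψ
    cov Ψ = pick (cover (lin h))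
      where
      h = proj₁ (transitive T Ψ)
      to : ∀ i → pre (lin h) (InLat B) ≐ pre (a i) (InLat B) → SameOrbit T B (Φ i) Ψ
      to i = pre⇒sameOrbit {Φ i} {Ψ} (g i) h (λ k → ≐-refl) (proj₂ (transitive T Ψ))
      pick : (Σ (Fin 3) λ i → pre (lin h) (InLat B) ≐ pre (a i) (InLat B)) → SameOrbit T B (Φ zero) Ψ ⊎ SameOrbit T B (Φ 1F) Ψ ⊎ SameOrbit T B (Φ 2F) Ψ
      pick (zero , e) = inj₁ (to zero e)
      pick (1F , e) = inj₂ (inj₁ (to 1F e))
      pick (2F , e) = inj₂ (inj₂ (to 2F e))

-- A translational symmetry arises from `Gp`, where the shift lies in `V`.
latticeGroup-V : ∀ T B → LatticeGroup T B → InLat B ⊆ V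
latticeGroup-V T B (sy , _) x (k , refl) = lincomb-V k B (λ i → go (Sym⇒Gp T (sy i)))
  where
  go : ∀ {t} → (Σ Gp λ g → toAff g ≡ transl t) → V t
  go {t} (g , e) = subst V (2v-cancel (cong Aff.b e)) (shiftV g)

Cj-inv : ∀ w {K K'} → Cj w K K' → Cj (inv w) K' K
Cj-inv w (p , q) = (λ t' k' → let t , k , r = q t' k' in t , k , ↦-tr w r) , (λ t k → let t' , k' , r = p t k in t' , k' , ↦-tr w r)

pre-mono : ∀ w {K K'} → K ⊆ K' → pre w K ⊆ pre w K'
pre-mono w s t (x , k , p) = x , s x k , p

pre-cong : ∀ w {K K'} → K ≐ K' → pre w K ≐ pre w K'
pre-cong w (p , q) = pre-mono w p , pre-mono w q

pre-∘ : ∀ w' w {K} → K ⊆ V → pre (w' ∘w w) K ≐ pre w (pre w' K)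
pre-∘ w' w {K} s = to , λ { t (y , (z , k , q) , p) → z , k , ↦-∘ w' w p q }
  where
  to : pre (w' ∘w w) K ⊆ pre w (pre w' K)
  to t (z , k , p) = let y , _ , q = presV w t (↦V⁻ (w' ∘w w) p (s z k)) in y , (z , k , ∘-↦ w' w p q) , q

Cj⇒≐ : ∀ w {K K'} → Cj w K K' → pre w K' ≐ K
Cj⇒≐ w {K} (p , q) =
  (λ { t (t' , k' , r) → let s , k , r' = q t' k' in subst K (2v-cancel (trans (sym (↦-tr w r')) (↦-tr w r))) k }) ,
  (λ t k → p t k)

pre-V : ∀ w {K} → K ⊆ V → pre w K ⊆ V
pre-V w s t (x , k , p) = ↦V⁻ w p (s x k)

threeLattices-conj : ∀ h {K K'} → K ⊆ V → K' ⊆ V → Cj h K K' → ThreeLattices K' → ThreeLattices K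
threeLattices-conj h {K} {K'} s s' c (a , apart , cover) = a' , apart' , cover'
  where
  a' : Fin 3 → W
  a' i = (inv h ∘w a i)
  e : pre (inv h) K ≐ K'
  e = Cj⇒≐ (inv h) (Cj-inv h c)
  to : ∀ w → pre (inv h ∘w w) K ≐ pre w K'
  to w = ≐-trans (pre-∘ (inv h) w s) (pre-cong w e)
  apart' : ∀ i j → pre (a' i) K ≐ pre (a' j) K → i ≡ j
  apart' i j q = apart i j (≐-trans (≐-sym (to (a i))) (≐-trans q (to (a j))))
  cover' : ∀ g → Σ (Fin 3) λ i → pre g K ≐ pre (a' i) K
  cover' g = let i , q = cover (h ∘w g) in i ,
    ≐-trans (≐-trans (pre-cong g (≐-sym (Cj⇒≐ h c))) (≐-sym (pre-∘ h g s'))) (≐-trans q (≐-sym (to (a i))))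

-- Lattices invariant under the signed permutations

bezout : ∀ (a : ℤ) n → Σ ℕ λ d → (Σ ℤ λ q → a ≡ + d * q) × (Σ ℤ λ q → + n ≡ + d * q) × Σ ℤ λ x → Σ ℤ λ y → x * a + y * + n ≡ + d
bezout a n = d , div-a a (gcd[m,n]∣m ∣ a ∣ n) , div-n (gcd[m,n]∣n ∣ a ∣ n) , combine a (Bézout.identity (gcd-GCD ∣ a ∣ n))
  where
  d = gcd ∣ a ∣ n
  open Bézout using (+-; -+)
  div-n : ∀ {d n} → d Data.Nat.Divisibility.∣ n → Σ ℤ λ q → + n ≡ + d * q
  div-n {d} (divides q refl) = + q , trans (ℤP.pos-* q d) (ℤP.*-comm (+ q) (+ d))
  div-a : ∀ {d} a → d Data.Nat.Divisibility.∣ ∣ a ∣ → Σ ℤ λ q → a ≡ + d * q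
  div-a (+ m) h = div-n h
  div-a {d} -[1+ m ] h = let q , e = div-n h in - q , trans (cong -_ e) (l (+ d) q)
    where l : ∀ d q → - (d * q) ≡ d * - q
          l = solve-∀
  nat : ∀ {d m n} → Bézout.Identity d m n → Σ ℤ λ x → Σ ℤ λ y → x * + m + y * + n ≡ + d
  nat {d} {m} {n} (+- x y e) = + x , - + y , trans (cong (_+ (- + y) * + n) (trans (sym (ℤP.pos-* x m)) (trans (cong +_ (sym e)) (cong (λ t → + d + t) (ℤP.pos-* y n))))) (l (+ d) (+ y) (+ n))
    where l : ∀ d y n → d + y * n + (- y) * n ≡ d
          l = solve-∀
  nat {d} {m} {n} (-+ x y e) = - + x , + y , trans (cong (λ t → (- + x) * + m + t) (trans (sym (ℤP.pos-* y n)) (trans (cong +_ (sym e)) (cong (λ t → + d + t) (ℤP.pos-* x m))))) (l (+ d) (+ x) (+ m))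
    where l : ∀ d x m → (- x) * m + (d + x * m) ≡ d
          l = solve-∀
  combine : ∀ {d} a → Bézout.Identity d ∣ a ∣ n → Σ ℤ λ x → Σ ℤ λ y → x * a + y * + n ≡ + d
  combine (+ m) i = nat i
  combine -[1+ m ] i = let x , y , e = nat i in - x , y , trans (l x (+ suc m) (y * + n)) e
    where l : ∀ x a t → (- x) * (- a) + t ≡ x * a + t
          l = solve-∀

gcd-vec : ∀ {n} (c : Vec ℤ n) → Σ ℕ λ d → All (λ x → Σ ℤ λ q → x ≡ + d * q) c × Σ (Vec ℤ n) λ k → dot k c ≡ + d
gcd-vec [] = 0 , [] , [] , refl
gcd-vec (a ∷ c) = let d , al , k , e = gcd-vec c
                      d' , qa , (qd , ed) , x , y , f = bezout a d
  in d' , qa ∷ widen d d' qd ed al , x ∷ (y ·v k) , trans (cong (λ t → x * a + t) (trans (dot-·ˡ y k c) (cong (y *_) e))) f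
  where
  widen : ∀ d d' q → + d ≡ + d' * q → ∀ {n} {c : Vec ℤ n} → All (λ x → Σ ℤ λ q → x ≡ + d * q) c → All (λ x → Σ ℤ λ q → x ≡ + d' * q) c
  widen d d' q e [] = []
  widen d d' q e ((p , h) ∷ al) = (q * p , trans h (trans (cong (_* p) e) (ℤP.*-assoc (+ d') q p))) ∷ widen d d' q e al

δ₁₂ δ₂₃ δ₃₄ : Pt
δ₁₂ = v4 (+ 1) (- + 1) (+ 0) (+ 0)
δ₂₃ = v4 (+ 0) (+ 1) (- + 1) (+ 0)
δ₃₄ = v4 (+ 0) (+ 0) (+ 1) (- + 1)

-- The adjacent transpositions and one sign change generate all signed permutations of the
-- coordinates.
record SignedPerm (K : Pred) : Set where
  field
    swap₁₂ : ∀ {a b c d} → K (v4 a b c d) → K (v4 b a c d)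
    swap₂₃ : ∀ {a b c d} → K (v4 a b c d) → K (v4 a c b d)
    swap₃₄ : ∀ {a b c d} → K (v4 a b c d) → K (v4 a b d c)
    neg₄   : ∀ {a b c d} → K (v4 a b c d) → K (v4 a b c (- d))
open SignedPerm

record Subgroup (K : Pred) : Set where
  field
    add : ∀ {x y} → K x → K y → K (x +v y)
    scale : ∀ k {x} → K x → K (k ·v x)
open Subgroup

_·P_ : ℕ → Pred → Pred
(d ·P P) x = Σ Pt λ y → P y × x ≡ (+ d) ·v y

AllPts : Pred
AllPts _ = ⊤

MultipleOf : Pred → ℕ → Set
MultipleOf K d = K ≐ (d ·P AllPts) ⊎ K ≐ (d ·P D) ⊎ K ≐ (d ·P V)

-- `P` is to be the lattice divided by its content. Moving the coordinate 1 of `unit` to the last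
-- place and subtracting the sign-changed vector leaves `2e₄`, so `P` contains all even vectors and
-- is determined by a binary code. The nonzero permutation-invariant codes correspond to `V`, `D`
-- and all of Z⁴.
module Codes (P : Pred) (gr : Subgroup P) (inv : SignedPerm P) {z₂ z₃ z₄ : ℤ} (unit : P (v4 (+ 1) z₂ z₃ z₄)) where

  sub : ∀ {x y} → P x → P y → P (x -v y)
  sub {x} {y} p q = subst P (-v-as-+ x y) (add gr p (scale gr (- + 1) q))

  2e₄ : P (v4 (+ 0) (+ 0) (+ 0) (+ 2))
  2e₄ = subst P (v4≡ (ℤP.+-inverseʳ z₂) (ℤP.+-inverseʳ z₃) (ℤP.+-inverseʳ z₄) refl) (sub w (neg₄ inv w))
    where w : P (v4 z₂ z₃ z₄ (+ 1))
          w = swap₃₄ inv (swap₂₃ inv (swap₁₂ inv unit))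
  2e₃ : P (v4 (+ 0) (+ 0) (+ 2) (+ 0))
  2e₃ = swap₃₄ inv 2e₄
  2e₂ : P (v4 (+ 0) (+ 2) (+ 0) (+ 0))
  2e₂ = swap₂₃ inv 2e₃
  2e₁ : P (v4 (+ 2) (+ 0) (+ 0) (+ 0))
  2e₁ = swap₁₂ inv 2e₂

  doubles : ∀ a b c d → P ((+ 2) ·v v4 a b c d)
  doubles a b c d = subst P (v4≡ (l₁ a b c d) (l₂ a b c d) (l₃ a b c d) (l₄ a b c d))
    (add gr (scale gr a 2e₁) (add gr (scale gr b 2e₂) (add gr (scale gr c 2e₃) (scale gr d 2e₄))))
    where
    l₁ : ∀ a b c d → a * + 2 + (b * + 0 + (c * + 0 + d * + 0)) ≡ + 2 * a
    l₁ = solve-∀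
    l₂ : ∀ a b c d → a * + 0 + (b * + 2 + (c * + 0 + d * + 0)) ≡ + 2 * b
    l₂ = solve-∀
    l₃ : ∀ a b c d → a * + 0 + (b * + 0 + (c * + 2 + d * + 0)) ≡ + 2 * c
    l₃ = solve-∀
    l₄ : ∀ a b c d → a * + 0 + (b * + 0 + (c * + 0 + d * + 2)) ≡ + 2 * d
    l₄ = solve-∀

  shift2 : ∀ {a b c d a' b' c' d'} → P (v4 a b c d) → Even (a' - a) → Even (b' - b) → Even (c' - c) → Even (d' - d) → P (v4 a' b' c' d')
  shift2 {a} {b} {c} {d} p (i , e₁) (j , e₂) (k , e₃) (l , e₄) =
    subst P (v4≡ (f a e₁) (f b e₂) (f c e₃) (f d e₄)) (add gr p (doubles i j k l))
    where
    f : ∀ {a' k} a → a' - a ≡ + 2 * k → a + + 2 * k ≡ a'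
    f {a'} a e = trans (cong (λ t → a + t) (sym e)) (g a a')
      where g : ∀ a a' → a + (a' - a) ≡ a'
            g = solve-∀

  full-V : V (v4 (+ 1) z₂ z₃ z₄) → V ⊆ P
  full-V (p , q , r) (v4 a b c d) (p' , q' , r') = shift2 {a * + 1} {a * + 1} {a * + 1} {a * + 1} (scale gr a ones)
    (+ 0 , l₀ a) (subst Even (l₁ a b) (even-neg p')) (subst Even (l₁ a c) (even-neg q')) (subst Even (l₁ a d) (even-neg r'))
    where
    ones : P (v4 (+ 1) (+ 1) (+ 1) (+ 1))
    ones = shift2 unit (+ 0 , refl) p q r
    l₀ : ∀ a → a - a * + 1 ≡ + 0
    l₀ = solve-∀
    l₁ : ∀ a b → - (a - b) ≡ b - a * + 1
    l₁ = solve-∀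

  gens⇒D : P δ₁₂ → P δ₂₃ → P δ₃₄ → D ⊆ P
  gens⇒D p q r (v4 a b c d) (k , e) = subst P (v4≡ (l₁ a b c k) (l₂ a b c k) (l₃ a b c k)
      (trans (l₄ a b c k) (trans (cong (λ t → t - (a + (b + c))) (sym e)) (l₅ a b c d))))
    (add gr (scale gr a p) (add gr (scale gr (a + b) q) (add gr (scale gr (a + (b + c)) r) (scale gr k 2e₄))))
    where
    l₁ : ∀ a b c k → a * + 1 + ((a + b) * + 0 + ((a + (b + c)) * + 0 + k * + 0)) ≡ a
    l₁ = solve-∀
    l₂ : ∀ a b c k → a * (- + 1) + ((a + b) * + 1 + ((a + (b + c)) * + 0 + k * + 0)) ≡ b
    l₂ = solve-∀
    l₃ : ∀ a b c k → a * + 0 + ((a + b) * (- + 1) + ((a + (b + c)) * + 1 + k * + 0)) ≡ c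
    l₃ = solve-∀
    l₄ : ∀ a b c k → a * + 0 + ((a + b) * + 0 + ((a + (b + c)) * (- + 1) + k * + 2)) ≡ + 2 * k - (a + (b + c))
    l₄ = solve-∀
    l₅ : ∀ a b c d → a + (b + (c + d)) - (a + (b + c)) ≡ d
    l₅ = solve-∀

  12→23 : P δ₁₂ → P δ₂₃
  12→23 p = sub (swap₂₃ inv p) p
  23→12 : P δ₂₃ → P δ₁₂
  23→12 p = sub (swap₁₂ inv p) p
  23→34 : P δ₂₃ → P δ₃₄
  23→34 p = sub (swap₃₄ inv p) p
  34→23 : P δ₃₄ → P δ₂₃
  34→23 p = sub (swap₂₃ inv p) p

  δ⇒D : P δ₂₃ → D ⊆ P
  δ⇒D p = gens⇒D (23→12 p) p (23→34 p)

  odd-diff : ∀ x y → Odd (x - y) → Even (+ 1 - (x - y)) × Even ((- + 1) - (y - x))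
  odd-diff x y (k , e) = (- k , trans (cong (λ t → + 1 - t) e) (l₁ k)) , (k , trans (l₂ x y) (trans (cong (_- + 1) e) (l₃ k)))
    where
    l₁ : ∀ k → + 1 - (+ 1 + + 2 * k) ≡ + 2 * (- k)
    l₁ = solve-∀
    l₂ : ∀ x y → (- + 1) - (y - x) ≡ (x - y) - + 1
    l₂ = solve-∀
    l₃ : ∀ k → + 1 + + 2 * k - + 1 ≡ + 2 * k
    l₃ = solve-∀

  ev0 : ∀ a → Even (+ 0 - (a - a))
  ev0 a = + 0 , l a
    where l : ∀ a → + 0 - (a - a) ≡ + 0
          l = solve-∀

  -- Two adjacent coordinates have different parity. Subtracting the vector with these two exchanged
  -- leaves an odd multiple of the corresponding difference of unit vectors, and even vectors are
  -- available to reduce it.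
  ¬V⇒D : ∀ {x} → P x → ¬ V x → D ⊆ P
  ¬V⇒D {v4 a b c d} p nv with parity (a - b) | parity (b - c) | parity (c - d)
  ... | inj₂ o | _ | _ = δ⇒D (12→23 (shift2 (sub p (swap₁₂ inv p)) (odd-diff a b o .proj₁) (odd-diff a b o .proj₂) (ev0 c) (ev0 d)))
  ... | inj₁ _ | inj₂ o | _ = δ⇒D (shift2 (sub p (swap₂₃ inv p)) (ev0 a) (odd-diff b c o .proj₁) (odd-diff b c o .proj₂) (ev0 d))
  ... | inj₁ _ | inj₁ _ | inj₂ o = δ⇒D (34→23 (shift2 (sub p (swap₃₄ inv p)) (ev0 a) (ev0 b) (odd-diff c d o .proj₁) (odd-diff c d o .proj₂)))
  ... | inj₁ e | inj₁ f | inj₁ g = ⊥-elim (nv (e , ac , subst Even (l a c d) (even-+ ac g)))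
    where
    l : ∀ a b c → a - b + (b - c) ≡ a - c
    l = solve-∀
    ac = subst Even (l a b c) (even-+ e f)

  ¬D-diff : ∀ {x y} → ¬ D x → ¬ D y → D (x -v y)
  ¬D-diff {v4 a b c d} {v4 a' b' c' d'} nx ny with parity (a + (b + (c + d))) | parity (a' + (b' + (c' + d')))
  ... | inj₁ e | _ = ⊥-elim (nx e)
  ... | inj₂ _ | inj₁ e = ⊥-elim (ny e)
  ... | inj₂ o | inj₂ o' = subst Even (l a b c d a' b' c' d') (odd-odd o o')
    where l : ∀ a b c d e f g h → a + (b + (c + d)) - (e + (f + (g + h))) ≡ a - e + (b - f + (c - g + (d - h)))
          l = solve-∀

  -- `D` has index 2 in Z⁴, so one vector outside it fills the other coset.
  ¬D⇒all : ∀ {x} → D ⊆ P → P x → ¬ D x → ∀ y → P y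
  ¬D⇒all {x} s p n y with D? y
  ... | yes d = s y d
  ... | no nd = subst P (-+-cancel y x) (add gr (s (y -v x) (¬D-diff {y} {x} nd n)) p)

·v-cancel : ∀ {n} d .{{_ : ℕ.NonZero d}} {x y : Vec ℤ n} → (+ d) ·v x ≡ (+ d) ·v y → x ≡ y
·v-cancel d {[]} {[]} _ = refl
·v-cancel d@(suc _) {a ∷ x} {c ∷ y} e = cong₂ _∷_ (ℤP.*-cancelˡ-≡ (+ d) a c (cong head e)) (·v-cancel d (cong tail e))

module _ (B : Vec Pt 4) where

  lattice-subgroup : Subgroup (InLat B)
  lattice-subgroup = record
    { add = λ { (k , refl) (l , refl) → k +v l , sym (lincomb-+ˡ k l B) }
    ; scale = λ { c (k , refl) → c ·v k , sym (lincomb-·ˡ c k B) } }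

  basis-in : ∀ i → InLat B (lookup B i)
  basis-in = go B
    where
    unit : ∀ {n} → Fin n → Vec ℤ n
    unit zero = + 1 ∷ replicate _ (+ 0)
    unit (suc i) = + 0 ∷ unit i
    one : ∀ (x : Pt) → ((+ 1) ·v x) +v zeroV ≡ x
    one (v4 a b c d) = v4≡ (l a) (l b) (l c) (l d)
      where l : ∀ a → + 1 * a + + 0 ≡ a
            l = solve-∀
    nil : ∀ (x y : Pt) → ((+ 0) ·v x) +v y ≡ y
    nil (v4 _ _ _ _) (v4 a b c d) = v4≡ (ℤP.+-identityˡ a) (ℤP.+-identityˡ b) (ℤP.+-identityˡ c) (ℤP.+-identityˡ d)
    go : ∀ {n} (B : Vec Pt n) i → Σ (Vec ℤ n) λ k → lookup B i ≡ lincomb k B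
    go (b ∷ B) zero = unit zero , sym (trans (cong (((+ 1) ·v b) +v_) (lincomb-zeroˡ B)) (one b))
    go (b ∷ B) (suc i) = let k , e = go B i in + 0 ∷ k , trans e (sym (nil b (lincomb k B)))

  head-lincomb : ∀ {n} (k : Vec ℤ n) (B : Vec Pt n) → head (lincomb k B) ≡ dot k (map head B)
  head-lincomb [] [] = refl
  head-lincomb (k ∷ ks) (v4 a b c d ∷ B) = go (lincomb ks B) (head-lincomb ks B)
    where
    go : ∀ (y : Pt) {e} → head y ≡ e → head ((k ·v v4 a b c d) +v y) ≡ k * a + e
    go (v4 _ _ _ _) refl = refl

  divisible-dot : ∀ {n} d (k c : Vec ℤ n) → All (λ x → Σ ℤ λ q → x ≡ + d * q) c → Σ ℤ λ q → dot k c ≡ + d * q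
  divisible-dot d [] [] [] = + 0 , sym (ℤP.*-zeroʳ (+ d))
  divisible-dot d (k ∷ ks) (c ∷ cs) ((q , refl) ∷ al) = let r , e = divisible-dot d ks cs al in
    k * q + r , trans (cong (λ t → k * (+ d * q) + t) e) (l (+ d) k q r)
    where l : ∀ d k q r → k * (d * q) + d * r ≡ d * (k * q + r)
          l = solve-∀

  module _ (sp : SignedPerm (InLat B)) where

    -- The first coordinates of the basis are enough: invariance under permutations moves every
    -- coordinate of a lattice vector to the first place. Bézout coefficients give a lattice vector
    -- whose first coordinate is this gcd.
    content : ℕ
    content = proj₁ (gcd-vec (map head B))

    divide : ∀ x → InLat B x → Σ Pt λ y → x ≡ (+ content) ·v y
    divide (v4 a b c d) h =
      let q₁ , e₁ = first-div h
          q₂ , e₂ = first-div (swap₁₂ sp h)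
          q₃ , e₃ = first-div (swap₁₂ sp (swap₂₃ sp h))
          q₄ , e₄ = first-div (swap₁₂ sp (swap₂₃ sp (swap₃₄ sp h)))
      in v4 q₁ q₂ q₃ q₄ , v4≡ e₁ e₂ e₃ e₄
      where
      first-div : ∀ {a b c d} → InLat B (v4 a b c d) → Σ ℤ λ q → a ≡ + content * q
      first-div (k , e) = let q , f = divisible-dot content k (map head B) (proj₁ (proj₂ (gcd-vec (map head B)))) in
        q , trans (cong head e) (trans (head-lincomb k B) f)

    quotient : Vec Pt 4
    quotient = tabulate (λ i → proj₁ (divide (lookup B i) (basis-in i)))

    B≡ : B ≡ map ((+ content) ·v_) quotient
    B≡ = go B (λ i → divide (lookup B i) (basis-in i))
      where
      go : ∀ {n} (C : Vec Pt n) (f : ∀ i → Σ Pt λ y → lookup C i ≡ (+ content) ·v y) → C ≡ map ((+ content) ·v_) (tabulate (λ i → proj₁ (f i)))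
      go [] f = refl
      go (c ∷ C) f = cong₂ _∷_ (proj₂ (f zero)) (go C (λ i → f (suc i)))

    classify-lattice : (Σ Pt λ x → InLat B x × x ≢ zeroV) → Σ ℕ λ d → ℕ.NonZero d ×
      MultipleOf (InLat B) d
    classify-lattice (x₀ , k₀ , ne) = go content refl
      where
      go : ∀ d → content ≡ d → Σ ℕ λ d → ℕ.NonZero d × MultipleOf (InLat B) d
      go zero e = ⊥-elim (ne (trans (proj₂ (divide x₀ k₀)) (trans (cong (λ t → (+ t) ·v proj₁ (divide x₀ k₀)) e) (nil (proj₁ (divide x₀ k₀))))))
        where nil : ∀ (x : Pt) → (+ 0) ·v x ≡ zeroV
              nil (v4 _ _ _ _) = refl
      go d@(suc _) e = d , _ , decide
        where
        P : Pred
        P y = InLat B ((+ d) ·v y)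
        gr : Subgroup P
        gr = record { add = λ {x} {y} p q → subst (InLat B) (sym (·v-+ (+ d) x y)) (add lattice-subgroup p q)
                    ; scale = λ k {x} p → subst (InLat B) (·v-comm k (+ d) x) (scale lattice-subgroup k p) }
        spP : SignedPerm P
        spP = record { swap₁₂ = swap₁₂ sp ; swap₂₃ = swap₂₃ sp ; swap₃₄ = swap₃₄ sp
                     ; neg₄ = λ {a} {b} {c} {x} p → subst (λ t → InLat B (v4 (+ d * a) (+ d * b) (+ d * c) t)) (l (+ d) x) (neg₄ sp p) }
          where l : ∀ d x → - (d * x) ≡ d * (- x)
                l = solve-∀
        coeffs : Pt
        coeffs = proj₁ (proj₂ (proj₂ (gcd-vec (map head B))))
        z : Pt
        z = lincomb coeffs B
        z-head : head z ≡ + d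
        z-head = trans (head-lincomb coeffs B) (trans (proj₂ (proj₂ (proj₂ (gcd-vec (map head B))))) (cong +_ e))
        div : ∀ x → InLat B x → Σ Pt λ y → x ≡ (+ d) ·v y
        div x h = let y , f = divide x h in y , trans f (cong (λ t → (+ t) ·v y) e)
        decide : MultipleOf (InLat B) d
        decide = unit (div z (coeffs , refl))
          where
          dec-all : ∀ (Q : Pred) → (∀ x → Dec (Q x)) → ∀ {n} (C : Vec Pt n) → (∀ i → Q (lookup C i)) ⊎ Σ (Fin n) λ i → ¬ Q (lookup C i)
          dec-all Q Q? [] = inj₁ (λ ())
          dec-all Q Q? (c ∷ C) with Q? c | dec-all Q Q? C
          ... | no n | _ = inj₂ (zero , n)
          ... | yes q | inj₂ (i , n) = inj₂ (suc i , n)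
          ... | yes q | inj₁ h = inj₁ λ { zero → q ; (suc i) → h i }
          into : ∀ {Q : Pred} → (∀ k → Q (lincomb k quotient)) → InLat B ⊆ (d ·P Q)
          into h x (k , refl) = lincomb k quotient , h k ,
            trans (cong (lincomb k) B≡) (trans (lincomb-· (+ content) k quotient) (cong (λ t → (+ t) ·v lincomb k quotient) e))
          outof : ∀ {Q : Pred} → Q ⊆ P → (d ·P Q) ⊆ InLat B
          outof s x (y , q , refl) = s y q
          quotient-P : ∀ i → P (lookup quotient i)
          quotient-P i = subst (InLat B) (trans (proj₂ (divide (lookup B i) (basis-in i)))
            (trans (cong (λ t → (+ t) ·v proj₁ (divide (lookup B i) (basis-in i))) e) (cong ((+ d) ·v_) (sym (lookup∘tabulate (λ i → proj₁ (divide (lookup B i) (basis-in i))) i))))) (basis-in i)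
          lincomb-D : ∀ {n} (k : Vec ℤ n) vs → (∀ i → D (lookup vs i)) → D (lincomb k vs)
          lincomb-D [] [] _ = + 0 , refl
          lincomb-D (k ∷ ks) (v ∷ vs) h = D-+ {k ·v v} {lincomb ks vs} (D-· k {v} (h zero)) (lincomb-D ks vs (λ i → h (suc i)))
          unit : (Σ Pt λ y → z ≡ (+ d) ·v y) → MultipleOf (InLat B) d
          -- The Bézout vector divided by `d` has first coordinate 1, as `Codes` requires.
          -- Containment in `V` or in `D` is decided on the divided basis, and a basis vector
          -- outside feeds `¬V⇒D` or `¬D⇒all`.
          unit (v4 y₁ y₂ y₃ y₄ , f) = cases (dec-all V V? quotient) (dec-all D D? quotient)
            where
            y₁≡1 : y₁ ≡ + 1
            y₁≡1 = ℤP.*-cancelˡ-≡ (+ d) y₁ (+ 1) (trans (sym (cong head f)) (trans z-head (sym (ℤP.*-identityʳ (+ d)))))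
            u : P (v4 (+ 1) y₂ y₃ y₄)
            u = subst (λ t → P (v4 t y₂ y₃ y₄)) y₁≡1 (subst (InLat B) f (coeffs , refl))
            open Codes P gr spP u
            cases : ((∀ i → V (lookup quotient i)) ⊎ Σ (Fin 4) λ i → ¬ V (lookup quotient i)) →
                    ((∀ i → D (lookup quotient i)) ⊎ Σ (Fin 4) λ i → ¬ D (lookup quotient i)) →
                    MultipleOf (InLat B) d
            cases (inj₁ allV) _ = inj₂ (inj₂ (V-into , outof (full-V (unit-V (V-into ((+ d) ·v v4 (+ 1) y₂ y₃ y₄) u)))))
              where
              V-into : InLat B ⊆ (d ·P V)
              V-into = into (λ k → lincomb-V k quotient allV)
              unit-V : (d ·P V) ((+ d) ·v v4 (+ 1) y₂ y₃ y₄) → V (v4 (+ 1) y₂ y₃ y₄)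
              unit-V (y , v , g) = subst V (·v-cancel d {y} {v4 (+ 1) y₂ y₃ y₄} (sym g)) v
            cases (inj₂ (i , nv)) (inj₁ allD) = inj₂ (inj₁ (into (λ k → lincomb-D k quotient allD) , outof (¬V⇒D (quotient-P i) nv)))
            cases (inj₂ (i , nv)) (inj₂ (j , nd)) = inj₁ (into (λ _ → tt) ,
              outof (λ y _ → ¬D⇒all {lookup quotient j} (¬V⇒D (quotient-P i) nv) (quotient-P j) nd y))

-- Reflections

-- x ↦ x - (k/2)⟨x,r⟩ r, the reflection in r.
record Root : Set where
  field
    r : Pt
    k : ℤ
    unit : k * norm2 r ≡ + 4
    coeffV : ∀ x → V x → Σ ℤ λ t → k * dot x r ≡ + 2 * t × V (t ·v r)
    coeffD : ∀ x → D x → Σ ℤ λ t → k * dot x r ≡ + 2 * t × D (t ·v r)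
open Root

reflMat : Pt → ℤ → Vec Pt 4
reflMat r@(v4 a b c d) k = v4 (row e₁ a) (row e₂ b) (row e₃ c) (row e₄ d)
  where
  row : Pt → ℤ → Pt
  row e a = ((+ 2) ·v e) -v ((k * a) ·v r)

reflMat-·m : ∀ r k x → reflMat r k ·m x ≡ ((+ 2) ·v x) -v ((k * dot x r) ·v r)
reflMat-·m r@(v4 a b c d) k x@(v4 p q s t) = v4≡
  (row e₁ a p (trans (dot-comm e₁ x) (dot-e₁ p q s t))) (row e₂ b q (trans (dot-comm e₂ x) (dot-e₂ p q s t)))
  (row e₃ c s (trans (dot-comm e₃ x) (dot-e₃ p q s t))) (row e₄ d t (trans (dot-comm e₄ x) (dot-e₄ p q s t)))
  where
  l : ∀ p k a y → + 2 * p - k * a * y ≡ + 2 * p - k * y * a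
  l = solve-∀
  row : ∀ (e : Pt) a p → dot e x ≡ p → dot (((+ 2) ·v e) -v ((k * a) ·v r)) x ≡ + 2 * p - (k * dot x r) * a
  row e a p h = trans (dot--ˡ ((+ 2) ·v e) ((k * a) ·v r) x)
    (trans (cong₂ _-_ (trans (dot-·ˡ (+ 2) e x) (cong (+ 2 *_) h)) (trans (dot-·ˡ (k * a) r x) (cong (k * a *_) (dot-comm r x)))) (l p k a (dot x r)))

refl-act : ∀ r k {x t} → k * dot x r ≡ + 2 * t → reflMat r k ·m x ≡ (+ 2) ·v (x -v (t ·v r))
refl-act r k {x} {t} e = trans (reflMat-·m r k x) (trans (cong (λ c → ((+ 2) ·v x) -v (c ·v r)) e)
  (trans (cong (((+ 2) ·v x) -v_) (sym (·v-assoc (+ 2) t r))) (sym (·v-- (+ 2) x (t ·v r)))))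

reflect : Root → W
reflect ρ = record
  { mat = reflMat (r ρ) (k ρ)
  ; iso = λ x → trans (cong norm2 (reflMat-·m (r ρ) (k ρ) x)) (trans (norm-- ((+ 2) ·v x) ((k ρ * dot x (r ρ)) ·v r ρ))
      (trans (cong₂ _+_ (cong₂ _-_ (norm-· (+ 2) x) (cong (+ 2 *_) (trans (dot-·ˡ (+ 2) x _) (cong (+ 2 *_) (dot-·ʳ x (k ρ * dot x (r ρ)) (r ρ))))))
        (norm-· (k ρ * dot x (r ρ)) (r ρ)))
      (trans (l₁ (norm2 x) (k ρ) (dot x (r ρ)) (norm2 (r ρ))) (trans (cong (λ n → + 4 * norm2 x - + 4 * (k ρ * dot x (r ρ) * dot x (r ρ)) + n * (k ρ * dot x (r ρ) * dot x (r ρ))) (unit ρ)) (l₂ (norm2 x) _)))))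
  ; presV = λ x v → let t , e , w = coeffV ρ x v in x -v (t ·v r ρ) , V-- v w , refl-act (r ρ) (k ρ) e
  ; presD = λ x v → let t , e , w = coeffD ρ x v in x -v (t ·v r ρ) , D-- {x} v w , refl-act (r ρ) (k ρ) e
  }
  where
  l₁ : ∀ x k s n → + 2 * + 2 * x - + 2 * (+ 2 * (k * s * s)) + k * s * (k * s) * n ≡ + 4 * x - + 4 * (k * s * s) + k * n * (k * s * s)
  l₁ = solve-∀
  l₂ : ∀ x y → + 4 * x - + 4 * y + + 4 * y ≡ + 4 * x
  l₂ = solve-∀

-- Lengths are named as in the usual F₄ system, with long roots `±eᵢ ± eⱼ` of norm 2. Its short
-- roots have norm 1 and may be half-integral, so they appear doubled in `short`, as vectors of norm
-- 4 in `V`.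
long : ∀ r → D r → norm2 r ≡ + 2 → Root
long r d n = record
  { r = r ; k = + 2 ; unit = cong (+ 2 *_) n
  ; coeffV = λ x v → dot x r , refl , even-scale (V·D-even {x} {r} v d)
  ; coeffD = λ x _ → dot x r , refl , D-· (dot x r) {r} d }
  where
  even-scale : ∀ {t} → Even t → V (t ·v r)
  even-scale (u , refl) = subst V (·v-assoc (+ 2) u r) (V-2· (u ·v r))

short : ∀ r → V r → norm2 r ≡ + 4 → Root
short r v n = record
  { r = r ; k = + 1 ; unit = cong (+ 1 *_) n
  ; coeffV = λ x xv → let t , e = V·D-even {x} {r} xv (V⇒D v) in t , trans (ℤP.*-identityˡ (dot x r)) e , V-· t v
  ; coeffD = λ x xd → let t , e = V·D-even {r} {x} v xd in t , trans (ℤP.*-identityˡ (dot x r)) (trans (dot-comm x r) e) , D-· t {r} (V⇒D v) }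

act≡ : ∀ ρ {x y t} → reflect ρ ⊢ x ↦ y → k ρ * dot x (r ρ) ≡ + 2 * t → y ≡ x -v (t ·v r ρ)
act≡ ρ p e = ↦-unique (reflect ρ) p (refl-act (r ρ) (k ρ) e)

coeff-sub : ∀ k (x : Pt) t q r → k * dot (x -v (t ·v q)) r ≡ k * dot x r - t * (k * dot q r)
coeff-sub k x t q r = trans (cong (k *_) (trans (dot--ˡ x (t ·v q) r) (cong (λ u → dot x r - u) (dot-·ˡ t q r)))) (l k (dot x r) t (dot q r))
  where l : ∀ k a t b → k * (a - t * b) ≡ k * a - t * (k * b)
        l = solve-∀

module _ (ρ σ : Root) {K : Pred} (s : K ⊆ V) where

  commute : dot (r ρ) (r σ) ≡ + 0 → pre (reflect ρ) (pre (reflect σ) K) ⊆ pre (reflect σ) (pre (reflect ρ) K)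
  commute o x (y , (z , kz , q) , p) =
    let xv = ↦V⁻ (reflect ρ) p (↦V⁻ (reflect σ) q (s z kz))
        A , eA , _ = coeffV ρ x xv
        B , eB , _ = coeffV σ x xv
        y≡ = act≡ ρ p eA
        z≡ = act≡ σ (subst (reflect σ ⊢_↦ z) y≡ q) (trans (coeff-sub (k σ) x A (r ρ) (r σ)) (trans (cong (λ t → k σ * dot x (r σ) - A * (k σ * t)) o) (trans (cong (λ t → t - A * (k σ * + 0)) eB) (l A B (k σ)))))
        o' = trans (dot-comm (r σ) (r ρ)) o
    in x -v (B ·v r σ) , (z , kz , subst (reflect ρ ⊢ (x -v (B ·v r σ)) ↦_) (trans (swp x (B ·v r σ) (A ·v r ρ)) (sym z≡))
         (refl-act (r ρ) (k ρ) (trans (coeff-sub (k ρ) x B (r σ) (r ρ)) (trans (cong (λ t → k ρ * dot x (r ρ) - B * (k ρ * t)) o') (trans (cong (λ t → t - B * (k ρ * + 0)) eA) (l B A (k ρ))))))) ,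
       refl-act (r σ) (k σ) eB
    where
    l : ∀ a b k → + 2 * b - a * (k * + 0) ≡ + 2 * b
    l = solve-∀
    swp : ∀ {n} (x a b : Vec ℤ n) → (x -v a) -v b ≡ (x -v b) -v a
    swp [] [] [] = refl
    swp (x ∷ xs) (a ∷ as) (b ∷ bs) = cong₂ _∷_ (i x a b) (swp xs as bs)
      where i : ∀ x a b → x - a - b ≡ x - b - a
            i = solve-∀

  -- Both triple products send x to x - (A + B)(r + q), where A and B are the coefficients of x along r and q.
  braid : k ρ * dot (r σ) (r ρ) ≡ - + 2 → k σ * dot (r ρ) (r σ) ≡ - + 2 →
    pre (reflect ρ) (pre (reflect σ) (pre (reflect ρ) K)) ⊆ pre (reflect σ) (pre (reflect ρ) (pre (reflect σ) K))
  braid o o' x (y , (y' , (z , kz , p₃) , p₂) , p₁) =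
    let xv = ↦V⁻ (reflect ρ) p₁ (↦V⁻ (reflect σ) p₂ (↦V⁻ (reflect ρ) p₃ (s z kz)))
        A , eA , _ = coeffV ρ x xv
        B , eB , _ = coeffV σ x xv
        y≡ = act≡ ρ p₁ eA
        y'≡ = act≡ σ (subst (reflect σ ⊢_↦ y') y≡ p₂) (second ρ σ x A B o' eB)
        z≡ = act≡ ρ (subst (reflect ρ ⊢_↦ z) y'≡ p₃) (third ρ σ x A B o eA)
    in x -v (B ·v r σ) , ((x -v (B ·v r σ)) -v ((B + A) ·v r ρ) , (z , kz ,
         subst (reflect σ ⊢ ((x -v (B ·v r σ)) -v ((B + A) ·v r ρ)) ↦_) (trans (fin A B x (r σ) (r ρ)) (sym z≡)) (refl-act (r σ) (k σ) (third σ ρ x B A o' eB))) ,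
         refl-act (r ρ) (k ρ) (second σ ρ x B A o eA)) ,
       refl-act (r σ) (k σ) eB
    where
    second : ∀ ρ σ x A B → k σ * dot (r ρ) (r σ) ≡ - + 2 → k σ * dot x (r σ) ≡ + 2 * B → k σ * dot (x -v (A ·v r ρ)) (r σ) ≡ + 2 * (A + B)
    second ρ σ x A B o' eB = trans (coeff-sub (k σ) x A (r ρ) (r σ)) (trans (cong₂ (λ u v → u - A * v) eB o') (l A B))
      where l : ∀ A B → + 2 * B - A * (- + 2) ≡ + 2 * (A + B)
            l = solve-∀
    third : ∀ ρ σ x A B → k ρ * dot (r σ) (r ρ) ≡ - + 2 → k ρ * dot x (r ρ) ≡ + 2 * A →
      k ρ * dot ((x -v (A ·v r ρ)) -v ((A + B) ·v r σ)) (r ρ) ≡ + 2 * B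
    third ρ σ x A B o eA = trans (coeff-sub (k ρ) (x -v (A ·v r ρ)) (A + B) (r σ) (r ρ))
      (trans (cong₂ (λ u v → u - (A + B) * v) (trans (coeff-sub (k ρ) x A (r ρ) (r ρ)) (cong₂ (λ u v → u - A * v) eA (unit ρ))) o) (l A B))
      where l : ∀ A B → + 2 * A - A * + 4 - (A + B) * (- + 2) ≡ + 2 * B
            l = solve-∀
    fin : ∀ A B {n} (x q r : Vec ℤ n) → ((x -v (B ·v q)) -v ((B + A) ·v r)) -v (A ·v q) ≡ ((x -v (A ·v r)) -v ((A + B) ·v q)) -v (B ·v r)
    fin A B [] [] [] = refl
    fin A B (x ∷ xs) (q ∷ qs) (r ∷ rs) = cong₂ _∷_ (i A B x q r) (fin A B xs qs rs)
      where i : ∀ A B x q r → x - B * q - (B + A) * r - A * q ≡ x - A * r - (A + B) * q - B * r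
            i = solve-∀

involution : ∀ ρ {K} → K ⊆ V → pre (reflect ρ) (pre (reflect ρ) K) ≐ K
involution ρ {K} s = to , λ x kx → let A , eA , w = coeffV ρ x (s x kx) in
    x -v (A ·v r ρ) , (x , kx , subst (reflect ρ ⊢ (x -v (A ·v r ρ)) ↦_) (back A x (r ρ)) (refl-act (r ρ) (k ρ) (again x A eA))) , refl-act (r ρ) (k ρ) eA
  where
  again : ∀ x A → k ρ * dot x (r ρ) ≡ + 2 * A → k ρ * dot (x -v (A ·v r ρ)) (r ρ) ≡ + 2 * (- A)
  again x A eA = trans (coeff-sub (k ρ) x A (r ρ) (r ρ)) (trans (cong₂ (λ u v → u - A * v) eA (unit ρ)) (l A))
    where l : ∀ A → + 2 * A - A * + 4 ≡ + 2 * (- A)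
          l = solve-∀
  back : ∀ A {n} (x r : Vec ℤ n) → (x -v (A ·v r)) -v ((- A) ·v r) ≡ x
  back A [] [] = refl
  back A (x ∷ xs) (r ∷ rs) = cong₂ _∷_ (i A x r) (back A xs rs)
    where i : ∀ A x r → x - A * r - (- A) * r ≡ x
          i = solve-∀
  to : pre (reflect ρ) (pre (reflect ρ) K) ⊆ K
  to x (y , (z , kz , q) , p) =
    let xv = ↦V⁻ (reflect ρ) p (↦V⁻ (reflect ρ) q (s z kz)) ; A , eA , _ = coeffV ρ x xv
        y≡ = act≡ ρ p eA
        z≡ = act≡ ρ (subst (reflect ρ ⊢_↦ z) y≡ q) (again x A eA)
    in subst K (trans z≡ (back A x (r ρ))) kz

-- Involutions of a set with three elements

Fixed : (Fin 3 → Fin 3) → Set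
Fixed f = ∀ i → f i ≡ i

two-points : ∀ (x y z w : Fin 3) → x ≢ y → z ≢ x → z ≢ y → w ≢ x → w ≢ y → z ≡ w
two-points = toWitness {a? = all? λ x → all? λ y → all? λ z → all? λ w →
  ¬? (x ≟F y) →-dec (¬? (z ≟F x) →-dec (¬? (z ≟F y) →-dec (¬? (w ≟F x) →-dec (¬? (w ≟F y) →-dec (z ≟F w)))))} tt

module _ (f : Fin 3 → Fin 3) (ff : ∀ i → f (f i) ≡ i) where

  -- The third point is left over as its own image, because `f` is injective.
  two-fixed : ∀ {x y} → x ≢ y → f x ≡ x → f y ≡ y → Fixed f
  two-fixed {x} {y} ne fx fy z with z ≟F x | z ≟F y
  ... | yes refl | _ = fx
  ... | no _ | yes refl = fy
  ... | no zx | no zy = two-points x y (f z) z ne (λ e → zx (trans (sym (ff z)) (trans (cong f e) fx)))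
    (λ e → zy (trans (sym (ff z)) (trans (cong f e) fy))) zx zy

  fixed-point : Σ (Fin 3) λ i → f i ≡ i
  fixed-point with f zero ≟F zero | f 1F ≟F 1F
  ... | yes e | _ = zero , e
  ... | no _ | yes e = 1F , e
  ... | no n | no m with f 2F ≟F 2F
  ... | yes e = 2F , e
  ... | no l = third (f 2F) refl
    where
    1≢2 : _≢_ {A = Fin 3} 1F 2F
    1≢2 ()
    1≢0 : _≢_ {A = Fin 3} 1F zero
    1≢0 ()
    0≢2 : _≢_ {A = Fin 3} zero 2F
    0≢2 ()
    0≢1 : _≢_ {A = Fin 3} zero 1F
    0≢1 ()
    third : ∀ j → f 2F ≡ j → Σ (Fin 3) λ i → f i ≡ i
    third 2F e = ⊥-elim (l e)
    third zero e = 1F , two-points zero 2F (f 1F) 1F (λ ())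
      (λ h → 1≢2 (trans (sym (ff 1F)) (trans (cong f h) (trans (cong f (sym e)) (ff 2F)))))
      (λ h → 1≢0 (trans (sym (ff 1F)) (trans (cong f h) e))) (λ ()) (λ ())
    third 1F e = zero , two-points 1F 2F (f zero) zero (λ ())
      (λ h → 0≢2 (trans (sym (ff zero)) (trans (cong f h) (trans (cong f (sym e)) (ff 2F)))))
      (λ h → 0≢1 (trans (sym (ff zero)) (trans (cong f h) e))) (λ ()) (λ ())

  -- A nontrivial `f` has only one fixed point by `two-fixed`, and a map commuting with `f` sends
  -- fixed points of `f` to fixed points.
  commuting-fixed : ∀ g → (∀ i → f (g i) ≡ g (f i)) → ¬ Fixed f → ∀ {x} → f x ≡ x → g x ≡ x
  commuting-fixed g c n {x} e with g x ≟F x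
  ... | yes h = h
  ... | no h = ⊥-elim (n (two-fixed h (trans (c x) (cong g e)) e))

  -- With `g` trivial the braid relation reads `f (f i) ≡ f i`, and `f` is an involution.
  braid-fixed : ∀ g → (∀ i → f (g (f i)) ≡ g (f (g i))) → Fixed g → Fixed f
  braid-fixed g b h i = sym (trans (sym (ff i)) (trans (cong f (sym (h (f i)))) (trans (b i) (trans (h (f (g i))) (cong f (h i))))))

-- Roots of F₄ acting on three lattices

Vρδ₁₂ : V (v4 (+ 1) (- + 1) (+ 1) (- + 1))
Vρδ₁₂ = (+ 1 , refl) , (+ 0 , refl) , (+ 1 , refl)
Vρδ₂₃ : V (v4 (- + 1) (+ 1) (+ 1) (+ 1))
Vρδ₂₃ = (- + 1 , refl) , (- + 1 , refl) , (- + 1 , refl)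
Vρδ₃₄ : V (v4 (+ 1) (- + 1) (- + 1) (+ 1))
Vρδ₃₄ = (+ 1 , refl) , (+ 1 , refl) , (+ 0 , refl)

-- The roots of `ℓ₁₂`, `ℓ₂₃`, `ℓ₃₄`, `s₄` generate the signed permutations. Those of `s₁`, `s₂`,
-- `s₃`, `ℓ₂₄` are the images under ρ of `δ₁₂`, `δ₂₃`, `δ₃₄`, `e₄`. In the chain `s₄`, `s₁`, `s₂`,
-- `s₃` neighbours meet at 120 degrees, which gives the braid relations.
ℓ₁₂ ℓ₂₃ ℓ₃₄ ℓ₂₄ s₄ s₁ s₂ s₃ : Root
ℓ₁₂ = long δ₁₂ (+ 0 , refl) refl
ℓ₂₃ = long δ₂₃ (+ 0 , refl) refl
ℓ₃₄ = long δ₃₄ (+ 0 , refl) refl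
ℓ₂₄ = long (v4 (+ 0) (+ 1) (+ 0) (- + 1)) (+ 0 , refl) refl
s₄ = short ((+ 2) ·v e₄) (V-2· e₄) refl
s₁ = short (v4 (+ 1) (- + 1) (+ 1) (- + 1)) Vρδ₁₂ refl
s₂ = short (v4 (- + 1) (+ 1) (+ 1) (+ 1)) Vρδ₂₃ refl
s₃ = short (v4 (+ 1) (- + 1) (- + 1) (+ 1)) Vρδ₃₄ refl

Invariant : Root → Pred → Set
Invariant ρ K = pre (reflect ρ) K ≐ K

Standard Rotated : Pred → Set
Standard K = Invariant ℓ₁₂ K × Invariant ℓ₂₃ K × Invariant ℓ₃₄ K × Invariant s₄ K
Rotated K = Invariant s₁ K × Invariant s₂ K × Invariant s₃ K × Invariant ℓ₂₄ K

module _ (K : Pred) (sub : K ⊆ V) (a : Fin 3 → W) (apart : ∀ i j → pre (a i) K ≐ pre (a j) K → i ≡ j)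
         (cover : ∀ g → Σ (Fin 3) λ i → pre g K ≐ pre (a i) K) where
  private
    L : Fin 3 → Pred
    L i = pre (a i) K

    L⊆V : ∀ i → L i ⊆ V
    L⊆V i = pre-V (a i) sub

    abstract
      π : Root → Fin 3 → Fin 3
      π ρ i = proj₁ (cover (a i ∘w reflect ρ))

      π-spec : ∀ ρ i → pre (reflect ρ) (L i) ≐ L (π ρ i)
      π-spec ρ i = ≐-trans (≐-sym (pre-∘ (a i) (reflect ρ) sub)) (proj₂ (cover (a i ∘w reflect ρ)))

      π₂ : ∀ ρ σ i → pre (reflect ρ) (pre (reflect σ) (L i)) ≐ L (π ρ (π σ i))
      π₂ ρ σ i = ≐-trans (pre-cong (reflect ρ) (π-spec σ i)) (π-spec ρ (π σ i))

      π-involutive : ∀ ρ i → π ρ (π ρ i) ≡ i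
      π-involutive ρ i = apart _ _ (≐-trans (≐-sym (π₂ ρ ρ i)) (involution ρ (L⊆V i)))

      π-commute : ∀ ρ σ → dot (r ρ) (r σ) ≡ + 0 → ∀ i → π ρ (π σ i) ≡ π σ (π ρ i)
      π-commute ρ σ o i = apart _ _ (≐-trans (≐-sym (π₂ ρ σ i)) (≐-trans
        (commute ρ σ (L⊆V i) o , commute σ ρ (L⊆V i) (trans (dot-comm (r σ) (r ρ)) o)) (π₂ σ ρ i)))

      π-braid : ∀ ρ σ → k ρ * dot (r σ) (r ρ) ≡ - + 2 → k σ * dot (r ρ) (r σ) ≡ - + 2 → ∀ i → π ρ (π σ (π ρ i)) ≡ π σ (π ρ (π σ i))
      π-braid ρ σ o o' i = apart _ _ (≐-trans (≐-sym (π₃ ρ σ)) (≐-trans (braid ρ σ (L⊆V i) o o' , braid σ ρ (L⊆V i) o' o) (π₃ σ ρ)))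
        where
        π₃ : ∀ ρ σ → pre (reflect ρ) (pre (reflect σ) (pre (reflect ρ) (L i))) ≐ L (π ρ (π σ (π ρ i)))
        π₃ ρ σ = ≐-trans (pre-cong (reflect ρ) (π₂ σ ρ i)) (π-spec ρ (π σ (π ρ i)))

      invariant : ∀ ρ {i} → π ρ i ≡ i → Invariant ρ (L i)
      invariant ρ {i} e = subst (λ j → pre (reflect ρ) (L i) ≐ L j) e (π-spec ρ i)

    trivial? : ∀ ρ → Dec (Fixed (π ρ))
    trivial? ρ = all? (λ i → π ρ i ≟F i)

    spread : ∀ ρ σ → k ρ * dot (r σ) (r ρ) ≡ - + 2 → k σ * dot (r ρ) (r σ) ≡ - + 2 → Fixed (π σ) → Fixed (π ρ)
    spread ρ σ o o' = braid-fixed (π ρ) (π-involutive ρ) (π σ) (π-braid ρ σ o o')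

  -- Braid relations propagate trivial action among the long roots and among the short roots. If neither length acts
  -- trivially, orthogonal long and short roots give commuting transpositions of three points, which are equal.
  invariant-lattice : Σ (Fin 3) λ x → Standard (pre (a x) K) ⊎ Rotated (pre (a x) K)
  invariant-lattice = go (trivial? ℓ₂₃) (trivial? s₄)
    where
    go : Dec (Fixed (π ℓ₂₃)) → Dec (Fixed (π s₄)) → Σ (Fin 3) λ x → Standard (pre (a x) K) ⊎ Rotated (pre (a x) K)
    go (yes t) _ = let x , e = fixed-point (π s₄) (π-involutive s₄) in x , inj₁
        (invariant ℓ₁₂ (spread ℓ₁₂ ℓ₂₃ refl refl t x) , invariant ℓ₂₃ (t x) , invariant ℓ₃₄ (spread ℓ₃₄ ℓ₂₃ refl refl t x) , invariant s₄ e)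
    -- Here the trivial action spreads along the short roots, while a common fixed point of several
    -- long reflections is not at hand. One long reflection has a fixed point, and the conjugates by
    -- ρ of the signed permutations ask for just one.
    go (no _) (yes t) =
        let x , e = fixed-point (π ℓ₂₄) (π-involutive ℓ₂₄)
            t₁ = spread s₁ s₄ refl refl t
            t₂ = spread s₂ s₁ refl refl t₁
            t₃ = spread s₃ s₂ refl refl t₂
        in x , inj₂ (invariant s₁ (t₁ x) , invariant s₂ (t₂ x) , invariant s₃ (t₃ x) , invariant ℓ₂₄ e)
    go (no n) (no m) =
        let x , e = fixed-point (π ℓ₂₃) (π-involutive ℓ₂₃)
            e₄ = commuting-fixed (π ℓ₂₃) (π-involutive ℓ₂₃) (π s₄) (π-commute ℓ₂₃ s₄ refl) n e
            f₂ = commuting-fixed (π ℓ₂₃) (π-involutive ℓ₂₃) (π s₂) (π-commute ℓ₂₃ s₂ refl) n e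
            e₁₂ = commuting-fixed (π s₄) (π-involutive s₄) (π ℓ₁₂) (π-commute s₄ ℓ₁₂ refl) m e₄
            -- `ℓ₃₄` is not orthogonal to `s₄`, so its fixed point is reached through `s₂`, which is
            -- orthogonal to both `ℓ₂₃` and `ℓ₃₄`. The braid relations along `s₄`, `s₁`, `s₂` show
            -- that `s₂` acts nontrivially as well.
            m₂ = λ t → m (spread s₄ s₁ refl refl (spread s₁ s₂ refl refl t))
            e₃₄ = commuting-fixed (π s₂) (π-involutive s₂) (π ℓ₃₄) (π-commute s₂ ℓ₃₄ refl) m₂ f₂
        in x , inj₁ (invariant ℓ₁₂ e₁₂ , invariant ℓ₂₃ e , invariant ℓ₃₄ e₃₄ , invariant s₄ e₄)

signedPerm : ∀ {K : Pred} →
  (∀ y → K y → K (y -v (dot y δ₁₂ ·v δ₁₂))) → (∀ y → K y → K (y -v (dot y δ₂₃ ·v δ₂₃))) →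
  (∀ y → K y → K (y -v (dot y δ₃₄ ·v δ₃₄))) → (∀ y → K y → K (y -v ((+ 2 * dot y e₄) ·v e₄))) → SignedPerm K
signedPerm {K} h₁ h₂ h₃ h₄ = record
  { swap₁₂ = λ {a} {b} {c} {d} h → subst K (trans (cong (λ t → v4 a b c d -v (t ·v δ₁₂)) (l₁ a b c d)) (v4≡ (u a b) (v a b) (o c (a - b)) (o d (a - b)))) (h₁ _ h)
  ; swap₂₃ = λ {a} {b} {c} {d} h → subst K (trans (cong (λ t → v4 a b c d -v (t ·v δ₂₃)) (l₂ a b c d)) (v4≡ (o a (b - c)) (u b c) (v b c) (o d (b - c)))) (h₂ _ h)
  ; swap₃₄ = λ {a} {b} {c} {d} h → subst K (trans (cong (λ t → v4 a b c d -v (t ·v δ₃₄)) (l₃ a b c d)) (v4≡ (o a (c - d)) (o b (c - d)) (u c d) (v c d))) (h₃ _ h)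
  ; neg₄ = λ {a} {b} {c} {d} h → subst K (trans (cong (λ t → v4 a b c d -v ((+ 2 * t) ·v e₄)) (dot-e₄ a b c d)) (v4≡ (o a (+ 2 * d)) (o b (+ 2 * d)) (o c (+ 2 * d)) (w d))) (h₄ _ h) }
  where
  l₁ : ∀ a b c d → a * + 1 + (b * (- + 1) + (c * + 0 + (d * + 0 + + 0))) ≡ a - b
  l₁ = solve-∀
  l₂ : ∀ a b c d → a * + 0 + (b * + 1 + (c * (- + 1) + (d * + 0 + + 0))) ≡ b - c
  l₂ = solve-∀
  l₃ : ∀ a b c d → a * + 0 + (b * + 0 + (c * + 1 + (d * (- + 1) + + 0))) ≡ c - d
  l₃ = solve-∀
  u : ∀ a b → a - (a - b) * + 1 ≡ b
  u = solve-∀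
  v : ∀ a b → b - (a - b) * (- + 1) ≡ a
  v = solve-∀
  o : ∀ c t → c - t * + 0 ≡ c
  o = solve-∀
  w : ∀ d → d - + 2 * d * + 1 ≡ - d
  w = solve-∀

reflected : ∀ ρ {K} → K ⊆ V → Invariant ρ K → ∀ x → K x → Σ ℤ λ t → k ρ * dot x (r ρ) ≡ + 2 * t × K (x -v (t ·v r ρ))
reflected ρ {K} s (_ , from) x kx = let t , e , _ = coeffV ρ x (s x kx) ; y , ky , p = from x kx in t , e , subst K (act≡ ρ p e) ky

long-reflected : ∀ q (d : D q) n {K} → K ⊆ V → Invariant (long q d n) K → ∀ x → K x → K (x -v (dot x q ·v q))
long-reflected q d n {K} s i x kx = let t , e , h = reflected (long q d n) s i x kx in subst (λ u → K (x -v (u ·v q))) (sym (cancel2 e)) h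

short-reflected : ∀ q (v : V q) n {K} → K ⊆ V → Invariant (short q v n) K → ∀ x → K x → Σ ℤ λ t → dot x q ≡ + 2 * t × K (x -v (t ·v q))
short-reflected q v n s i x kx = let t , e , h = reflected (short q v n) s i x kx in t , trans (sym (ℤP.*-identityˡ (dot x q))) e , h

standard-signedPerm : ∀ {K} → K ⊆ V → Standard K → SignedPerm K
standard-signedPerm {K} s (i₁ , i₂ , i₃ , i₄) = signedPerm (long-reflected δ₁₂ (+ 0 , refl) refl s i₁) (long-reflected δ₂₃ (+ 0 , refl) refl s i₂) (long-reflected δ₃₄ (+ 0 , refl) refl s i₃)
  λ y ky → let t , e , h = short-reflected ((+ 2) ·v e₄) (V-2· e₄) refl s i₄ y ky in
    subst (λ u → K (y -v u)) (trans (cong (_·v ((+ 2) ·v e₄)) (sym (cancel2 (trans (sym (dot-·ʳ y (+ 2) e₄)) e))))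
      (trans (·v-comm (dot y e₄) (+ 2) e₄) (·v-assoc (+ 2) (dot y e₄) e₄))) h

-- The similarity ρ, with ρ² = 2, which exchanges the two root systems

ρ : Pt → Pt
ρ (v4 a b c d) = v4 (a + c) (b + d) (a - c) (b - d)

ρρ : ∀ x → ρ (ρ x) ≡ (+ 2) ·v x
ρρ (v4 a b c d) = v4≡ (i a c) (i b d) (j a c) (j b d)
  where
  i : ∀ a c → a + c + (a - c) ≡ + 2 * a
  i = solve-∀
  j : ∀ a c → a + c - (a - c) ≡ + 2 * c
  j = solve-∀

ρ-+ : ∀ x y → ρ (x +v y) ≡ ρ x +v ρ y
ρ-+ (v4 a b c d) (v4 e f g h) = v4≡ (i a c e g) (i b d f h) (j a c e g) (j b d f h)
  where
  i : ∀ a c e g → a + e + (c + g) ≡ a + c + (e + g)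
  i = solve-∀
  j : ∀ a c e g → a + e - (c + g) ≡ a - c + (e - g)
  j = solve-∀

ρ-· : ∀ k x → ρ (k ·v x) ≡ k ·v ρ x
ρ-· k (v4 a b c d) = v4≡ (i k a c) (i k b d) (j k a c) (j k b d)
  where
  i : ∀ k a c → k * a + k * c ≡ k * (a + c)
  i = solve-∀
  j : ∀ k a c → k * a - k * c ≡ k * (a - c)
  j = solve-∀

ρ-- : ∀ x y → ρ (x -v y) ≡ ρ x -v ρ y
ρ-- x y = trans (cong ρ (sym (-v-as-+ x y))) (trans (ρ-+ x ((- + 1) ·v y)) (trans (cong (ρ x +v_) (ρ-· (- + 1) y)) (-v-as-+ (ρ x) (ρ y))))

ρ-lincomb : ∀ {n} (k : Vec ℤ n) vs → ρ (lincomb k vs) ≡ lincomb k (map ρ vs)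
ρ-lincomb [] [] = refl
ρ-lincomb (k ∷ ks) (v ∷ vs) = trans (ρ-+ (k ·v v) (lincomb ks vs)) (cong₂ _+v_ (ρ-· k v) (ρ-lincomb ks vs))

ρ-adjoint : ∀ x y → dot (ρ x) y ≡ dot x (ρ y)
ρ-adjoint (v4 a b c d) (v4 e f g h) = l a b c d e f g h
  where l : ∀ a b c d e f g h → (a + c) * e + ((b + d) * f + ((a - c) * g + ((b - d) * h + + 0))) ≡ a * (e + g) + (b * (f + h) + (c * (e - g) + (d * (f - h) + + 0)))
        l = solve-∀

ρ-inj : ∀ {x y} → ρ x ≡ ρ y → x ≡ y
ρ-inj {x} {y} e = 2v-cancel (trans (sym (ρρ x)) (trans (cong ρ e) (ρρ y)))

-- Together with `V⇒2D` and `ρρ` this says that ρ maps `D` onto `V` and `V` onto twice `D`.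
D⇒Vρ : ∀ {x} → D x → V (ρ x)
D⇒Vρ {v4 a b c d} (k , e) = (k - b - d , trans (l₁ a b c d) (trans (cong (λ t → t - + 2 * b - + 2 * d) e) (m₁ k b d))) ,
  (c , l₂ a c) , (k - b , trans (l₃ a b c d) (trans (cong (λ t → t - + 2 * b) e) (m₃ k b)))
  where
  l₁ : ∀ a b c d → a + c - (b + d) ≡ a + (b + (c + d)) - + 2 * b - + 2 * d
  l₁ = solve-∀
  m₁ : ∀ k b d → + 2 * k - + 2 * b - + 2 * d ≡ + 2 * (k - b - d)
  m₁ = solve-∀
  l₂ : ∀ a c → a + c - (a - c) ≡ + 2 * c
  l₂ = solve-∀
  l₃ : ∀ a b c d → a + c - (b - d) ≡ a + (b + (c + d)) - + 2 * b
  l₃ = solve-∀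
  m₃ : ∀ k b → + 2 * k - + 2 * b ≡ + 2 * (k - b)
  m₃ = solve-∀

V⇒2D : ∀ {x} → V x → Σ Pt λ y → D y × ρ x ≡ (+ 2) ·v y
V⇒2D {v4 a b c d} ((k , p) , (l , q) , (m , s)) rewrite minuend {a} p | minuend {a} q | minuend {a} s =
  v4 (a - l) (a - k - m) l (m - k) , (a - k , z a k l m) , v4≡ (i₁ a l) (i₂ a k m) (i₃ a l) (i₄ a k m)
  where
  z : ∀ a k l m → a - l + (a - k - m + (l + (m - k))) ≡ + 2 * (a - k)
  z = solve-∀
  i₁ : ∀ a l → a + (a - + 2 * l) ≡ + 2 * (a - l)
  i₁ = solve-∀
  i₂ : ∀ a k m → a - + 2 * k + (a - + 2 * m) ≡ + 2 * (a - k - m)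
  i₂ = solve-∀
  i₃ : ∀ a l → a - (a - + 2 * l) ≡ + 2 * l
  i₃ = solve-∀
  i₄ : ∀ a k m → a - + 2 * k - (a - + 2 * m) ≡ + 2 * (m - k)
  i₄ = solve-∀

ρim : Pred → Pred
ρim K y = Σ Pt λ x → K x × y ≡ ρ x

-- ρ is self-adjoint with square 2, so conjugation by it turns the reflection in `ρ δ` into the
-- reflection in `δ`.
rotated-signedPerm : ∀ {K} → K ⊆ V → Rotated K → SignedPerm (ρim K)
rotated-signedPerm {K} s (i₁ , i₂ , i₃ , i₄) = signedPerm (sh δ₁₂ Vρδ₁₂ refl i₁) (sh δ₂₃ Vρδ₂₃ refl i₂) (sh δ₃₄ Vρδ₃₄ refl i₃) lg
  where
  sh : ∀ δ (v : V (ρ δ)) n → Invariant (short (ρ δ) v n) K → ∀ y → ρim K y → ρim K (y -v (dot y δ ·v δ))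
  sh δ v n i y (x , kx , refl) = let t , e , h = short-reflected (ρ δ) v n s i x kx in x -v (t ·v ρ δ) , h ,
    sym (trans (ρ-- x (t ·v ρ δ)) (cong (ρ x -v_) (trans (ρ-· t (ρ δ)) (trans (cong (t ·v_) (ρρ δ))
      (trans (·v-comm t (+ 2) δ) (trans (·v-assoc (+ 2) t δ) (cong (_·v δ) (sym (trans (ρ-adjoint x δ) e)))))))))
  lg : ∀ y → ρim K y → ρim K (y -v ((+ 2 * dot y e₄) ·v e₄))
  lg y (x , kx , refl) = x -v (dot x (ρ e₄) ·v ρ e₄) , long-reflected (ρ e₄) (+ 0 , refl) refl s i₄ x kx ,
    sym (trans (ρ-- x (dot x (ρ e₄) ·v ρ e₄)) (cong (ρ x -v_) (trans (ρ-· (dot x (ρ e₄)) (ρ e₄)) (trans (cong (_·v ρ (ρ e₄)) (sym (ρ-adjoint x e₄)))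
      (trans (·v-comm (dot (ρ x) e₄) (+ 2) e₄) (·v-assoc (+ 2) (dot (ρ x) e₄) e₄))))))

-- Lattices with three flag orbits

↦-inj : ∀ w {x x' y} → w ⊢ x ↦ y → w ⊢ x' ↦ y → x ≡ x'
↦-inj w p q = 2v-cancel (trans (sym (↦-tr w p)) (↦-tr w q))

pre-inv' : ∀ w {K} → K ⊆ V → pre (inv w) (pre w K) ≐ K
pre-inv' w {K} s = (λ { t (y , (z , k , q) , p) → subst K (↦-unique w q (tr-↦ w p)) k }) ,
  (λ t k → let y , _ , p = onV w t (s t k) in y , (t , k , p) , ↦-tr w p)

Cj-pre : ∀ w {K K'} → K ⊆ V → pre w K ≐ K' → Cj (inv w) K K'
Cj-pre w {K} s (to , from) = (λ t k → let y , _ , p = onV w t (s t k) in y , to y (t , k , p) , ↦-tr w p) ,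
  (λ y k' → let t , k , p = from y k' in t , k , ↦-tr w p)

pre-lattice : ∀ w B → InLat B ⊆ V → Σ (Vec Pt 4) λ B' → pre w (InLat B) ≐ InLat B'
pre-lattice w B s = proj₁ (go B λ i → s (lookup B i) (basis-in B i)) ,
  (λ { t (x , (k , refl) , p) → k , ↦-inj w p (↦-lincomb w k {proj₁ basis} {B} (proj₂ basis)) }) ,
  (λ { t (k , refl) → lincomb k B , (k , refl) , ↦-lincomb w k {proj₁ basis} {B} (proj₂ basis) })
  where
  go : ∀ {n} (C : Vec Pt n) → (∀ i → V (lookup C i)) → Σ (Vec Pt n) λ C' → map (mat w ·m_) C' ≡ map ((+ 2) ·v_) C
  go [] _ = [] , refl
  go (c ∷ C) h = let x , _ , p = onV w c (h zero) ; xs , q = go C (λ i → h (suc i)) in x ∷ xs , cong₂ _∷_ p q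
  basis = go B λ i → s (lookup B i) (basis-in B i)

scaled-invariant : ∀ d {P : Pred} → (∀ w x → P x → Σ Pt λ y → P y × w ⊢ x ↦ y) → (∀ w y → P y → Σ Pt λ x → P x × w ⊢ x ↦ y) →
  ∀ w → pre w (d ·P P) ≐ (d ·P P)
scaled-invariant d {P} to from w =
  (λ { t (x , (y , py , refl) , p) → let u , pu , q = from w y py in u , pu , ↦-inj w p (↦-· w (+ d) q) }) ,
  (λ { t (y , py , refl) → let u , pu , q = to w y py in (+ d) ·v u , (u , pu , refl) , ↦-· w (+ d) q })

D-invariant : ∀ d w → pre w (d ·P D) ≐ (d ·P D)
D-invariant d = scaled-invariant d presD onD

V-invariant : ∀ d w → pre w (d ·P V) ≐ (d ·P V)
V-invariant d = scaled-invariant d presV onV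

threeLattices-cong : ∀ {K K'} → K ≐ K' → ThreeLattices K → ThreeLattices K'
threeLattices-cong e (a , apart , cover) = a ,
  (λ i j h → apart i j (≐-trans (pre-cong (a i) e) (≐-trans h (≐-sym (pre-cong (a j) e))))) ,
  λ g → let i , h = cover g in i , ≐-trans (pre-cong g (≐-sym e)) (≐-trans h (pre-cong (a i) e))

cubic≐ : ∀ s → InLat (cubicBasis s) ≐ ((2 ℕ.* s) ·P AllPts)
cubic≐ s = (λ { x (k , refl) → k , tt , trans (lincomb-· (+ (2 ℕ.* s)) k idRows) (cong ((+ (2 ℕ.* s)) ·v_) (sym (e-expand k))) }) ,
  (λ { x (y , _ , refl) → y , trans (cong ((+ (2 ℕ.* s)) ·v_) (e-expand y)) (sym (lincomb-· (+ (2 ℕ.* s)) y idRows)) })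

-- The basis of `L2Basis` is the multiple by `2s` of `ρ e₁`, `ρ e₃`, `ρ e₂`, `ρ e₄` in this order,
-- whence the exchange of the middle coordinates.
L2≐ : ∀ s → InLat (L2Basis s) ≐ ρim ((2 ℕ.* s) ·P AllPts)
L2≐ s = (λ { x (v4 a b c d , refl) → m ·v v4 a c b d , (v4 a c b d , tt , refl) ,
             trans (lincomb-· m (v4 a b c d) L2) (trans (cong (m ·v_) (comb a b c d)) (sym (ρ-· m (v4 a c b d)))) }) ,
  (λ { x (_ , (v4 a b c d , _ , refl) , refl) → v4 a c b d ,
             trans (ρ-· m (v4 a b c d)) (trans (cong (m ·v_) (sym (comb a c b d))) (sym (lincomb-· m (v4 a c b d) L2))) })
  where
  m = + (2 ℕ.* s)
  L2 : Vec Pt 4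
  L2 = v4 (v4 (+ 1) (+ 0) (+ 1) (+ 0)) (v4 (+ 1) (+ 0) (- + 1) (+ 0)) (v4 (+ 0) (+ 1) (+ 0) (+ 1)) (v4 (+ 0) (+ 1) (+ 0) (- + 1))
  comb : ∀ a b c d → lincomb (v4 a b c d) L2 ≡ ρ (v4 a c b d)
  comb a b c d = v4≡ (l₁ a b c d) (l₂ a b c d) (l₃ a b c d) (l₄ a b c d)
    where
    l₁ : ∀ a b c d → a * + 1 + (b * + 1 + (c * + 0 + (d * + 0 + + 0))) ≡ a + b
    l₁ = solve-∀
    l₂ : ∀ a b c d → a * + 0 + (b * + 0 + (c * + 1 + (d * + 1 + + 0))) ≡ c + d
    l₂ = solve-∀
    l₃ : ∀ a b c d → a * + 1 + (b * (- + 1) + (c * + 0 + (d * + 0 + + 0))) ≡ a - b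
    l₃ = solve-∀
    l₄ : ∀ a b c d → a * + 0 + (b * + 0 + (c * + 1 + (d * (- + 1) + + 0))) ≡ c - d
    l₄ = solve-∀

even-nat : ∀ d q → + d ≡ + 2 * q → d ≡ 2 ℕ.* ∣ q ∣
even-nat d q e = trans (cong ∣_∣ e) (ℤP.abs-* (+ 2) q)

positive-half : ∀ s → ℕ.NonZero (2 ℕ.* s) → s ≥ 1
positive-half zero ()
positive-half (suc s) _ = s≤s z≤n

nonZero-half : ∀ s → ℕ.NonZero (2 ℕ.* s) → ℕ.NonZero s
nonZero-half zero ()
nonZero-half (suc s) _ = _

V⇒even : ∀ d {e f} → V ((+ d) ·v v4 (+ 1) (+ 0) e f) → Σ ℕ λ s → d ≡ 2 ℕ.* s
V⇒even d ((q , e) , _) = ∣ q ∣ , even-nat d q (trans (l (+ d)) e)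
  where l : ∀ d → d ≡ d * + 1 - d * + 0
        l = solve-∀

module Forward (T : Kind) (B : Vec Pt 4) (sub : InLat B ⊆ V) (ind : Independent B) (three : ThreeLattices (InLat B)) where
  private
    a = proj₁ three
    apart = proj₁ (proj₂ three)

    Goal : Set₁
    Goal = Σ ℕ λ s → s ≥ 1 × (Conj T B (cubicBasis s) ⊎ Conj T B (L2Basis s))

    -- If one of the lattices were `W`-invariant, all three would equal it, against `apart`.
    not-invariant : ∀ x {Q} → pre (a x) (InLat B) ≐ Q → (∀ w → pre w Q ≐ Q) → ⊥
    not-invariant x {Q} e i = 0≢1 (apart zero 1F (≐-trans (all zero) (≐-sym (all 1F))))
      where
      K≐Q : InLat B ≐ Q
      K≐Q = ≐-trans (≐-sym (pre-inv' (a x) sub)) (≐-trans (pre-cong (inv (a x)) e) (i (inv (a x))))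
      all : ∀ y → pre (a y) (InLat B) ≐ Q
      all y = ≐-trans (pre-cong (a y) K≐Q) (i (a y))
      0≢1 : _≢_ {A = Fin 3} zero 1F
      0≢1 ()

    conj : ∀ x B' → pre (a x) (InLat B) ≐ InLat B' → Conj T B B'
    conj x B' e = toAff g , Gp⇒Sym T g , Cj-pre (a x) sub e
      where g = gp (inv (a x)) zeroV V0

    nonzero : ∀ x → Σ Pt λ t → pre (a x) (InLat B) t × t ≢ zeroV
    nonzero x = let t , _ , p = onV (a x) (lincomb e₁ B) (sub _ (e₁ , refl)) in
      t , (lincomb e₁ B , (e₁ , refl) , p) , λ t≡ → e₁≢0 (ind e₁ (sym (2v-cancel (trans (sym (·m-zero (mat (a x)))) (trans (cong (mat (a x) ·m_) (sym t≡)) p)))))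
      where
      e₁≢0 : e₁ ≢ replicate 4 (+ 0)
      e₁≢0 ()

    module _ (x : Fin 3) (B' : Vec Pt 4) (e : pre (a x) (InLat B) ≐ InLat B') where
      L⊆V : InLat B' ⊆ V
      L⊆V t h = pre-V (a x) sub t (proj₂ e t h)

      standard : Standard (InLat B') → Goal
      standard i = let t , h , ne = nonzero x in
        cases (classify-lattice B' (standard-signedPerm L⊆V i) (t , proj₁ e t h , ne))
        where
        cases : (Σ ℕ λ d → ℕ.NonZero d × MultipleOf (InLat B') d) → Goal
        cases (d , nz , inj₂ (inj₁ h)) = ⊥-elim (not-invariant x (≐-trans e h) (D-invariant d))
        cases (d , nz , inj₂ (inj₂ h)) = ⊥-elim (not-invariant x (≐-trans e h) (V-invariant d))
        cases (d , nz , inj₁ h) = go (V⇒even d (L⊆V ((+ d) ·v e₁) (proj₂ h _ (e₁ , tt , refl)))) nz h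
          where
          go : ∀ {d} → (Σ ℕ λ s → d ≡ 2 ℕ.* s) → ℕ.NonZero d → InLat B' ≐ (d ·P AllPts) → Goal
          go (s , refl) nz h = s , positive-half s nz , inj₁ (conj x (cubicBasis s) (≐-trans e (≐-trans h (≐-sym (cubic≐ s)))))

      rotated : Rotated (InLat B') → Goal
      rotated i = let t , h , ne = nonzero x in
        cases (classify-lattice ρB' (transport (rotated-signedPerm L⊆V i)) (ρ t , proj₁ ρ≐ _ (t , proj₁ e t h , refl) , λ q → ne (ρ-inj {t} {zeroV} q)))
        where
        ρB' = map ρ B'
        ρ≐ : ρim (InLat B') ≐ InLat ρB'
        ρ≐ = (λ { y (_ , (k , refl) , refl) → k , ρ-lincomb k B' }) , (λ { y (k , refl) → lincomb k B' , (k , refl) , sym (ρ-lincomb k B') })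
        transport : SignedPerm (ρim (InLat B')) → SignedPerm (InLat ρB')
        transport sp = record
          { swap₁₂ = λ h → proj₁ ρ≐ _ (SignedPerm.swap₁₂ sp (proj₂ ρ≐ _ h)) ; swap₂₃ = λ h → proj₁ ρ≐ _ (SignedPerm.swap₂₃ sp (proj₂ ρ≐ _ h))
          ; swap₃₄ = λ h → proj₁ ρ≐ _ (SignedPerm.swap₃₄ sp (proj₂ ρ≐ _ h)) ; neg₄ = λ h → proj₁ ρ≐ _ (SignedPerm.neg₄ sp (proj₂ ρ≐ _ h)) }
        halve : ∀ t d y → ρ t ≡ (+ d) ·v y → (+ 2) ·v t ≡ (+ d) ·v ρ y
        halve t d y h = trans (sym (ρρ t)) (trans (cong ρ h) (ρ-· (+ d) y))
        unhalve : ∀ t d y → (+ 2) ·v t ≡ (+ d) ·v ρ y → ρ t ≡ (+ d) ·v y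
        unhalve t d y h = 2v-cancel (trans (sym (ρ-· (+ 2) t)) (trans (cong ρ h) (trans (ρ-· (+ d) (ρ y)) (trans (cong ((+ d) ·v_) (ρρ y)) (·v-comm (+ d) (+ 2) y)))))
        cancel-double : ∀ s (t u : Pt) → (+ 2) ·v t ≡ (+ (2 ℕ.* s)) ·v u → t ≡ (+ s) ·v u
        cancel-double s t u h = 2v-cancel (trans h (trans (cong (_·v u) (ℤP.pos-* 2 s)) (sym (·v-assoc (+ 2) (+ s) u))))
        double : ∀ s (u : Pt) → (+ 2) ·v ((+ s) ·v u) ≡ (+ (2 ℕ.* s)) ·v u
        double s u = trans (·v-assoc (+ 2) (+ s) u) (cong (_·v u) (sym (ℤP.pos-* 2 s)))
        ρ∈ : ∀ (P : Pred) d → InLat ρB' ≐ (d ·P P) → ∀ t → InLat B' t → Σ Pt λ y → P y × (+ 2) ·v t ≡ (+ d) ·v ρ y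
        ρ∈ P d h t k = let y , p , q = proj₁ h (ρ t) (proj₁ ρ≐ _ (t , k , refl)) in y , p , halve t d y q
        ∈ρ : ∀ (P : Pred) d → InLat ρB' ≐ (d ·P P) → ∀ t y → P y → (+ 2) ·v t ≡ (+ d) ·v ρ y → InLat B' t
        ∈ρ P d h t y p q = let u , k , f = proj₂ ρ≐ _ (proj₂ h ((+ d) ·v y) (y , p , refl)) in
          subst (InLat B') (ρ-inj {u} {t} (trans (sym f) (sym (unhalve t d y q)))) k
        -- Some lattice vector `u` has `ρ u` equal to `d` times `y`; applying ρ again gives twice
        -- `u` as `d` times `ρ y`. The first coordinates make `d` even.
        even-content : ∀ (P : Pred) d → InLat ρB' ≐ (d ·P P) → ∀ y → P y → head (ρ y) ≡ + 1 → Σ ℕ λ s → d ≡ 2 ℕ.* s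
        even-content P d h y p one = let u , k , f = proj₂ ρ≐ _ (proj₂ h ((+ d) ·v y) (y , p , refl)) in
          hd u (ρ y) one (halve u d y (sym f))
          where
          hd : ∀ (u v : Pt) → head v ≡ + 1 → (+ 2) ·v u ≡ (+ d) ·v v → Σ ℕ λ s → d ≡ 2 ℕ.* s
          hd (v4 u₁ _ _ _) (v4 _ _ _ _) refl q = ∣ u₁ ∣ , even-nat d u₁ (trans (sym (ℤP.*-identityʳ (+ d))) (sym (cong head q)))
        -- The lattice is recovered from its image as half of the ρ-image of that image. As ρ maps
        -- `V` onto twice `D` and `D` onto `V`, the types exchange: `V` comes from `D` and `D` from
        -- `V`, and both are excluded by invariance.
        caseV : ∀ d → InLat ρB' ≐ (d ·P V) → InLat B' ≐ (d ·P D)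
        caseV d h = (λ t k → let y , v , q = ρ∈ V d h t k ; δ , dδ , r = V⇒2D {y} v in
                       δ , dδ , 2v-cancel (trans q (trans (cong ((+ d) ·v_) r) (·v-comm (+ d) (+ 2) δ)))) ,
                    (λ { t (δ , dδ , refl) → ∈ρ V d h ((+ d) ·v δ) (ρ δ) (D⇒Vρ {δ} dδ) (trans (·v-comm (+ 2) (+ d) δ) (cong ((+ d) ·v_) (sym (ρρ δ)))) })
        caseD : ∀ s → InLat ρB' ≐ ((2 ℕ.* s) ·P D) → InLat B' ≐ (s ·P V)
        caseD s h = (λ t k → let y , d , q = ρ∈ D (2 ℕ.* s) h t k in ρ y , D⇒Vρ {y} d , cancel-double s t (ρ y) q) ,
          (λ { t (v , vv , refl) → let δ , dδ , r = V⇒2D {v} vv in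
             ∈ρ D (2 ℕ.* s) h ((+ s) ·v v) δ dδ (trans (double s v) (cong ((+ (2 ℕ.* s)) ·v_) (2v-cancel (trans (sym (ρρ v)) (trans (cong ρ r) (ρ-· (+ 2) δ)))))) })
        caseA : ∀ s → InLat ρB' ≐ ((2 ℕ.* s) ·P AllPts) → InLat B' ≐ ρim (s ·P AllPts)
        caseA s h = (λ t k → let y , _ , q = ρ∈ AllPts (2 ℕ.* s) h t k in (+ s) ·v y , (y , tt , refl) , trans (cancel-double s t (ρ y) q) (sym (ρ-· (+ s) y))) ,
          (λ { t (_ , (y , _ , refl) , refl) → ∈ρ AllPts (2 ℕ.* s) h (ρ ((+ s) ·v y)) y tt (trans (cong ((+ 2) ·v_) (ρ-· (+ s) y)) (double s (ρ y))) })
        cases : (Σ ℕ λ d → ℕ.NonZero d × MultipleOf (InLat ρB') d) → Goal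
        cases (d , nz , inj₂ (inj₂ h)) = ⊥-elim (not-invariant x (≐-trans e (caseV d h)) (D-invariant d))
        cases (d , nz , inj₂ (inj₁ h)) = go (even-content D d h c₀ (+ 1 , refl) refl) h
          where
          go : ∀ {d} → (Σ ℕ λ s → d ≡ 2 ℕ.* s) → InLat ρB' ≐ (d ·P D) → Goal
          go (s , refl) h = ⊥-elim (not-invariant x (≐-trans e (caseD s h)) (V-invariant s))
        cases (d , nz , inj₁ h) = go (even-content AllPts d h e₁ tt refl) nz h
          where
          go' : ∀ {d} → (Σ ℕ λ s → d ≡ 2 ℕ.* s) → ℕ.NonZero d → InLat B' ≐ ρim (d ·P AllPts) → Goal
          go' (s , refl) nz h = s , positive-half s nz , inj₂ (conj x (L2Basis s) (≐-trans e (≐-trans h (≐-sym (L2≐ s)))))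
          go : ∀ {d} → (Σ ℕ λ s → d ≡ 2 ℕ.* s) → ℕ.NonZero d → InLat ρB' ≐ (d ·P AllPts) → Goal
          -- The content is halved a second time: the lattice contains `s` times `(1,0,1,0)`, which
          -- lies in `V` only for even `s`.
          go (s , refl) nz h = go' (V⇒even s (subst V (ρ-· (+ s) e₁) (L⊆V _ (proj₂ (caseA s h) _ ((+ s) ·v e₁ , (e₁ , tt , refl) , refl))))) (nonZero-half s nz) (caseA s h)

  conclusion : Goal
  conclusion = go (invariant-lattice (InLat B) sub a apart (proj₂ (proj₂ three)))
    where
    move : ∀ root {K K'} → K ≐ K' → Invariant root K → Invariant root K'
    move root e i = ≐-trans (pre-cong (reflect root) (≐-sym e)) (≐-trans i e)
    go : (Σ (Fin 3) λ x → Standard (pre (a x) (InLat B)) ⊎ Rotated (pre (a x) (InLat B))) → Goal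
    go (x , inj₁ (i₁ , i₂ , i₃ , i₄)) = let B' , e = pre-lattice (a x) B sub in
      standard x B' e (move ℓ₁₂ e i₁ , move ℓ₂₃ e i₂ , move ℓ₃₄ e i₃ , move s₄ e i₄)
    go (x , inj₂ (i₁ , i₂ , i₃ , i₄)) = let B' , e = pre-lattice (a x) B sub in
      rotated x B' e (move s₁ e i₁ , move s₂ e i₂ , move s₃ e i₃ , move ℓ₂₄ e i₄)

-- The lattices 2sZ⁴ have three flag orbits

V-half : ∀ {x} → V x → Even (head x) → Half x
V-half {v4 a b c d} ((k , p) , (l , q) , (m , s)) (n , e) =
  v4 n (n - k) (n - l) (n - m) , v4≡ e (f p) (f q) (f s)
  where
  f : ∀ {b k} → a - b ≡ + 2 * k → b ≡ + 2 * (n - k)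
  f {b} {k} p = trans (minuend {a} p) (trans (cong (_- + 2 * k) e) (l' n k))
    where l' : ∀ n k → + 2 * n - + 2 * k ≡ + 2 * (n - k)
          l' = solve-∀

-- All coordinates of `x` are odd, so the inner product is congruent to the coordinate sum of `z`,
-- and thus to its norm, modulo 2.
V-odd-dot : ∀ {x z} → V x → Odd (head x) → Even (dot x z - norm2 z)
V-odd-dot {v4 a b c d} {v4 e f g h} ((k , p) , (l , q) , (m , s)) (n , o)
  rewrite minuend {a} p | minuend {a} q | minuend {a} s | o =
  subst Even (i n k l m e f g h (norm2 (v4 e f g h))) (even-- (n * (e + (f + (g + h))) - k * f - l * g - m * h , refl) (norm≡sum e f g h))
  where
  i : ∀ n k l m e f g h N → + 2 * (n * (e + (f + (g + h))) - k * f - l * g - m * h) - (N - (e + (f + (g + h)))) ≡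
    (+ 1 + + 2 * n) * e + ((+ 1 + + 2 * n - + 2 * k) * f + ((+ 1 + + 2 * n - + 2 * l) * g + ((+ 1 + + 2 * n - + 2 * m) * h + + 0))) - N
  i = solve-∀

perp-half : ∀ {y z} → V y → norm2 z ≡ + 1 → dot y z ≡ + 0 → Half y
perp-half {y} {z} v n o = go (parity (head y))
  where
  go : Even (head y) ⊎ Odd (head y) → Half y
  go (inj₁ e) = V-half v e
  go (inj₂ h) = let k , e = V-odd-dot {y} {z} v h in
    ⊥-elim (two≢one (- k) (trans (l k) (trans (cong -_ (sym e)) (cong₂ (λ a b → - (a - b)) o n))))
    where l : ∀ k → + 2 * (- k) ≡ - (+ 2 * k)
          l = solve-∀

-- If N fixes the line of a coordinate vector up to Z⁴, then N is a signed permutation: the other coordinate vectors are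
-- mapped to vectors orthogonal to a unit vector, which excludes odd coordinates.
module _ (g : W) (z : Pt) (gz : g ⊢ ((+ 2) ·v z) ↦ ((+ 2) ·v e₁)) where
  private
    z-unit : norm2 z ≡ + 1
    z-unit = cancel4 (trans (sym (norm-· (+ 2) z)) (sym (↦-dot g {(+ 2) ·v z} {(+ 2) ·v e₁} {(+ 2) ·v z} {(+ 2) ·v e₁} gz gz)))

    back : ∀ e → dot e e₁ ≡ + 0 → Σ Pt λ y → tr (mat g) ·m e ≡ (+ 2) ·v y
    back e o = let y , v , p = onV g ((+ 2) ·v e) (V-2· e)
                   w , h = perp-half {y} {z} v z-unit (cancel2 (trans (sym (dot-·ʳ y (+ 2) z)) (trans (sym (↦-dot g p gz))
                     (trans (dot-·ˡ (+ 2) e ((+ 2) ·v e₁)) (cong (+ 2 *_) (trans (dot-·ʳ e (+ 2) e₁) (cong (+ 2 *_) o)))))))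
      in w , 2v-cancel (trans (sym (·m-· (tr (mat g)) (+ 2) e)) (trans (↦-tr g p) (cong ((+ 2) ·v_) h)))

    w₁ = z
    h₁ : tr (mat g) ·m e₁ ≡ (+ 2) ·v w₁
    h₁ = 2v-cancel (trans (sym (·m-· (tr (mat g)) (+ 2) e₁)) (↦-tr g gz))
    w₂ = proj₁ (back e₂ refl)
    h₂ = proj₂ (back e₂ refl)
    w₃ = proj₁ (back e₃ refl)
    h₃ = proj₂ (back e₃ refl)
    w₄ = proj₁ (back e₄ refl)
    h₄ = proj₂ (back e₄ refl)

    inverse-integral : ∀ y → tr (mat g) ·m y ≡ (+ 2) ·v lincomb y (v4 w₁ w₂ w₃ w₄)
    inverse-integral y = trans (cong (tr (mat g) ·m_) (e-expand y)) (trans (·m-lincomb (tr (mat g)) y idRows)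
      (trans (cong (lincomb y) (cong₂ _∷_ h₁ (cong₂ _∷_ h₂ (cong₂ _∷_ h₃ (cong₂ _∷_ h₄ refl))))) (lincomb-· (+ 2) y (v4 w₁ w₂ w₃ w₄))))

    integral : ∀ y → g ⊢ y ↦ v4 (dot y w₁) (dot y w₂) (dot y w₃) (dot y w₄)
    integral y = coords (mat g ·m y) (c e₁ w₁ h₁) (c e₂ w₂ h₂) (c e₃ w₃ h₃) (c e₄ w₄ h₄)
      where
      c : ∀ e w → tr (mat g) ·m e ≡ (+ 2) ·v w → dot (mat g ·m y) e ≡ + 2 * dot y w
      c e w h = trans (adjoint (mat g) y e) (trans (cong (dot y) h) (dot-·ʳ y (+ 2) w))
      coords : ∀ (u : Pt) {p q r s} → dot u e₁ ≡ + 2 * p → dot u e₂ ≡ + 2 * q → dot u e₃ ≡ + 2 * r → dot u e₄ ≡ + 2 * s → u ≡ (+ 2) ·v v4 p q r s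
      coords (v4 a b c d) i j k l = v4≡ (trans (sym (dot-e₁ a b c d)) i) (trans (sym (dot-e₂ a b c d)) j) (trans (sym (dot-e₃ a b c d)) k) (trans (sym (dot-e₄ a b c d)) l)

  stable : ∀ d → pre g (d ·P AllPts) ≐ (d ·P AllPts)
  stable d = (λ { t (_ , (y , _ , refl) , p) → lincomb y (v4 w₁ w₂ w₃ w₄) , tt , ↦-inj g p (↦-· g (+ d) (tr-↦ g (inverse-integral y))) }) ,
    (λ { t (y , _ , refl) → _ , (v4 (dot y w₁) (dot y w₂) (dot y w₃) (dot y w₄) , tt , refl) , ↦-· g (+ d) (integral y) })

idMat-act : ∀ x → map ((+ 2) ·v_) idRows ·m x ≡ (+ 2) ·v x
idMat-act x = trans (tr-·m (map ((+ 2) ·v_) idRows) x) (trans (lincomb-· (+ 2) x idRows) (cong ((+ 2) ·v_) (sym (e-expand x))))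

idW : W
idW = record { mat = map ((+ 2) ·v_) idRows ; iso = λ x → trans (cong norm2 (idMat-act x)) (norm-· (+ 2) x)
             ; presV = λ x v → x , v , idMat-act x ; presD = λ x d → x , d , idMat-act x }

s₀ : Root
s₀ = short 𝟙 V𝟙 refl

double-V : ∀ s y → V ((+ (2 ℕ.* s)) ·v y)
double-V s y = subst V (trans (·v-assoc (+ 2) (+ s) y) (cong (_·v y) (sym (ℤP.pos-* 2 s)))) (V-2· ((+ s) ·v y))

scaled-V : ∀ s → ((2 ℕ.* s) ·P AllPts) ⊆ V
scaled-V s x (y , _ , refl) = double-V s y

module Cubic (s : ℕ) (s≥1 : s ≥ 1) where
  private
    instance
      nz : ℕ.NonZero s
      nz = ℕ.>-nonZero s≥1

    Q : Pred
    Q = (2 ℕ.* s) ·P AllPts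

    -- The three frames of norm-4 vectors of `V` are the doubled coordinate vectors, the sign
    -- vectors with an even number of minus signs, and those with an odd number. The reflection `s₂`
    -- sends `2e₁` to `𝟙` and `s₀` sends it to the negative of the root of `s₂`, which gives the
    -- second and the third frame.
    a : Fin 3 → W
    a zero = idW
    a 1F = reflect s₂
    a 2F = reflect s₀

    pre-id : pre idW Q ≐ Q
    pre-id = (λ { t (x , q , p) → subst Q (↦-unique idW {t} {x} {t} p (idMat-act t)) q }) , (λ t q → t , q , idMat-act t)

    not-in-Q : ∀ (u : Pt) → (∀ k → + 2 * k ≢ head u) → ¬ Q ((+ s) ·v u)
    not-in-Q (v4 u _ _ _) ne (v4 y _ _ _ , _ , e) = ne y (sym (ℤP.*-cancelˡ-≡ (+ s) u (+ 2 * y) (trans (cong head e) (trans (cong (_* y) (ℤP.pos-* 2 s)) (l (+ s) y)))))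
      where l : ∀ s y → + 2 * s * y ≡ s * (+ 2 * y)
            l = solve-∀

    two≢-one : ∀ k → + 2 * k ≢ - + 1
    two≢-one k e = two≢one (- k) (trans (l k) (cong -_ e))
      where l : ∀ k → + 2 * (- k) ≡ - (+ 2 * k)
            l = solve-∀

    scaled-act : ∀ ρ u t → k ρ * dot u (r ρ) ≡ + 2 * t → reflect ρ ⊢ ((+ s) ·v u) ↦ ((+ s) ·v (u -v (t ·v r ρ)))
    scaled-act ρ u t e = ↦-· (reflect ρ) (+ s) {u} {u -v (t ·v r ρ)} (refl-act (r ρ) (k ρ) e)

    double-e₁ : ∀ y → Q ((+ s) ·v ((+ 2) ·v y))
    double-e₁ y = y , tt , trans (·v-assoc (+ s) (+ 2) y) (cong (_·v y) (trans (ℤP.*-comm (+ s) (+ 2)) (sym (ℤP.pos-* 2 s))))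

    𝟙∈ : pre (reflect s₂) Q ((+ s) ·v 𝟙)
    𝟙∈ = _ , double-e₁ e₁ , scaled-act s₂ 𝟙 (+ 1) refl

    q∈ : pre (reflect s₀) Q ((+ s) ·v r s₂)
    q∈ = _ , double-e₁ ((- + 1) ·v e₁) , scaled-act s₀ (r s₂) (+ 1) refl

    q∉ : ¬ pre (reflect s₂) Q ((+ s) ·v r s₂)
    q∉ (y , q , p) = not-in-Q (r s₂ -v ((+ 2) ·v r s₂)) two≢one (subst Q (↦-unique (reflect s₂) {(+ s) ·v r s₂} {y} {(+ s) ·v (r s₂ -v ((+ 2) ·v r s₂))} p (scaled-act s₂ (r s₂) (+ 2) refl)) q)

    apart : ∀ i j → pre (a i) Q ≐ pre (a j) Q → i ≡ j
    apart = pairwise (λ i → pre (a i) Q)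
      (λ e → not-in-Q 𝟙 two≢one (proj₁ pre-id ((+ s) ·v 𝟙) (proj₂ e ((+ s) ·v 𝟙) 𝟙∈)))
      (λ e → not-in-Q (r s₂) two≢-one (proj₁ pre-id ((+ s) ·v r s₂) (proj₂ e ((+ s) ·v r s₂) q∈)))
      (λ e → q∉ (proj₂ e ((+ s) ·v r s₂) q∈))

    module _ (g : W) where
      f = proj₁ (onV g ((+ 2) ·v e₁) (V-2· e₁))
      fv : V f
      fv = proj₁ (proj₂ (onV g ((+ 2) ·v e₁) (V-2· e₁)))
      gf : g ⊢ f ↦ ((+ 2) ·v e₁)
      gf = proj₂ (proj₂ (onV g ((+ 2) ·v e₁) (V-2· e₁)))

      -- `f` is the vector that `g` sends to `2e₁`. If a reflection makes `f` even, then `g`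
      -- composed with that reflection sends an even vector to `2e₁`, and `stable` applies to the
      -- composite.
      by-reflection : ∀ ρ t → k ρ * dot f (r ρ) ≡ + 2 * t → V (f -v (t ·v r ρ)) → Even (head (f -v (t ·v r ρ))) → pre g Q ≐ pre (reflect ρ) Q
      by-reflection ρ t e v h = ≐-trans (≐-sym (involution ρ (pre-V g (scaled-V s)))) (pre-cong (reflect ρ)
        (≐-trans (≐-sym (pre-∘ g (reflect ρ) (scaled-V s))) (stable (g ∘w reflect ρ) (proj₁ half) sends (2 ℕ.* s))))
        where
        half = V-half v h
        f' = f -v (t ·v r ρ)
        sends : (g ∘w reflect ρ) ⊢ ((+ 2) ·v proj₁ half) ↦ ((+ 2) ·v e₁)
        sends = ↦-∘ g (reflect ρ) {(+ 2) ·v proj₁ half} {f} {(+ 2) ·v e₁} (subst (reflect ρ ⊢_↦ f) (proj₂ half) (undo (proj₂ (involution ρ {_≡ f} (λ { x refl → fv })) f refl))) gf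
          where
          undo : pre (reflect ρ) (pre (reflect ρ) (_≡ f)) f → reflect ρ ⊢ f' ↦ f
          undo (y , (_ , refl , q) , p) = subst (reflect ρ ⊢_↦ f) (act≡ ρ {f} {y} p e) q

      cover : Σ (Fin 3) λ i → pre g Q ≐ pre (a i) Q
      cover = go (parity (head f))
        where
        t₂ = proj₁ (coeffV s₂ f fv)
        t₀ = proj₁ (coeffV s₀ f fv)
        e₂' = proj₁ (proj₂ (coeffV s₂ f fv))
        e₀' = proj₁ (proj₂ (coeffV s₀ f fv))
        diff : t₀ ≡ t₂ + head f
        diff = cancel2 (trans (sym e₀') (trans (lem f) (trans (cong (_+ + 2 * head f) e₂') (sym (ℤP.*-distribˡ-+ (+ 2) t₂ (head f))))))
          where
          l : ∀ a b c d → + 1 * (a * + 1 + (b * + 1 + (c * + 1 + (d * + 1 + + 0)))) ≡ + 1 * (a * (- + 1) + (b * + 1 + (c * + 1 + (d * + 1 + + 0)))) + + 2 * a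
          l = solve-∀
          lem : ∀ f → + 1 * dot f 𝟙 ≡ + 1 * dot f (r s₂) + + 2 * head f
          lem (v4 a b c d) = l a b c d
        head₂ : ∀ t (f : Pt) → head (f -v (t ·v r s₂)) ≡ head f + t
        head₂ t (v4 a _ _ _) = l a t
          where l : ∀ a t → a - t * (- + 1) ≡ a + t
                l = solve-∀
        head₀ : ∀ t (f : Pt) → head (f -v (t ·v 𝟙)) ≡ head f - t
        head₀ t (v4 a _ _ _) = l a t
          where l : ∀ a t → a - t * + 1 ≡ a - t
                l = solve-∀
        go : Even (head f) ⊎ Odd (head f) → Σ (Fin 3) λ i → pre g Q ≐ pre (a i) Q
        go (inj₁ h) = zero , ≐-trans (stable g (proj₁ hf) (subst (g ⊢_↦ ((+ 2) ·v e₁)) (proj₂ hf) gf) (2 ℕ.* s)) (≐-sym pre-id)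
          where hf = V-half fv h
        -- The reflection `s₂` changes the first coordinate of `f` to `head f + t₂` and `s₀` changes
        -- it to `- t₂`. As `head f` is odd, exactly one of these is even.
        go (inj₂ o) = go' (parity t₂)
          where
          go' : Even t₂ ⊎ Odd t₂ → Σ (Fin 3) λ i → pre g Q ≐ pre (a i) Q
          go' (inj₂ ot) = 1F , by-reflection s₂ t₂ e₂' (V-- fv (V-· t₂ {r s₂} Vρδ₂₃)) (subst Even (sym (head₂ t₂ f)) (pr-+ {true} {true} o ot))
          go' (inj₁ et) = 2F , by-reflection s₀ t₀ e₀' (V-- fv (V-· t₀ {𝟙} V𝟙))
            (subst Even (sym (trans (head₀ t₀ f) (trans (cong (λ t → head f - t) diff) (l (head f) t₂)))) (even-neg et))
            where l : ∀ a t → a - (t + a) ≡ - t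
                  l = solve-∀

  cubic-three : ThreeLattices Q
  cubic-three = a , apart , cover

-- Conjugation by ρ

module _ (w : W) where
  private
    image : ∀ e → D (ρ e) → Σ Pt λ u → mat w ·m ρ e ≡ (+ 2) ·v u
    image e d = let u , _ , p = presD w (ρ e) d in u , p

    u₁ = image e₁ (+ 1 , refl)
    u₂ = image e₂ (+ 1 , refl)
    u₃ = image e₃ (+ 0 , refl)
    u₄ = image e₄ (+ 0 , refl)

    us : Vec Pt 4
    us = v4 (proj₁ u₁) (proj₁ u₂) (proj₁ u₃) (proj₁ u₄)

    m : Vec Pt 4
    m = tr (map ρ us)

    2m : ∀ x → (+ 2) ·v (m ·m x) ≡ ρ (mat w ·m ρ x)
    2m x = trans (cong ((+ 2) ·v_) (trans (tr-·m (map ρ us) x) (sym (ρ-lincomb x us))))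
      (trans (sym (ρ-· (+ 2) (lincomb x us))) (cong ρ (trans (sym (lincomb-· (+ 2) x us))
        (sym (trans (cong (λ t → mat w ·m ρ t) (e-expand x)) (trans (cong (mat w ·m_) (ρ-lincomb x idRows))
          (trans (·m-lincomb (mat w) x (map ρ idRows)) (cong (lincomb x)
            (cong₂ _∷_ (proj₂ u₁) (cong₂ _∷_ (proj₂ u₂) (cong₂ _∷_ (proj₂ u₃) (cong₂ _∷_ (proj₂ u₄) refl))))))))))))

    norm-ρ : ∀ x → norm2 (ρ x) ≡ + 2 * norm2 x
    norm-ρ x = trans (ρ-adjoint x (ρ x)) (trans (cong (dot x) (ρρ x)) (dot-·ʳ x (+ 2) x))

  -- Conjugation by ρ, whose inverse is half of ρ; it preserves `W` because ρ exchanges `V` and `D`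
  -- up to scale. This is the diagram automorphism of F₄, and it exchanges reflections in long and
  -- short roots.
  θ : W
  θ = record
    { mat = m
    ; iso = λ x → cancel4 (trans (sym (norm-· (+ 2) (m ·m x))) (trans (cong norm2 (2m x)) (trans (norm-ρ (mat w ·m ρ x))
        (trans (cong (+ 2 *_) (trans (iso w (ρ x)) (cong (+ 4 *_) (norm-ρ x)))) (l (norm2 x))))))
    ; presV = λ x v → let δ , d , p = V⇒2D {x} v ; δ' , d' , q = presD w δ d in ρ δ' , D⇒Vρ {δ'} d' ,
        2v-cancel (trans (2m x) (trans (cong (λ t → ρ (mat w ·m t)) p) (trans (cong ρ (trans (·m-· (mat w) (+ 2) δ) (cong ((+ 2) ·v_) q)))
          (trans (ρ-· (+ 2) ((+ 2) ·v δ')) (cong ((+ 2) ·v_) (ρ-· (+ 2) δ'))))))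
    ; presD = λ x d → let v , vv , q = presV w (ρ x) (D⇒Vρ {x} d) ; δ , dδ , p = V⇒2D {v} vv in δ , dδ ,
        2v-cancel (trans (2m x) (trans (cong ρ q) (trans (ρ-· (+ 2) v) (cong ((+ 2) ·v_) p))))
    }
    where l : ∀ n → + 2 * (+ 4 * (+ 2 * n)) ≡ + 4 * (+ 4 * n)
          l = solve-∀

  private
    m-ρ : ∀ x → m ·m ρ x ≡ ρ (mat w ·m x)
    m-ρ x = 2v-cancel (trans (2m (ρ x)) (trans (cong (λ t → ρ (mat w ·m t)) (ρρ x)) (trans (cong ρ (·m-· (mat w) (+ 2) x)) (ρ-· (+ 2) (mat w ·m x)))))

  θ-↦ : ∀ {x y} → w ⊢ x ↦ y → θ ⊢ ρ x ↦ ρ y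
  θ-↦ {x} {y} p = trans (m-ρ x) (trans (cong ρ p) (ρ-· (+ 2) y))

  ↦-θ : ∀ {x y} → θ ⊢ ρ x ↦ ρ y → w ⊢ x ↦ y
  ↦-θ {x} {y} p = ρ-inj (trans (sym (m-ρ x)) (trans p (sym (ρ-· (+ 2) y))))

ρim-cong : ∀ {K K'} → K ≐ K' → ρim K ≐ ρim K'
ρim-cong (p , q) = (λ { y (x , k , e) → x , p x k , e }) , (λ { y (x , k , e) → x , q x k , e })

ρim-reflects : ∀ {K K'} → ρim K ≐ ρim K' → K ≐ K'
ρim-reflects {K} {K'} (p , q) =
  (λ x k → let x' , k' , e = p (ρ x) (x , k , refl) in subst K' (sym (ρ-inj {x} {x'} e)) k') ,
  (λ x k → let x' , k' , e = q (ρ x) (x , k , refl) in subst K (sym (ρ-inj {x} {x'} e)) k')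

pre-θ : ∀ w {K} → K ⊆ V → pre (θ w) (ρim K) ≐ ρim (pre w K)
pre-θ w {K} s = (λ { t (_ , (x , k , refl) , p) → let u , _ , q = onV w x (s x k) in u , (x , k , q) , ↦-inj (θ w) p (θ-↦ w {u} {x} q) }) ,
  (λ { t (u , (x , k , q) , refl) → ρ x , (x , k , refl) , θ-↦ w {u} {x} q })

-- As ρ has square 2, `θ` undoes itself. So each lattice obtained from `ρim K` is the ρ-image of one
-- obtained from `K`, and the numbers of lattices agree.
pre-ρ : ∀ g {K} → K ⊆ V → pre g (ρim K) ≐ ρim (pre (θ g) K)
pre-ρ g {K} s =
  (λ { t (_ , (x , k , refl) , p) → let u , _ , q = onV (θ g) x (s x k) in u , (x , k , q) ,
       2v-cancel (trans (sym (ρρ t)) (trans (cong ρ (↦-inj (θ g) (subst (θ g ⊢ ρ t ↦_) (ρρ x) (θ-↦ g {t} {ρ x} p)) (↦-· (θ g) (+ 2) q))) (ρ-· (+ 2) u))) }) ,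
  (λ { t (u , (x , k , q) , refl) → ρ x , (x , k , refl) ,
       ↦-θ g {ρ u} {ρ x} (subst₂ (θ g ⊢_↦_) (sym (ρρ u)) (sym (ρρ x)) (↦-· (θ g) (+ 2) q)) })

threeLattices-ρ : ∀ {K} → K ⊆ V → ThreeLattices K → ThreeLattices (ρim K)
threeLattices-ρ s (a , apart , cover) = (λ i → θ (a i)) ,
  (λ i j e → apart i j (ρim-reflects (≐-trans (≐-sym (pre-θ (a i) s)) (≐-trans e (pre-θ (a j) s))))) ,
  λ g → let i , e = cover (θ g) in i , ≐-trans (pre-ρ g s) (≐-trans (ρim-cong e) (≐-sym (pre-θ (a i) s)))

rotated-V : ∀ s → ρim ((2 ℕ.* s) ·P AllPts) ⊆ V
rotated-V s x (_ , (y , _ , refl) , refl) = subst V (sym (ρ-· (+ (2 ℕ.* s)) y)) (double-V s (ρ y))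

theorem9 : (T : Kind) (B : Vec Pt 4) → LatticeGroup T B →
    (ThreeFlagOrbits T B →
    Σ ℕ λ s → s ≥ 1 × (Conj T B (cubicBasis s) ⊎ Conj T B (L2Basis s)))
    × ((Σ ℕ λ s → s ≥ 1 × (Conj T B (cubicBasis s) ⊎ Conj T B (L2Basis s))) →
    ThreeFlagOrbits T B)
theorem9 T B lg = (λ three → Forward.conclusion T B sub (proj₂ lg) (three⇒lattices T B sub three)) ,
  λ { (s , s≥1 , inj₁ c) → back (scaled-V s) (cubic≐ s) (Cubic.cubic-three s s≥1) c
    ; (s , s≥1 , inj₂ c) → back (rotated-V s) (L2≐ s) (threeLattices-ρ (scaled-V s) (Cubic.cubic-three s s≥1)) c }
  where
  sub : InLat B ⊆ V
  sub = latticeGroup-V T B lg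
  back : ∀ {B' K} → K ⊆ V → InLat B' ≐ K → ThreeLattices K → Conj T B B' → ThreeFlagOrbits T B
  back {B'} {K} s e three (g , sy , cj) = go (Sym⇒Gp T sy) cj
    where
    go : (Σ Gp λ h → toAff h ≡ g) → ConjBy g B B' → ThreeFlagOrbits T B
    go (h , refl) cj = lattices⇒three T B sub
      (threeLattices-conj (lin h) sub (λ x k → s x (proj₁ e x k)) cj (threeLattices-cong (≐-sym e) three))
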